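{- There is a randomized algorithm which, given independence-oracle access to two matroids $\mathcal{M}_1=(V,\mathcal{I}_1)$ and $\mathcal{M}_2=(V,\mathcal{I}_2)$ on a common ground set $V$ with $|V|=n$, with high probability uses $O(n^{6/5}r^{3/5}\log^{4/5} r)$ independence queries and solves the matroid intersection problem, i.e. outputs a maximum-cardinality set $S\in\mathcal{I}_1\cap\mathcal{I}_2$, where $r$ denotes the size of such a set. In particular, when $r=\Theta(n)$, the number of queries is $\tilde O(n^{9/5})$.
   Context: A matroid $\mathcal{M}=(V,\mathcal{I})$ consists of a finite ground set $V$ and a nonempty family $\mathcal{I}\subseteq 2^V$ of independent sets that is downward closed and satisfies the exchange property (if $A,B\in\mathcal{I}$ with $|A|<|B|$, then there is $v\in B\setminus A$ with $A\cup\{v\}\in\mathcal{I}$). In the matroid intersection problem, we are given two matroids on the same ground set $V$ of size $n$ and must find a largest common independent set $S\in\mathcal{I}_1\cap\mathcal{I}_2$; $r$ denotes its size. Access to the matroids is only through independence oracles: given $X\subseteq V$ and $i\in\{1,2\}$, the oracle answers whether $X\in\mathcal{I}_i$. The cost of an algorithm is the number of such independence queries it makes. "With high probability" means with probability at least $1-n^{ -c}$ for an arbitrarily large constant $c$; $\tilde O$ hides polylogarithmic factors in $n$. -}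

module Defs where

open import Data.Bool using (Bool; true; false; if_then_else_; _∧_)
open import Data.Nat using (ℕ; zero; suc; _<_; _≡ᵇ_)
open import Data.Fin using (Fin)
open import Data.Fin.Subset using (Subset; _⊆_; _∈_; _∉_; _∪_; ⁅_⁆; ∣_∣)
open import Data.Product using (Σ; ∃; _×_)
open import Data.Integer using (+_)
open import Data.Rational using (ℚ; 0ℚ; 1ℚ; ½; _+_; _*_; _/_)
open import Relation.Binary.PropositionalEquality using (_≡_)

-- Matroids on the ground set V = Fin n, given by their independence
-- predicate (= the independence oracle) I : Subset n → Bool.

record IsMatroid {n : ℕ} (I : Subset n → Bool) : Set where
  field
    nonempty : ∃ λ X → I X ≡ true
    downward : ∀ X Y → X ⊆ Y → I Y ≡ true → I X ≡ true
    exchange : ∀ A B → I A ≡ true → I B ≡ true → ∣ A ∣ < ∣ B ∣ →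
               ∃ λ v → v ∈ B × v ∉ A × I (A ∪ ⁅ v ⁆) ≡ true

CommonIndep : {n : ℕ} → (Subset n → Bool) → (Subset n → Bool) → Subset n → Set
CommonIndep I₁ I₂ S = (I₁ S ≡ true) × (I₂ S ≡ true)

IsMaxCommonSize : {n : ℕ} → (Subset n → Bool) → (Subset n → Bool) → ℕ → Set
IsMaxCommonSize I₁ I₂ r =
  (∃ λ S → CommonIndep I₁ I₂ S × ∣ S ∣ ≡ r) ×
  (∀ S → CommonIndep I₁ I₂ S → ∣ S ∣ Data.Nat.≤ r)

-- Randomized query algorithms for ground set Fin n: finite decision
-- trees with independence-query nodes (to matroid 1 or 2), fair-coin
-- nodes and output leaves.

data QTree (n : ℕ) : Set where
  output : Subset n → QTree n
  ask₁   : Subset n → (Bool → QTree n) → QTree n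
  ask₂   : Subset n → (Bool → QTree n) → QTree n
  coin   : (Bool → QTree n) → QTree n

probRun : {n : ℕ} → (I₁ I₂ : Subset n → Bool) → (P : Subset n → ℕ → Bool) →
          ℕ → QTree n → ℚ
probRun I₁ I₂ P k (output S) = if P S k then 1ℚ else 0ℚ
probRun I₁ I₂ P k (ask₁ X t) = probRun I₁ I₂ P (suc k) (t (I₁ X))
probRun I₁ I₂ P k (ask₂ X t) = probRun I₁ I₂ P (suc k) (t (I₂ X))
probRun I₁ I₂ P k (coin t)   =
  ½ * (probRun I₁ I₂ P k (t true) + probRun I₁ I₂ P k (t false))

Pr : {n : ℕ} → (I₁ I₂ : Subset n → Bool) → (P : Subset n → ℕ → Bool) →
     QTree n → ℚ
Pr I₁ I₂ P T = probRun I₁ I₂ P 0 T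

toℚ : ℕ → ℚ
toℚ m = + m / 1

module Submission where

-- Phase 1 is a push-relabel scheme: S₁ is a greedy basis of the first matroid by increasing label, S ⊆ S₁ a
-- greedy basis of the second one by decreasing label, and treating all active elements S₁ ∖ S of one label
-- at once raises a potential by their number. Phase 2 is Cunningham's algorithm with persistent distance
-- labels, so that an augmentation costs Õ(n) queries and all relabellings together n times the largest label.
-- By weak duality at a sparse level, labels up to D leave a deficit O(r/D). Phase 3 closes the remaining
-- deficit by single augmentations of cost Õ(n √r): random samples of S tell the elements with few exchange
-- edges to unvisited elements, whose edges are all learnt, from those with many; a backward search
-- through the former either finds an augmenting path, or a certificate of optimality, or reaches one of the
-- latter, which at once visits about √r new elements.
-- With g ≈ r^(1/4) and label bounds g and g³ the total is Õ(n g³), which is within the bound since g⁴ ≤ n leaves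
-- a factor n^(1/4) for the logarithms. Randomness affects only the number of queries, never correctness.

-- Every phase gets the budget n g³ up to logarithms. Phase 1 treats a level only while it holds g²
-- active elements: its potential stays O(g r) = O(g⁵), so there are O(g³) rounds of O(n) queries,
-- and the sparse levels left behind hold O(g³) active elements in all. Together with the O(r/g)
-- elements lost across a level, this bounds the augmentations of phase 2, each of which throws the
-- search tree away. The O(r/g³) = O(g) elements missing after phase 2 are too few to justify
-- further relabelling. The obstacle in phase 3 is that learning the whole second exchange graph may
-- cost n r queries. A long circuit is therefore learnt only once its element is reached from a
-- source, and then its length pays for it. Since r is unknown, a greedy common independent set, at
-- least half as large as an optimum, fixes g. The potential of phase 1 also counts a basis of the
-- first matroid, whose rank may far exceed r; truncating that matroid at twice the greedy size
-- cures this without losing any common independent set.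

open import Defs
open import Data.Bool using (Bool; true; false; T; if_then_else_; _∧_; _∨_; not)
open import Data.Empty using (⊥; ⊥-elim)
open import Data.Fin using (Fin; zero; suc)
open import Data.Fin.Subset using (Subset; ∣_∣)
open import Data.List using (List; []; _∷_; _++_; length; map; take; drop)
open import Data.Maybe using (Maybe; just; nothing; is-just; fromMaybe)
open import Data.Product using (∃; _×_; _,_; proj₁; proj₂)
open import Data.Sum using (_⊎_; inj₁; inj₂)
open import Data.Unit using (tt)
open import Data.Vec using (tabulate; lookup)
open import Function using (_∘_)
open import Relation.Nullary using (¬_; does; yes; no)
open import Relation.Binary.PropositionalEquality hiding (J)

-- Finite sets as Boolean predicates, their cardinalities and enumerations.

module FiniteSets where
  open import Data.Nat
  open import Data.Nat.Properties
  open import Data.Fin.Properties using () renaming (_≟_ to _≟F_)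
  open import Data.List.Properties using (length-map)
  open import Data.Bool.Properties using (∨-assoc)
  open import Relation.Nullary.Decidable using (dec-true; dec-false)
  open import Data.Nat.Tactic.RingSolver

  -- Linear inequalities are proved by exhibiting the combination of hypotheses:
  -- a ≤ b together with p + b + s ≡ q + a.
  lin : ∀ {a b p q} s → a ≤ b → p + b + s ≡ q + a → p ≤ q
  lin {a} {b} {p} {q} s h e = +-cancelʳ-≤ b p q (begin
      p + b     ≤⟨ m≤m+n _ s ⟩
      p + b + s ≡⟨ e ⟩
      q + a     ≤⟨ +-monoʳ-≤ q h ⟩
      q + b     ∎)
    where open ≤-Reasoning

  BSet : ℕ → Set
  BSet n = Fin n → Bool

  true≢false : {A : Set} {b : Bool} → b ≡ true → b ≡ false → A
  true≢false refl ()

  bool-case : ∀ b → b ≡ true ⊎ b ≡ false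
  bool-case true  = inj₁ refl
  bool-case false = inj₂ refl

  not-true : ∀ {b} → ¬ (b ≡ true) → b ≡ false
  not-true {true}  h = ⊥-elim (h refl)
  not-true {false} h = refl

  # : Bool → ℕ
  # true  = 1
  # false = 0

  #-mono : ∀ {b c} → (b ≡ true → c ≡ true) → # b ≤ # c
  #-mono {true}  h rewrite h refl = ≤-refl
  #-mono {false} h = z≤n

  ∨-elim : ∀ {A : Set} b {c} → b ∨ c ≡ true → (b ≡ true → A) → (c ≡ true → A) → A
  ∨-elim true  h f g = f refl
  ∨-elim false h f g = g h

  ∨-introˡ : ∀ {b} c → b ≡ true → b ∨ c ≡ true
  ∨-introˡ c refl = refl

  ∨-introʳ : ∀ b {c} → c ≡ true → b ∨ c ≡ true
  ∨-introʳ true  h = refl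
  ∨-introʳ false h = h

  ∧-split : ∀ b {c} → b ∧ c ≡ true → b ≡ true × c ≡ true
  ∧-split true h = refl , h

  ∧-intro : ∀ {b c} → b ≡ true → c ≡ true → b ∧ c ≡ true
  ∧-intro refl h = h

  not-false : ∀ {b} → not b ≡ true → b ≡ false
  not-false {false} _ = refl

  false-not : ∀ {b} → b ≡ false → not b ≡ true
  false-not refl = refl

  _==_ : ∀ {n} → Fin n → Fin n → Bool
  x == y = does (x ≟F y)

  ==-refl : ∀ {n} (x : Fin n) → (x == x) ≡ true
  ==-refl x = dec-true (x ≟F x) refl

  ==-sound : ∀ {n} {x y : Fin n} → (x == y) ≡ true → x ≡ y
  ==-sound {x = x} {y} h with x ≟F y
  ... | yes p = p

  ==-false : ∀ {n} {x y : Fin n} → x ≢ y → (x == y) ≡ false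
  ==-false {x = x} {y} h = dec-false (x ≟F y) h

  module _ {n : ℕ} where

    infix 4 _∈_ _∉_ _⊆_
    infixl 6 _∪_ _∖_ _⊕_ _⊖_
    infixl 7 _∩_

    _∈_ : Fin n → BSet n → Set
    x ∈ f = f x ≡ true

    _∉_ : Fin n → BSet n → Set
    x ∉ f = f x ≡ false

    _⊆_ : BSet n → BSet n → Set
    f ⊆ g = ∀ x → x ∈ f → x ∈ g

    ∅ full : BSet n
    ∅ _    = false
    full _ = true

    opaque
     _∪_ _∩_ _∖_ : BSet n → BSet n → BSet n
     (f ∪ g) x = f x ∨ g x
     (f ∩ g) x = f x ∧ g x
     (f ∖ g) x = f x ∧ not (g x)

     _⊕_ _⊖_ : BSet n → Fin n → BSet n
     (f ⊕ v) x = f x ∨ (x == v)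
     (f ⊖ v) x = f x ∧ not (x == v)

     ∉-⊆ : ∀ {f g : BSet n} {x} → f ⊆ g → x ∉ g → x ∉ f
     ∉-⊆ {f} {g} {x} s h with f x in e
     ... | true  = true≢false (s x e) h
     ... | false = refl

     ∪-ˡ : ∀ f g → f ⊆ f ∪ g
     ∪-ˡ f g x h = ∨-introˡ (g x) h

     ∪-ʳ : ∀ f g → g ⊆ f ∪ g
     ∪-ʳ f g x h = ∨-introʳ (f x) h

     ∪-elim : ∀ {A : Set} f g {x} → x ∈ f ∪ g → (x ∈ f → A) → (x ∈ g → A) → A
     ∪-elim f g {x} = ∨-elim (f x)

     ∩-ˡ : ∀ f g → f ∩ g ⊆ f
     ∩-ˡ f g x h = proj₁ (∧-split (f x) h)

     ∩-ʳ : ∀ f g → f ∩ g ⊆ g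
     ∩-ʳ f g x h = proj₂ (∧-split (f x) h)

     ∩-in : ∀ f g {x} → x ∈ f → x ∈ g → x ∈ f ∩ g
     ∩-in f g = ∧-intro

     ∖-ˡ : ∀ f g → f ∖ g ⊆ f
     ∖-ˡ f g x h = proj₁ (∧-split (f x) h)

     ∖-ʳ : ∀ f g {x} → x ∈ f ∖ g → x ∉ g
     ∖-ʳ f g {x} h = not-false (proj₂ (∧-split (f x) h))

     ∖-in : ∀ f g {x} → x ∈ f → x ∉ g → x ∈ f ∖ g
     ∖-in f g h k = ∧-intro h (false-not k)

     ⊕-self : ∀ f v → v ∈ f ⊕ v
     ⊕-self f v = ∨-introʳ (f v) (==-refl v)

     ⊕-ˡ : ∀ f v → f ⊆ f ⊕ v
     ⊕-ˡ f v x h = ∨-introˡ (x == v) h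

     ⊕-elim : ∀ {A : Set} f v {x} → x ∈ f ⊕ v → (x ∈ f → A) → (x ≡ v → A) → A
     ⊕-elim f v {x} h k l = ∨-elim (f x) h k (l ∘ ==-sound)

     ⊕-lub : ∀ {f g v} → f ⊆ g → v ∈ g → f ⊕ v ⊆ g
     ⊕-lub {f} {g} {v} s h x k = ⊕-elim f v k (s x) λ { refl → h }

     ⊕-mono : ∀ {f g} v → f ⊆ g → f ⊕ v ⊆ g ⊕ v
     ⊕-mono {f} {g} v s = ⊕-lub (λ x h → ⊕-ˡ g v x (s x h)) (⊕-self g v)

     ⊖-ˡ : ∀ f v → f ⊖ v ⊆ f
     ⊖-ˡ f v x h = proj₁ (∧-split (f x) h)

     ⊖-≢ : ∀ f v {x} → x ∈ f ⊖ v → x ≢ v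
     ⊖-≢ f v {x} h refl = true≢false (==-refl x) (not-false (proj₂ (∧-split (f x) h)))

     ⊖-in : ∀ f v {x} → x ∈ f → x ≢ v → x ∈ f ⊖ v
     ⊖-in f v h k = ∧-intro h (false-not (==-false k))

     ⊖-self : ∀ f v → v ∉ f ⊖ v
     ⊖-self f v with bool-case ((f ⊖ v) v)
     ... | inj₁ h = ⊥-elim (⊖-≢ f v h refl)
     ... | inj₂ h = h

     ⊖-mono : ∀ {f g} v → f ⊆ g → f ⊖ v ⊆ g ⊖ v
     ⊖-mono {f} {g} v s x h = ⊖-in g v (s x (⊖-ˡ f v x h)) (⊖-≢ f v h)

     ⊆-trans : ∀ {f g h : BSet n} → f ⊆ g → g ⊆ h → f ⊆ h
     ⊆-trans s t x k = t x (s x k)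

     ∪-lub : ∀ {f g h : BSet n} → f ⊆ h → g ⊆ h → f ∪ g ⊆ h
     ∪-lub {f} {g} s t x k = ∪-elim f g k (s x) (t x)

  Σ' : ∀ {n} → (Fin n → ℕ) → ℕ
  Σ' {zero}  f = 0
  Σ' {suc n} f = f zero + Σ' (f ∘ suc)

  Σ-mono : ∀ {n} {f g : Fin n → ℕ} → (∀ x → f x ≤ g x) → Σ' f ≤ Σ' g
  Σ-mono {zero}  h = z≤n
  Σ-mono {suc n} h = +-mono-≤ (h zero) (Σ-mono (h ∘ suc))

  Σ-+ : ∀ {n} (f g : Fin n → ℕ) → Σ' (λ x → f x + g x) ≡ Σ' f + Σ' g
  Σ-+ {zero}  f g = refl
  Σ-+ {suc n} f g rewrite Σ-+ (f ∘ suc) (g ∘ suc) =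
    inter (f zero) (g zero) _ _
    where
    inter : ∀ a b c d → a + b + (c + d) ≡ a + c + (b + d)
    inter = solve-∀

  Σ-const : ∀ n c → Σ' {n} (λ _ → c) ≡ n * c
  Σ-const zero c = refl
  Σ-const (suc n) c = cong (c +_) (Σ-const n c)

  Σ-δ : ∀ {n} (v : Fin n) → Σ' (λ x → # (x == v)) ≡ 1
  Σ-δ {suc n} zero = cong suc (trans (lemma n) (*-zeroʳ n))
    where
    lemma : ∀ n → Σ' {n} (λ x → # (suc x == zero)) ≡ n * 0
    lemma n = Σ-const n 0
  Σ-δ {suc n} (suc v) = trans (≤-antisym (Σ-mono λ x → ≤-reflexive (e x)) (Σ-mono λ x → ≤-reflexive (sym (e x)))) (Σ-δ v)
    where
    e : ∀ x → # (suc x == suc v) ≡ # (x == v)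
    e x with x ≟F v
    ... | yes _ = refl
    ... | no _  = refl

  -- Opaque, so that unification never looks inside a cardinality.
  opaque
    card : ∀ {n} → BSet n → ℕ
    card f = Σ' (# ∘ f)

    -- Counting facts reduce to a pointwise inequality between sums of two indicators; unions and
    -- disjoint unions below are instances with `∅` in the spare place.
    card-2 : ∀ {n} {f g h k : BSet n} → (∀ x → # (f x) + # (g x) ≤ # (h x) + # (k x)) →
             card f + card g ≤ card h + card k
    card-2 {f = f} {g} {h} {k} e = begin
      card f + card g ≡⟨ Σ-+ (# ∘ f) (# ∘ g) ⟨
      Σ' (λ x → # (f x) + # (g x)) ≤⟨ Σ-mono e ⟩
      Σ' (λ x → # (h x) + # (k x)) ≡⟨ Σ-+ (# ∘ h) (# ∘ k) ⟩
      card h + card k ∎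
      where open ≤-Reasoning

    card-mono : ∀ {n} {f g : BSet n} → f ⊆ g → card f ≤ card g
    card-mono s = Σ-mono λ x → #-mono (s x)

    card-∅ : ∀ {n} → card {n} ∅ ≡ 0
    card-∅ {n} = trans (Σ-const n 0) (*-zeroʳ n)

    card-full : ∀ {n} → card {n} full ≡ n
    card-full {n} = trans (Σ-const n 1) (*-identityʳ n)

    card-single : ∀ {n} (v : Fin n) → card (λ x → x == v) ≡ 1
    card-single = Σ-δ

  module _ {n : ℕ} where

    card-≤n : (f : BSet n) → card f ≤ n
    card-≤n f = ≤-trans (card-mono {g = full} (λ _ _ → refl)) (≤-reflexive card-full)

    opaque
     unfolding _∪_ _⊕_

     card-union : {f g h : BSet n} → f ⊆ g ∪ h → card f ≤ card g + card h
     card-union {f} {g} {h} s =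
       ≤-trans (≤-reflexive (sym (trans (cong (card f +_) card-∅) (+-identityʳ _))))
               (card-2 {f = f} {∅} {g} {h} pt)
       where
       pt : ∀ x → # (f x) + 0 ≤ # (g x) + # (h x)
       pt x with f x in e
       ... | false = z≤n
       ... | true  with g x | h x | s x e
       ... | true | _ | _ = s≤s z≤n
       ... | false | true | _ = s≤s z≤n

     card-disj : {f g h : BSet n} → f ⊆ h → g ⊆ h → (∀ x → x ∈ f → x ∉ g) → card f + card g ≤ card h
     card-disj {f} {g} {h} s t d =
       ≤-trans (card-2 {f = f} {g} {h} {∅} pt)
               (≤-reflexive (trans (cong (card h +_) card-∅) (+-identityʳ _)))
       where
       pt : ∀ x → # (f x) + # (g x) ≤ # (h x) + 0
       pt x with f x in e | g x in e'
       ... | true  | true  = true≢false e' (d x e)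
       ... | true  | false rewrite s x e = ≤-refl
       ... | false | true  rewrite t x e' = ≤-refl
       ... | false | false = z≤n

     card-split : (f p : BSet n) → card f ≡ card (f ∩ p) + card (f ∖ p)
     card-split f p = ≤-antisym (card-union sub) (card-disj (∩-ˡ f p) (∖-ˡ f p) dis)
       where
       sub : f ⊆ f ∩ p ∪ (f ∖ p)
       sub x h rewrite h with p x
       ... | true = refl
       ... | false = refl
       dis : ∀ x → x ∈ f ∩ p → x ∉ f ∖ p
       dis x h with f x | p x
       ... | true | true = refl
       ... | false | _ = refl

     card-⊕ : (f : BSet n) (v : Fin n) → v ∉ f → card (f ⊕ v) ≡ suc (card f)
     card-⊕ f v h = ≤-antisym
       (≤-trans (card-union {f ⊕ v} {_} {f} (λ x k → ∨-swap (f x) k))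
                (≤-reflexive (cong (_+ card f) (card-single v))))
       (≤-trans (≤-reflexive (cong (_+ card f) (sym (card-single v))))
                (card-disj {λ x → x == v} (λ x e → ∨-introʳ (f x) e) (⊕-ˡ f v)
                  λ x e → subst (_∉ f) (sym (==-sound e)) h))
       where
       ∨-swap : ∀ a {b} → a ∨ b ≡ true → b ∨ a ≡ true
       ∨-swap true {true} _ = refl
       ∨-swap true {false} _ = refl
       ∨-swap false {true} _ = refl

     card-⊕≤ : (f : BSet n) (v : Fin n) → card (f ⊕ v) ≤ suc (card f)
     card-⊕≤ f v with bool-case (f v)
     ... | inj₁ h = m≤n⇒m≤1+n (card-mono (⊕-lub (λ _ k → k) h))
     ... | inj₂ h = ≤-reflexive (card-⊕ f v h)

     card-⊖ : (f : BSet n) (v : Fin n) → v ∈ f → suc (card (f ⊖ v)) ≡ card f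
     card-⊖ f v h = trans (sym (card-⊕ (f ⊖ v) v (⊖-self f v))) (≤-antisym
       (card-mono (⊕-lub (⊖-ˡ f v) h)) (card-mono sub))
       where
       sub : f ⊆ f ⊖ v ⊕ v
       sub x k with x ≟F v
       ... | yes refl = ∨-introʳ (f x ∧ _) refl
       ... | no ne rewrite k = refl

     card-⊖≤ : (f : BSet n) (v : Fin n) → card f ≤ suc (card (f ⊖ v))
     card-⊖≤ f v with bool-case (f v)
     ... | inj₁ h = ≤-reflexive (sym (card-⊖ f v h))
     ... | inj₂ h = m≤n⇒m≤1+n (card-mono λ x k → ⊖-in f v k λ { refl → true≢false k h })

    card-full⊆ : {f g : BSet n} → f ⊆ g → card g ≤ card f → g ⊆ f
    card-full⊆ {f} {g} s le x h with bool-case (f x)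
    ... | inj₁ k = k
    ... | inj₂ k = ⊥-elim (<-irrefl refl (begin-strict
        card f       <⟨ n<1+n _ ⟩
        suc (card f) ≡⟨ card-⊕ f x k ⟨
        card (f ⊕ x) ≤⟨ card-mono (⊕-lub s h) ⟩
        card g       ≤⟨ le ⟩
        card f       ∎))
      where open ≤-Reasoning

  mem : ∀ {n} → List (Fin n) → BSet n
  mem []       x = false
  mem (z ∷ zs) x = (x == z) ∨ mem zs x

  elems : ∀ {n} → BSet n → List (Fin n)
  elems {zero}  f = []
  elems {suc n} f with f zero
  ... | true  = zero ∷ map suc (elems (f ∘ suc))
  ... | false = map suc (elems (f ∘ suc))

  mem-suc : ∀ {n} (zs : List (Fin n)) x → mem (map suc zs) (suc x) ≡ mem zs x
  mem-suc [] x = refl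
  mem-suc (z ∷ zs) x = cong₂ _∨_ (e x z) (mem-suc zs x)
    where
    e : ∀ {n} (x z : Fin n) → (suc x == suc z) ≡ (x == z)
    e x z with x ≟F z
    ... | yes _ = refl
    ... | no _  = refl

  mem-zero : ∀ {n} (zs : List (Fin n)) → mem (map suc zs) zero ≡ false
  mem-zero []       = refl
  mem-zero (z ∷ zs) = mem-zero zs

  mem-elems : ∀ {n} (f : BSet n) x → mem (elems f) x ≡ f x
  mem-elems {suc n} f x with f zero in e
  mem-elems {suc n} f zero    | true  = sym e
  mem-elems {suc n} f (suc x) | true  = trans (mem-suc (elems (f ∘ suc)) x) (mem-elems (f ∘ suc) x)
  mem-elems {suc n} f zero    | false = trans (mem-zero (elems (f ∘ suc))) (sym e)
  mem-elems {suc n} f (suc x) | false = trans (mem-suc (elems (f ∘ suc)) x) (mem-elems (f ∘ suc) x)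

  in-elems : ∀ {n} (f : BSet n) x → x ∈ f → x ∈ mem (elems f)
  in-elems f x h = trans (mem-elems f x) h

  from-elems : ∀ {n} (f : BSet n) x → x ∈ mem (elems f) → x ∈ f
  from-elems f x h = trans (sym (mem-elems f x)) h

  opaque
    unfolding card

    length-elems : ∀ {n} (f : BSet n) → length (elems f) ≡ card f
    length-elems {zero} f = refl
    length-elems {suc n} f with f zero
    ... | true  = cong suc (trans (length-map suc (elems (f ∘ suc))) (length-elems (f ∘ suc)))
    ... | false = trans (length-map suc (elems (f ∘ suc))) (length-elems (f ∘ suc))

  module _ {n : ℕ} where

    mem-++ : ∀ (xs ys : List (Fin n)) x → mem (xs ++ ys) x ≡ mem xs x ∨ mem ys x
    mem-++ [] ys x = refl
    mem-++ (z ∷ xs) ys x = trans (cong ((x == z) ∨_) (mem-++ xs ys x)) (sym (∨-assoc (x == z) _ _))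

    mem-single : ∀ {x z : Fin n} → x ∈ mem (z ∷ []) → x ≡ z
    mem-single {x} {z} m = ∨-elim (x == z) m ==-sound λ ()

    data Distinct : List (Fin n) → Set where
      []  : Distinct []
      _∷_ : ∀ {x xs} → x ∉ mem xs → Distinct xs → Distinct (x ∷ xs)

    find : (xs : List (Fin n)) (p : BSet n) →
           (∃ λ x → x ∈ mem xs × x ∈ p) ⊎ (∀ x → x ∈ mem xs → x ∉ p)
    find [] p = inj₂ λ _ ()
    find (z ∷ xs) p with bool-case (p z)
    ... | inj₁ h = inj₁ (z , ∨-introˡ (mem xs z) (==-refl z) , h)
    ... | inj₂ h with find xs p
    ...   | inj₁ (x , m , k) = inj₁ (x , ∨-introʳ (x == z) m , k)
    ...   | inj₂ k = inj₂ λ x m → ∨-elim (x == z) m (λ e → subst (_∉ p) (sym (==-sound e)) h) (k x)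

    pick : (p : BSet n) → (∃ λ x → x ∈ p) ⊎ (∀ x → x ∉ p)
    pick p with find (elems p) p
    ... | inj₁ (x , _ , k) = inj₁ (x , k)
    ... | inj₂ k = inj₂ λ x → not-true λ h → true≢false h (k x (trans (mem-elems p x) h))

  distinct-map : ∀ {n} {xs : List (Fin n)} → Distinct xs → Distinct (map suc xs)
  distinct-map [] = []
  distinct-map {xs = x ∷ xs} (h ∷ d) = trans (mem-suc xs x) h ∷ distinct-map d

  distinct-elems : ∀ {n} (f : BSet n) → Distinct (elems f)
  distinct-elems {zero} f = []
  distinct-elems {suc n} f with f zero
  ... | true  = mem-zero (elems (f ∘ suc)) ∷ distinct-map (distinct-elems (f ∘ suc))
  ... | false = distinct-map (distinct-elems (f ∘ suc))

-- Independence, spans and exchange along circuits.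

module Matroids where
  open FiniteSets
  open import Data.Nat
  open import Data.Nat.Properties

  record Mat {n : ℕ} (J : BSet n → Bool) : Set where
    field
      J∅   : J ∅ ≡ true
      down : ∀ {f g} → f ⊆ g → J g ≡ true → J f ≡ true
      exch : ∀ {f g} → J f ≡ true → J g ≡ true → card f < card g →
             ∃ λ v → v ∈ g × v ∉ f × J (f ⊕ v) ≡ true

  module MatLemmas {n : ℕ} {J : BSet n → Bool} (mat : Mat J) where
    open Mat mat public

    Ind : BSet n → Set
    Ind f = J f ≡ true

    -- For independent `f` this is membership in the matroid closure of `f`, phrased through the
    -- independence of a single set so that one query settles it.
    Sp : BSet n → Fin n → Set
    Sp f x = x ∈ f ⊎ J (f ⊕ x) ≡ false

    up : ∀ {f g} → f ⊆ g → J f ≡ false → J g ≡ false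
    up {f} {g} s h with J g in e
    ... | false = refl
    ... | true  = true≢false (down s e) h

    Sp-mono : ∀ {f g x} → f ⊆ g → Sp f x → Sp g x
    Sp-mono s (inj₁ h) = inj₁ (s _ h)
    Sp-mono s (inj₂ h) = inj₂ (up (⊕-mono _ s) h)

    Sp-dep : ∀ {f x} → Sp f x → x ∉ f → J (f ⊕ x) ≡ false
    Sp-dep (inj₁ h) k = true≢false h k
    Sp-dep (inj₂ h) k = h

    -- If `g` were larger, exchange would extend `f` by an element of `g`, which spanning excludes.
    -- All rank comparisons below are made in this form, without a rank function.
    rank-≤ : ∀ {f g} → Ind f → Ind g → (∀ x → x ∈ g → Sp f x) → card g ≤ card f
    rank-≤ {f} {g} jf jg sp with card g ≤? card f
    ... | yes p = p
    ... | no p with exch jf jg (≰⇒> p)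
    ...   | v , vg , vf , jv with sp v vg
    ...     | inj₁ h = true≢false h vf
    ...     | inj₂ h = true≢false jv h

    -- `f` spans the elements with property `P`, so no independent set of them is larger than `f`.
    -- Hence `g`, being inside `P` and no smaller, is a basis there. This carries spanning over to a
    -- renewed part of a basis by counting alone.
    spans-by-count : ∀ {f g : BSet n} {P : Fin n → Set} → Ind f → Ind g →
                     (∀ x → P x → Sp f x) → (∀ x → x ∈ g → P x) → card f ≤ card g →
                     ∀ x → P x → Sp g x
    spans-by-count {f} {g} jf jg sp s le x px with bool-case (g x) | bool-case (J (g ⊕ x))
    ... | inj₁ h | _ = inj₁ h
    ... | inj₂ h | inj₂ k = inj₂ k
    ... | inj₂ h | inj₁ k = ⊥-elim (<-irrefl refl (begin-strict
          card g       <⟨ n<1+n _ ⟩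
          suc (card g) ≡⟨ card-⊕ g x h ⟨
          card (g ⊕ x) ≤⟨ rank-≤ jf k (λ y m → ⊕-elim g x m (λ m' → sp y (s y m')) λ { refl → sp y px }) ⟩
          card f       ≤⟨ le ⟩
          card g       ∎))
      where open ≤-Reasoning

    -- `d` bounds the number of exchanges still to be made and so makes the greedy augmentation
    -- structurally recursive.
    extend-gap : ∀ d {f g} → Ind f → Ind g → card g ≤ card f + d → card f ≤ card g →
                 ∃ λ h → f ⊆ h × h ⊆ f ∪ g × Ind h × card g ≤ card h
    extend-gap zero {f} {g} jf jg le _ =
      f , (λ _ k → k) , ∪-ˡ f g , jf , ≤-trans le (≤-reflexive (+-identityʳ _))
    extend-gap (suc d) {f} {g} jf jg le le' with card g ≤? card f
    ... | yes p = f , (λ _ k → k) , ∪-ˡ f g , jf , p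
    ... | no p with exch jf jg (≰⇒> p)
    ...   | v , vg , vf , jv
          with extend-gap d {f ⊕ v} {g} jv jg
                 (≤-trans le (≤-reflexive (trans (+-suc _ d) (cong (_+ d) (sym (card-⊕ f v vf))))))
                 (≤-trans (≤-reflexive (card-⊕ f v vf)) (≰⇒> p))
    ...     | h , s , t , jh , c =
              h , ⊆-trans (⊕-ˡ f v) s ,
              ⊆-trans t (∪-lub (⊕-lub (∪-ˡ f g) (∪-ʳ f g v vg)) (∪-ʳ f g)) , jh , c

    extend : ∀ {f g} → Ind f → Ind g → card f ≤ card g →
             ∃ λ h → f ⊆ h × h ⊆ f ∪ g × Ind h × card g ≤ card h
    extend {f} {g} jf jg le = extend-gap (card g) jf jg (m≤n+m _ _) le

    -- A circuit of A ⊕ v through u is still a circuit of T ⊕ v for T ⊇ A.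
    exchange-circuit : ∀ {A T u v} → A ⊆ T → Ind T → J (A ⊕ v) ≡ false → Ind (A ⊖ u ⊕ v) →
           Ind (T ⊖ u ⊕ v) × u ∈ A × v ∉ T
    exchange-circuit {A} {T} {u} {v} s jT dep ind = result , uA , vT
      where
      vT : v ∉ T
      vT with bool-case (T v)
      ... | inj₂ h = h
      ... | inj₁ h = true≢false (down (⊕-lub s h) jT) dep
      uA : u ∈ A
      uA with bool-case (A u)
      ... | inj₁ h = h
      ... | inj₂ h = true≢false (down (⊕-mono v λ x k → ⊖-in A u k λ { refl → true≢false k h }) ind) dep
      base : BSet n
      base = A ⊖ u ⊕ v
      base⊆ : base ⊆ T ⊖ u ⊕ v
      base⊆ = ⊕-mono v (⊖-mono u s)
      card-target : card (T ⊖ u ⊕ v) ≡ card T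
      card-target = trans (card-⊕ (T ⊖ u) v (∉-⊆ (⊖-ˡ T u) vT)) (card-⊖ T u (s u uA))
      result : Ind (T ⊖ u ⊕ v)
      -- Enlarge `A ⊖ u ⊕ v` by elements of `T` to the size of `T`. The result cannot contain `u`,
      -- or it would contain the dependent `A ⊕ v`; so it lies inside `T ⊖ u ⊕ v`, and equal sizes
      -- make the two sets coincide.
      result with extend {base} {T} ind jT (≤-trans (card-mono base⊆) (≤-reflexive card-target))
      ... | h , b⊆h , h⊆ , jh , ch = down whole jh
        where
        u∉h : u ∉ h
        u∉h with bool-case (h u)
        ... | inj₂ k = k
        ... | inj₁ k = true≢false (down cover jh) dep
          where
          cover : A ⊕ v ⊆ h
          cover x m = ⊕-elim A v m
            (λ xA → case-≡ x xA)
            (λ { refl → b⊆h v (⊕-self (A ⊖ u) v) })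
            where
            open import Data.Fin.Properties using () renaming (_≟_ to _≟F_)
            case-≡ : ∀ x → x ∈ A → x ∈ h
            case-≡ x xA with x ≟F u
            ... | yes refl = k
            ... | no ne = b⊆h x (⊕-ˡ (A ⊖ u) v x (⊖-in A u xA ne))
        h⊆target : h ⊆ T ⊖ u ⊕ v
        h⊆target x m = ∪-elim base T (h⊆ x m) (base⊆ x)
          λ xT → ⊕-ˡ (T ⊖ u) v x (⊖-in T u xT λ { refl → true≢false m u∉h })
        whole : T ⊖ u ⊕ v ⊆ h
        whole = card-full⊆ h⊆target (≤-trans (≤-reflexive card-target) ch)

    -- If deleting `zs` frees `x`, some element of `zs` lies on the circuit of `A ⊕ x`. Delete one
    -- element at a time: either it alone frees `x` and is the witness, or the circuit survives in
    -- the smaller set.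
    circuit-hit : ∀ S zs {A x} → Ind S → A ⊆ S → J (A ⊕ x) ≡ false → Ind ((A ∖ mem zs) ⊕ x) →
                  ∃ λ u → u ∈ mem zs × u ∈ A × Ind (S ⊖ u ⊕ x)
    circuit-hit S [] {A} {x} jS s dep ind = true≢false (down (⊕-mono x λ y k → ∖-in A (mem []) k refl) ind) dep
    circuit-hit S (z ∷ zs) {A} {x} jS s dep ind with bool-case (J (A ⊖ z ⊕ x))
    ... | inj₁ h with exchange-circuit s jS dep h
    ...   | jz , zA , _ = z , ∨-introˡ (mem zs z) (==-refl z) , zA , jz
    circuit-hit S (z ∷ zs) {A} {x} jS s dep ind | inj₂ h
      with circuit-hit S zs {A ⊖ z} jS (⊆-trans (⊖-ˡ A z) s) h (down (⊕-mono x sub) ind)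
      where
      sub : A ⊖ z ∖ mem zs ⊆ A ∖ mem (z ∷ zs)
      sub y k = ∖-in A (mem (z ∷ zs)) (⊖-ˡ A z y (∖-ˡ (A ⊖ z) (mem zs) y k))
        (not-true λ m → ∨-elim (y == z) m (λ e → ⊖-≢ A z (∖-ˡ (A ⊖ z) (mem zs) y k) (==-sound e))
                          (λ l → true≢false l (∖-ʳ (A ⊖ z) (mem zs) k)))
    ... | u , uz , uA , ju = u , ∨-introʳ (u == z) uz , ⊖-ˡ A z u uA , ju

-- Randomized query programs and a calculus of failure probabilities.

module RandomizedPrograms where
  open FiniteSets
  open import Data.Nat as ℕ using (ℕ; zero; suc)
  import Data.Nat.Properties as ℕP
  import Data.Integer as ℤ
  import Data.Integer.Properties as ℤP
  open import Data.Rational using (ℚ; 0ℚ; 1ℚ; ½; _+_; _*_; _≤_; nonNegative)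
  open import Data.Rational.Properties
  import Data.Rational.Unnormalised as U
  import Data.Rational.Unnormalised.Properties as UP
  open import Data.Rational.Solver
  open +-*-Solver using (solve; _:+_; _:*_; _:-_; _:=_; con)

  -- The free monad over the nodes of `QTree`, so that subroutines may return data of any type.
  -- `false` addresses the first matroid and `true` the second.
  data Prog (n : ℕ) (A : Set) : Set where
    ret  : A → Prog n A
    ask  : Bool → Subset n → (Bool → Prog n A) → Prog n A
    toss : (Bool → Prog n A) → Prog n A

  module _ {n : ℕ} where

    infixl 1 _>>=_
    _>>=_ : {A B : Set} → Prog n A → (A → Prog n B) → Prog n B
    ret a     >>= f = f a
    ask i X t >>= f = ask i X λ b → t b >>= f
    toss t    >>= f = toss λ b → t b >>= f

    compile : Prog n (Subset n) → QTree n
    compile (ret S)         = output S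
    compile (ask false X t) = ask₁ X λ b → compile (t b)
    compile (ask true X t)  = ask₂ X λ b → compile (t b)
    compile (toss t)        = coin λ b → compile (t b)

    module _ {S A : Set} (step : S → Prog n (S ⊎ A)) where
      while : ℕ → (S → A) → S → Prog n A
      continue : ℕ → (S → A) → S ⊎ A → Prog n A
      while zero    d s = ret (d s)
      while (suc f) d s = step s >>= continue f d
      continue f d (inj₁ s) = while f d s
      continue f d (inj₂ a) = ret a

  0≤½ : 0ℚ ≤ ½
  0≤½ = nonNegative⁻¹ ½

  half-mono : ∀ {a b c d} → a ≤ c → b ≤ d → ½ * (a + b) ≤ ½ * (c + d)
  half-mono {a} {b} {c} {d} h k = *-monoˡ-≤-nonNeg ½ (+-mono-≤ {a} {c} {b} {d} h k)

  half-same : ∀ a → ½ * (a + a) ≡ a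
  half-same = solve 1 (λ a → con ½ :* (a :+ a) := a) refl

  +-nonneg : ∀ {a b} → 0ℚ ≤ a → 0ℚ ≤ b → 0ℚ ≤ a + b
  +-nonneg {a} {b} h k = subst (_≤ a + b) (+-identityˡ 0ℚ) (+-mono-≤ {0ℚ} {a} {0ℚ} {b} h k)

  *-nonneg : ∀ {a b} → 0ℚ ≤ a → 0ℚ ≤ b → 0ℚ ≤ a * b
  *-nonneg {a} {b} h k = subst (_≤ a * b) (*-zeroʳ a) (*-monoˡ-≤-nonNeg a {{nonNegative h}} k)

  *-mono : ∀ {a b c d} → 0ℚ ≤ b → 0ℚ ≤ c → a ≤ c → b ≤ d → a * b ≤ c * d
  *-mono {a} {b} {c} {d} hb hc h k =
    ≤-trans (*-monoʳ-≤-nonNeg b {{nonNegative hb}} h) (*-monoˡ-≤-nonNeg c {{nonNegative hc}} k)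

  ≤+ˡ : ∀ {a b} → 0ℚ ≤ a → b ≤ a + b
  ≤+ˡ {a} {b} h = subst (_≤ a + b) (+-identityˡ b) (+-mono-≤ {0ℚ} {a} {b} {b} h ≤-refl)

  ≤+ʳ : ∀ {a b} → 0ℚ ≤ b → a ≤ a + b
  ≤+ʳ {a} {b} h = subst (_≤ a + b) (+-identityʳ a) (+-mono-≤ {a} {a} {0ℚ} {b} ≤-refl h)

  module Err {n : ℕ} (I : Bool → Subset n → Bool) where

    -- Err p Q e: except with probability e, the run of p ends in a result and a number of queries
    -- satisfying Q.
    Err : {A : Set} → Prog n A → (A → ℕ → Set) → ℚ → Set
    Err (ret a)     Q e = 0ℚ ≤ e × (Q a 0 ⊎ 1ℚ ≤ e)
    Err (ask i X t) Q e = Err (t (I i X)) (λ a k → Q a (suc k)) e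
    Err (toss t)    Q e = ∃ λ e₀ → ∃ λ e₁ → Err (t true) Q e₀ × Err (t false) Q e₁ × ½ * (e₀ + e₁) ≤ e

    err-mono : {A : Set} (p : Prog n A) {Q R : A → ℕ → Set} {e e' : ℚ} →
               (∀ a k → Q a k → R a k) → e ≤ e' → Err p Q e → Err p R e'
    err-mono (ret a) f le (h , inj₁ q) = ≤-trans h le , inj₁ (f a 0 q)
    err-mono (ret a) f le (h , inj₂ q) = ≤-trans h le , inj₂ (≤-trans q le)
    err-mono (ask i X t) f le h = err-mono (t (I i X)) (λ a k → f a (suc k)) le h
    err-mono (toss t) f le (e₀ , e₁ , h₀ , h₁ , le') =
      e₀ , e₁ , err-mono (t true) f ≤-refl h₀ , err-mono (t false) f ≤-refl h₁ , ≤-trans le' le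

    err-trivial : {A : Set} (p : Prog n A) {Q : A → ℕ → Set} {e : ℚ} → 1ℚ ≤ e → Err p Q e
    err-trivial (ret a) h = ≤-trans (nonNegative⁻¹ 1ℚ) h , inj₂ h
    err-trivial (ask i X t) h = err-trivial (t (I i X)) h
    err-trivial (toss t) {e = e} h =
      e , e , err-trivial (t true) h , err-trivial (t false) h , ≤-reflexive (half-same e)

    -- The product rule: after a failure of the first stage the second one still has its own chance
    -- `1 - e₂`. Repeated independent tests need it, since a plain union bound would add their
    -- errors instead of multiplying them.
    err-bind× : {A B : Set} (p : Prog n A) {f : A → Prog n B} {Q : A → ℕ → Set} {R : B → ℕ → Set}
                {e e₁ e₂ : ℚ} → 0ℚ ≤ e₁ → 0ℚ ≤ e₂ → Err p Q e →
                (∀ a k → Q a k → Err (f a) (λ b j → R b (k ℕ.+ j)) e₁) →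
                (∀ a k → Err (f a) (λ b j → R b (k ℕ.+ j)) e₂) →
                Err (p >>= f) R (e₁ + e * e₂)
    err-bind× (ret a) {f} {e₂ = e₂} z₁ z₂ (h , inj₁ q) good bad =
      err-mono (f a) (λ _ _ r → r) (≤+ʳ (*-nonneg h z₂)) (good a 0 q)
    err-bind× (ret a) {f} {e = e} {e₁} {e₂} z₁ z₂ (h , inj₂ q) good bad =
      err-mono (f a) (λ _ _ r → r)
        (≤-trans (subst (_≤ e * e₂) (*-identityˡ e₂) (*-monoʳ-≤-nonNeg e₂ {{nonNegative z₂}} q)) (≤+ˡ z₁))
        (bad a 0)
    err-bind× (ask i X t) z₁ z₂ h good bad =
      err-bind× (t (I i X)) z₁ z₂ h (λ a k → good a (suc k)) (λ a k → bad a (suc k))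
    err-bind× (toss t) {e = e} {e₁} {e₂} z₁ z₂ (a , b , h₀ , h₁ , le) good bad =
      e₁ + a * e₂ , e₁ + b * e₂ , err-bind× (t true) z₁ z₂ h₀ good bad , err-bind× (t false) z₁ z₂ h₁ good bad ,
      ≤-trans (≤-reflexive (mix a b e₁ e₂)) (+-mono-≤ (≤-refl {e₁}) (*-monoʳ-≤-nonNeg e₂ {{nonNegative z₂}} le))
      where
      mix : ∀ a b e₁ e₂ → ½ * ((e₁ + a * e₂) + (e₁ + b * e₂)) ≡ e₁ + (½ * (a + b)) * e₂
      mix = solve 4 (λ a b e₁ e₂ → con ½ :* ((e₁ :+ a :* e₂) :+ (e₁ :+ b :* e₂)) := e₁ :+ (con ½ :* (a :+ b)) :* e₂) refl

    err-bind : {A B : Set} (p : Prog n A) {f : A → Prog n B} {Q : A → ℕ → Set} {R : B → ℕ → Set}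
               {e e₁ : ℚ} → 0ℚ ≤ e₁ → Err p Q e →
               (∀ a k → Q a k → Err (f a) (λ b j → R b (k ℕ.+ j)) e₁) →
               Err (p >>= f) R (e₁ + e)
    err-bind p {f} {e = e} {e₁} z h good =
      subst (λ x → Err (p >>= f) _ (e₁ + x)) (*-identityʳ e)
        (err-bind× p z (nonNegative⁻¹ 1ℚ) h good (λ a k → err-trivial (f a) ≤-refl))

    0≤probRun : ∀ (P : Subset n → ℕ → Bool) k T → 0ℚ ≤ probRun (I false) (I true) P k T
    0≤probRun P k (output S) with P S k
    ... | true  = nonNegative⁻¹ 1ℚ
    ... | false = ≤-refl
    0≤probRun P k (ask₁ X t) = 0≤probRun P (suc k) (t (I false X))
    0≤probRun P k (ask₂ X t) = 0≤probRun P (suc k) (t (I true X))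
    0≤probRun P k (coin t) = *-nonneg 0≤½ (+-nonneg (0≤probRun P k (t true)) (0≤probRun P k (t false)))

    -- A good leaf contributes one to the probability, a bad leaf has error at least one, and coins
    -- average both. The offset `k` stands for the queries made above the current node.
    err-probRun : ∀ (P : Subset n → ℕ → Bool) k (p : Prog n (Subset n)) {Q : Subset n → ℕ → Set} {e} →
                  (∀ S j → Q S j → P S (k ℕ.+ j) ≡ true) → Err p Q e →
                  1ℚ ≤ probRun (I false) (I true) P k (compile p) + e
    err-probRun P k (ret S) imp (h , inj₁ q)
      rewrite subst (λ j → P S j ≡ true) (ℕP.+-identityʳ k) (imp S 0 q) = ≤+ʳ h
    err-probRun P k (ret S) imp (h , inj₂ q) = ≤-trans q (≤+ˡ (0≤probRun P k (output S)))
    err-probRun P k (ask false X t) imp h = err-probRun P (suc k) (t (I false X))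
      (λ S j q → subst (λ l → P S l ≡ true) (ℕP.+-suc k j) (imp S (suc j) q)) h
    err-probRun P k (ask true X t) imp h = err-probRun P (suc k) (t (I true X))
      (λ S j q → subst (λ l → P S l ≡ true) (ℕP.+-suc k j) (imp S (suc j) q)) h
    err-probRun P k (toss t) {e = e} imp (e₀ , e₁ , h₀ , h₁ , le) = begin
      1ℚ ≤⟨ half-mono (err-probRun P k (t true) imp h₀) (err-probRun P k (t false) imp h₁) ⟩
      ½ * ((x + e₀) + (y + e₁)) ≡⟨ mix x y e₀ e₁ ⟩
      ½ * (x + y) + ½ * (e₀ + e₁) ≤⟨ +-mono-≤ (≤-refl {½ * (x + y)}) le ⟩
      ½ * (x + y) + e ∎
      where
      open ≤-Reasoning
      x y : ℚ
      x = probRun (I false) (I true) P k (compile (t true))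
      y = probRun (I false) (I true) P k (compile (t false))
      mix : ∀ x y a b → ½ * ((x + a) + (y + b)) ≡ ½ * (x + y) + ½ * (a + b)
      mix = solve 4 (λ x y a b → con ½ :* ((x :+ a) :+ (y :+ b)) := con ½ :* (x :+ y) :+ con ½ :* (a :+ b)) refl

  toℚ-+ : ∀ a b → toℚ (a ℕ.+ b) ≡ toℚ a + toℚ b
  toℚ-+ a b = toℚᵘ-injective (UP.≃-trans (toℚᵘ-fromℚᵘ (U.mkℚᵘ (ℤ.+ (a ℕ.+ b)) 0)) (UP.≃-trans unnorm
    (UP.≃-sym (UP.≃-trans (toℚᵘ-homo-+ (toℚ a) (toℚ b))
      (UP.+-cong (toℚᵘ-fromℚᵘ (U.mkℚᵘ (ℤ.+ a) 0)) (toℚᵘ-fromℚᵘ (U.mkℚᵘ (ℤ.+ b) 0)))))))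
    where
    unnorm : U.mkℚᵘ (ℤ.+ (a ℕ.+ b)) 0 U.≃ U.mkℚᵘ (ℤ.+ a) 0 U.+ U.mkℚᵘ (ℤ.+ b) 0
    unnorm = U.*≡* (cong (ℤ._* ℤ.+ 1) (cong₂ ℤ._+_ (sym (ℤP.*-identityʳ (ℤ.+ a))) (sym (ℤP.*-identityʳ (ℤ.+ b)))))

  0≤toℚ : ∀ a → 0ℚ ≤ toℚ a
  0≤toℚ zero = ≤-refl
  0≤toℚ (suc a) = subst (0ℚ ≤_) (sym (toℚ-+ 1 a)) (+-nonneg (nonNegative⁻¹ 1ℚ) (0≤toℚ a))

  toℚ-mono : ∀ {a b} → a ℕ.≤ b → toℚ a ≤ toℚ b
  toℚ-mono {a} {b} h = subst (λ x → toℚ a ≤ toℚ x) (ℕP.m+[n∸m]≡n h)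
    (subst (toℚ a ≤_) (sym (toℚ-+ a (b ℕ.∸ a))) (≤+ʳ (0≤toℚ (b ℕ.∸ a))))

  toℚ-* : ∀ a b → toℚ (a ℕ.* b) ≡ toℚ a * toℚ b
  toℚ-* zero b = sym (*-zeroˡ (toℚ b))
  toℚ-* (suc a) b = begin
    toℚ (b ℕ.+ a ℕ.* b)      ≡⟨ toℚ-+ b (a ℕ.* b) ⟩
    toℚ b + toℚ (a ℕ.* b)    ≡⟨ cong (toℚ b +_) (toℚ-* a b) ⟩
    toℚ b + toℚ a * toℚ b    ≡⟨ solve 2 (λ a b → b :+ a :* b := (con 1ℚ :+ a) :* b) refl (toℚ a) (toℚ b) ⟩
    (1ℚ + toℚ a) * toℚ b     ≡⟨ cong (_* toℚ b) (toℚ-+ 1 a) ⟨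
    toℚ (suc a) * toℚ b      ∎
    where open ≡-Reasoning

  ½^ : ℕ → ℚ
  ½^ zero    = 1ℚ
  ½^ (suc j) = ½ * ½^ j

  ½^-+ : ∀ a b → ½^ (a ℕ.+ b) ≡ ½^ a * ½^ b
  ½^-+ zero b = sym (*-identityˡ (½^ b))
  ½^-+ (suc a) b = trans (cong (½ *_) (½^-+ a b)) (sym (*-assoc ½ (½^ a) (½^ b)))

  0≤½^ : ∀ j → 0ℚ ≤ ½^ j
  0≤½^ zero    = nonNegative⁻¹ 1ℚ
  0≤½^ (suc j) = *-nonneg 0≤½ (0≤½^ j)

  ½^≤1 : ∀ j → ½^ j ≤ 1ℚ
  ½^≤1 zero    = ≤-refl
  ½^≤1 (suc j) = ≤-trans (*-mono (0≤½^ j) 0≤½ (≤-refl {½}) (½^≤1 j)) (≤-trans (≤-reflexive (*-identityʳ ½)) (½≤1))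
    where
    ½≤1 : ½ ≤ 1ℚ
    ½≤1 = subst₂ _≤_ (half-same ½) refl (half-mono {½} {½} {1ℚ} {1ℚ} h h)
      where h = toℚᵘ-cancel-≤ (U.*≤* (ℤ.+≤+ (ℕ.s≤s ℕ.z≤n)))

  2^*½^ : ∀ j → toℚ (2 ℕ.^ j) * ½^ j ≡ 1ℚ
  2^*½^ zero    = refl
  2^*½^ (suc j) = begin
    toℚ (2 ℕ.* 2 ℕ.^ j) * (½ * ½^ j)  ≡⟨ cong (_* (½ * ½^ j)) (toℚ-* 2 (2 ℕ.^ j)) ⟩
    toℚ 2 * toℚ (2 ℕ.^ j) * (½ * ½^ j)
      ≡⟨ solve 2 (λ a b → (con (toℚ 2) :* a) :* (con ½ :* b) := a :* b) refl (toℚ (2 ℕ.^ j)) (½^ j) ⟩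
    toℚ (2 ℕ.^ j) * ½^ j              ≡⟨ 2^*½^ j ⟩
    1ℚ                                ∎
    where open ≡-Reasoning

  -- The parameter μ is the probability of one bad event; e counts bad events.
  module Logic {n : ℕ} (I : Bool → Subset n → Bool) (μ : ℚ) (0≤μ : 0ℚ ≤ μ) where
    open Err I

    record Ok {A : Set} (p : Prog n A) (Q : A → ℕ → Set) (e : ℕ) : Set where
      constructor mk
      field err : Err p Q (toℚ e * μ)
    open Ok public

    0≤scaled : ∀ e → 0ℚ ≤ toℚ e * μ
    0≤scaled e = *-nonneg (0≤toℚ e) 0≤μ

    ok-mono : {A : Set} {p : Prog n A} {Q R : A → ℕ → Set} {e e' : ℕ} →
              (∀ a k → Q a k → R a k) → e ℕ.≤ e' → Ok p Q e → Ok p R e'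
    ok-mono {p = p} f le (mk h) = mk (err-mono p f (*-monoʳ-≤-nonNeg μ {{nonNegative 0≤μ}} (toℚ-mono le)) h)

    ok-weaken : {A : Set} {p : Prog n A} {Q R : A → ℕ → Set} {e : ℕ} →
                (∀ a k → Q a k → R a k) → Ok p Q e → Ok p R e
    ok-weaken f = ok-mono f ℕP.≤-refl

    ok-ret : {A : Set} {a : A} {Q : A → ℕ → Set} {e : ℕ} → Q a 0 → Ok (ret a) Q e
    ok-ret {e = e} q = mk (0≤scaled e , inj₁ q)

    ok-ask : {A : Set} {i : Bool} {X : Subset n} {t : Bool → Prog n A} {Q : A → ℕ → Set} {e : ℕ} →
             Ok (t (I i X)) (λ a k → Q a (suc k)) e → Ok (ask i X t) Q e
    ok-ask (mk h) = mk h

    ok-bind : {A B : Set} {p : Prog n A} {f : A → Prog n B} {Q : A → ℕ → Set} {R : B → ℕ → Set} {e e' : ℕ} →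
              Ok p Q e → (∀ a k → Q a k → Ok (f a) (λ b j → R b (k ℕ.+ j)) e') → Ok (p >>= f) R (e ℕ.+ e')
    ok-bind {p = p} {f} {e = e} {e'} (mk h) g =
      mk (subst (Err (p >>= f) _)
           (trans (solve 3 (λ a b m → b :* m :+ a :* m := (a :+ b) :* m) refl (toℚ e) (toℚ e') μ)
                  (cong (_* μ) (sym (toℚ-+ e e'))))
           (err-bind p (0≤scaled e') h (λ a k q → err (g a k q))))

    After : {S A : Set} → (ℕ → S → ℕ → Set) → (A → ℕ → Set) → ℕ → ℕ → S ⊎ A → ℕ → Set
    After P Q f c (inj₁ s) k = P f s (c ℕ.+ k)
    After P Q f c (inj₂ a) k = Q a (c ℕ.+ k)

    -- P f s c holds at a state s reached with c queries when f more steps are allowed; the fuel never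
    -- runs out because P 0 is contradictory.
    ok-while : {S A : Set} {step : S → Prog n (S ⊎ A)} {d : S → A} (P : ℕ → S → ℕ → Set) (Q : A → ℕ → Set)
               (e : ℕ) →
               (∀ {s c} → P 0 s c → ⊥) →
               (∀ f s c → P (suc f) s c →
                  Ok (step s) (After P Q f c) e) →
               ∀ f s c → P f s c → Ok (while step f d s) (λ a k → Q a (c ℕ.+ k)) (f ℕ.* e)
    ok-while P Q e stop body zero s c p = ⊥-elim (stop p)
    ok-while P Q e stop body (suc f) s c p = ok-bind (body f s c p) next
      where
      next : ∀ r k → After P Q f c r k → Ok (continue _ f _ r) (λ a j → Q a (c ℕ.+ (k ℕ.+ j))) (f ℕ.* e)
      next (inj₁ s') k q = ok-weaken (λ a j → subst (Q a) (ℕP.+-assoc c k j))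
        (ok-while P Q e stop body f s' (c ℕ.+ k) q)
      next (inj₂ a) k q = ok-ret (subst (Q a) (cong (c ℕ.+_) (sym (ℕP.+-identityʳ k))) q)

-- Oracle subroutines: greedy growth, common scans, circuits by halving.

module OracleProcedures where
  open FiniteSets
  open Matroids
  open RandomizedPrograms
  open import Data.Nat
  open import Data.Nat.Properties
  open import Data.Rational using (ℚ; 0ℚ) renaming (_≤_ to _≤ℚ_)
  open import Data.List.Properties using (take++drop≡id; length-take; length-drop; length-++)
  open import Data.Nat.Tactic.RingSolver

  sel : ∀ {n} → BSet n → List (Fin n) → List (Fin n)
  sel p []       = []
  sel p (z ∷ zs) = if p z then z ∷ sel p zs else sel p zs

  module _ {n : ℕ} where

    sel-++ : (p : BSet n) (xs ys : List (Fin n)) → sel p (xs ++ ys) ≡ sel p xs ++ sel p ys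
    sel-++ p [] ys = refl
    sel-++ p (x ∷ xs) ys with p x
    ... | true  = cong (x ∷_) (sel-++ p xs ys)
    ... | false = sel-++ p xs ys

    mem-sel : (p : BSet n) (xs : List (Fin n)) → ∀ x → mem (sel p xs) x ≡ mem xs x ∧ p x
    mem-sel p [] x = refl
    mem-sel p (z ∷ xs) x with p z in pz | x == z in e
    ... | true  | true  rewrite e = sym (trans (cong p (==-sound e)) pz)
    ... | true  | false rewrite e = mem-sel p xs x
    ... | false | false = mem-sel p xs x
    ... | false | true  = trans (mem-sel p xs x) (trans (cong (mem xs x ∧_) px) (trans (∧-false (mem xs x)) (sym px)))
      where
      px : p x ≡ false
      px = trans (cong p (==-sound e)) pz
      ∧-false : ∀ b → b ∧ false ≡ false
      ∧-false true  = refl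
      ∧-false false = refl

    length-sel : (p : BSet n) {xs : List (Fin n)} → Distinct xs → length (sel p xs) ≤ card (mem xs ∩ p)
    length-sel p [] = z≤n
    length-sel p {x ∷ xs} (h ∷ d) with p x in px
    ... | false = ≤-trans (length-sel p d) (card-mono λ y k → ∩-in (mem (x ∷ xs)) p (∨-introʳ (y == x) (∩-ˡ (mem xs) p y k)) (∩-ʳ (mem xs) p y k))
    ... | true  = ≤-trans (s≤s (length-sel p d)) (≤-trans (≤-reflexive (cong (_+ card (mem xs ∩ p)) (sym (card-single x))))
          (card-disj (λ y e → ∩-in (mem (x ∷ xs)) p (∨-introˡ (mem xs y) e) (trans (cong p (==-sound e)) px))
             (λ y k → ∩-in (mem (x ∷ xs)) p (∨-introʳ (y == x) (∩-ˡ (mem xs) p y k)) (∩-ʳ (mem xs) p y k))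
             λ y e → ∉-⊆ (∩-ˡ (mem xs) p) (subst (_∉ mem xs) (sym (==-sound e)) h)))

    sel-none : (p : BSet n) (xs : List (Fin n)) → (∀ x → x ∈ mem xs → x ∉ p) → sel p xs ≡ []
    sel-none p [] h = refl
    sel-none p (x ∷ xs) h rewrite h x (∨-introˡ (mem xs x) (==-refl x)) =
      sel-none p xs λ y k → h y (∨-introʳ (y == x) k)

    sel-some : (p : BSet n) (xs : List (Fin n)) {x : Fin n} → x ∈ mem xs → x ∈ p → 1 ≤ length (sel p xs)
    sel-some p (z ∷ xs) {x} m h with p z in pz | x == z in e
    ... | true | _ = s≤s z≤n
    ... | false | false = sel-some p xs m h
    ... | false | true  = true≢false h (trans (cong p (==-sound e)) pz)

    sel-elems : (p q : BSet n) → length (sel p (elems q)) ≤ card (q ∩ p)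
    sel-elems p q = ≤-trans (length-sel p (distinct-elems q))
      (card-mono λ y k → ∩-in q p (trans (sym (mem-elems q y)) (∩-ˡ (mem (elems q)) p y k)) (∩-ʳ (mem (elems q)) p y k))

  module Programs (n : ℕ) (query : Bool → BSet n → Prog n Bool) where

    grow : Bool → BSet n → List (Fin n) → Prog n (BSet n)
    grow i B []       = ret B
    grow i B (x ∷ xs) = query i (B ⊕ x) >>= λ b → grow i (if b then B ⊕ x else B) xs

    -- A greedy common independent set X of the contractions of the two matroids by Q and N; R collects
    -- the elements rejected by the second matroid.
    scan : BSet n → BSet n → List (Fin n) → BSet n → BSet n → Prog n (BSet n × BSet n)
    scan N Q []       X R = ret (X , R)
    scan N Q (x ∷ xs) X R = query true (N ∪ (X ⊕ x)) >>= λ b₂ →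
      if b₂ then (query false (Q ∪ (X ⊕ x)) >>= λ b₁ → scan N Q xs (if b₁ then X ⊕ x else X) R)
            else scan N Q xs X (R ⊕ x)

    -- The elements of zs on the circuit of S ⊕ x, by repeated halving.
    collect : Bool → BSet n → Fin n → ℕ → List (Fin n) → Prog n (List (Fin n))
    collect i S x zero    zs = query i (S ∖ mem zs ⊕ x) >>= λ b → ret (if b then zs else [])
    collect i S x (suc L) zs = query i (S ∖ mem zs ⊕ x) >>= λ b →
      if b then (collect i S x L (take (2 ^ L) zs) >>= λ us →
                 collect i S x L (drop (2 ^ L) zs) >>= λ vs → ret (us ++ vs))
           else ret []

    -- Deleting the first half frees `x` exactly when the circuit meets that half. The value `x` for
    -- an empty list is a filler: the search starts only where a circuit element is known to be
    -- present.
    bsearch : Bool → BSet n → Fin n → ℕ → List (Fin n) → Prog n (Fin n)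
    bsearch i S x zero    []       = ret x
    bsearch i S x zero    (z ∷ zs) = ret z
    bsearch i S x (suc L) zs = query i (S ∖ mem (take (2 ^ L) zs) ⊕ x) >>= λ b →
      if b then bsearch i S x L (take (2 ^ L) zs) else bsearch i S x L (drop (2 ^ L) zs)

  module Specs {n : ℕ} (I : Bool → Subset n → Bool) (μ : ℚ) (0≤μ : 0ℚ ≤ℚ μ)
    (query : Bool → BSet n → Prog n Bool) (J : Bool → BSet n → Bool) (mat : ∀ i → Mat (J i))
    (query-ok : ∀ i f → Logic.Ok I μ 0≤μ (query i f) (λ b k → b ≡ J i f × k ≡ 1) 0) where

    open Programs n query public
    open Logic I μ 0≤μ public
    module M (i : Bool) = MatLemmas (mat i)
    open M using (Ind; Sp) public

    ok-query : ∀ {i f A} {t : Bool → Prog n A} {R : A → ℕ → Set} {e} →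
               Ok (t (J i f)) (λ a k → R a (suc k)) e → Ok (query i f >>= t) R e
    ok-query {i} {f} h = ok-bind (query-ok i f) λ { b k (refl , refl) → h }

    grow-ok : ∀ i B xs → Ind i B →
              Ok (grow i B xs) (λ h k → (B ⊆ h × h ⊆ B ∪ mem xs) × (Ind i h × (∀ x → x ∈ mem xs → Sp i h x)) ×
                                        k ≤ length xs) 0
    grow-ok i B [] jB = ok-ret (((λ _ h → h) , (λ _ h → ∪-ˡ B ∅ _ h)) , (jB , λ _ ()) , z≤n)
    grow-ok i B (x ∷ xs) jB = ok-query (go (J i (B ⊕ x)) refl)
      where
      go : ∀ b → J i (B ⊕ x) ≡ b → Ok (grow i (if b then B ⊕ x else B) xs)
               (λ h k → (B ⊆ h × h ⊆ B ∪ mem (x ∷ xs)) ×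
                        (Ind i h × (∀ y → y ∈ mem (x ∷ xs) → Sp i h y)) × suc k ≤ suc (length xs)) 0
      go true e = ok-weaken
        (λ { h k ((B⊆ , h⊆) , (jh , sp) , le) →
          (⊆-trans (⊕-ˡ B x) B⊆ ,
           ⊆-trans h⊆ (∪-lub (⊕-lub (∪-ˡ B (mem (x ∷ xs))) (∪-ʳ B (mem (x ∷ xs)) x (∨-introˡ (mem xs x) (==-refl x))))
                             (λ y m → ∪-ʳ B (mem (x ∷ xs)) y (∨-introʳ (y == x) m)))) ,
          (jh , λ y m → ∨-elim (y == x) m (λ q → inj₁ (B⊆ y (subst (_∈ B ⊕ x) (sym (==-sound q)) (⊕-self B x)))) (sp y)) ,
          s≤s le })
        (grow-ok i (B ⊕ x) xs e)
      go false e = ok-weaken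
        (λ { h k ((B⊆ , h⊆) , (jh , sp) , le) →
          (B⊆ , ⊆-trans h⊆ (∪-lub (∪-ˡ B (mem (x ∷ xs))) (λ y m → ∪-ʳ B (mem (x ∷ xs)) y (∨-introʳ (y == x) m)))) ,
          (jh , λ y m → ∨-elim (y == x) m
             (λ q → subst (Sp i h) (sym (==-sound q)) (M.Sp-mono i B⊆ (inj₂ e))) (sp y)) ,
          s≤s le })
        (grow-ok i B xs jB)

    -- The second matroid is asked first, so a scanned element outside `R` is either taken or
    -- spanned by `Q ∪ X` in the first one. This dichotomy becomes the relabelling rule of phase 1
    -- and also the factor two of the greedy set.
    record Scanned (N Q : BSet n) (xs : List (Fin n)) (X₀ R₀ X R : BSet n) : Set where
      field
        X₀⊆ : X₀ ⊆ X
        R₀⊆ : R₀ ⊆ R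
        X⊆  : X ⊆ X₀ ∪ mem xs
        R⊆  : R ⊆ R₀ ∪ mem xs
        ind₁ : Ind false (Q ∪ X)
        ind₂ : Ind true (N ∪ X)
        rejected : ∀ x → x ∈ R → J true (N ∪ X ⊕ x) ≡ false
        covered : ∀ x → x ∈ mem xs → x ∈ R ⊎ Sp false (Q ∪ X) x

    ⊕∪-assoc : ∀ (N X : BSet n) x → N ∪ (X ⊕ x) ⊆ N ∪ X ⊕ x
    ⊕∪-assoc N X x = ∪-lub (λ y h → ⊕-ˡ (N ∪ X) x y (∪-ˡ N X y h)) (⊕-mono x (∪-ʳ N X))

    ∪-monoʳ : ∀ (N : BSet n) {X Y} → X ⊆ Y → N ∪ X ⊆ N ∪ Y
    ∪-monoʳ N {X} {Y} s = ∪-lub (∪-ˡ N Y) (⊆-trans s (∪-ʳ N Y))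

    scan-ok : ∀ N Q xs X R → Ind false (Q ∪ X) → Ind true (N ∪ X) →
              (∀ x → x ∈ R → J true (N ∪ X ⊕ x) ≡ false) →
              Ok (scan N Q xs X R) (λ r k → Scanned N Q xs X R (proj₁ r) (proj₂ r) × k ≤ 2 * length xs) 0
    scan-ok N Q [] X R i₁ i₂ rj = ok-ret (record
      { X₀⊆ = λ _ h → h ; R₀⊆ = λ _ h → h ; X⊆ = ∪-ˡ X _ ; R⊆ = ∪-ˡ R _
      ; ind₁ = i₁ ; ind₂ = i₂ ; rejected = rj ; covered = λ _ () } , z≤n)
    scan-ok N Q (x ∷ xs) X R i₁ i₂ rj = ok-query (go₂ (J true (N ∪ (X ⊕ x))) refl)
      where
      head-in : x ∈ mem (x ∷ xs)
      head-in = ∨-introˡ (mem xs x) (==-refl x)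
      tail-in : mem xs ⊆ mem (x ∷ xs)
      tail-in y m = ∨-introʳ (y == x) m
      1≤2 : ∀ {k} → k ≤ 2 * length xs → suc k ≤ 2 * suc (length xs)
      1≤2 le = ≤-trans (s≤s (m≤n⇒m≤1+n le)) (≤-reflexive (sym (*-suc 2 (length xs))))
      go₁ : ∀ b → J false (Q ∪ (X ⊕ x)) ≡ b → J true (N ∪ (X ⊕ x)) ≡ true →
            Ok (scan N Q xs (if b then X ⊕ x else X) R)
               (λ r k → Scanned N Q (x ∷ xs) X R (proj₁ r) (proj₂ r) × suc (suc k) ≤ 2 * suc (length xs)) 0
      go₁ true e e₂ = ok-weaken
        (λ { r k (s , le) → record
          { X₀⊆ = ⊆-trans (⊕-ˡ X x) (X₀⊆ s) ; R₀⊆ = R₀⊆ s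
          ; X⊆ = ⊆-trans (X⊆ s) (∪-lub (⊕-lub (∪-ˡ X (mem (x ∷ xs))) (∪-ʳ X (mem (x ∷ xs)) x head-in))
                                         (⊆-trans tail-in (∪-ʳ X (mem (x ∷ xs)))))
          ; R⊆ = ⊆-trans (R⊆ s) (∪-monoʳ R tail-in)
          ; ind₁ = ind₁ s ; ind₂ = ind₂ s ; rejected = rejected s
          ; covered = λ y m → ∨-elim (y == x) m
              (λ q → inj₂ (inj₁ (∪-ʳ Q (proj₁ r) y (X₀⊆ s y (subst (_∈ X ⊕ x) (sym (==-sound q)) (⊕-self X x))))))
              (covered s y) } ,
          ≤-trans (s≤s (s≤s le)) (≤-reflexive (sym (*-suc 2 (length xs)))) })
        (scan-ok N Q xs (X ⊕ x) R e e₂ λ y yR →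
          M.up true (⊕-mono y (∪-monoʳ N (⊕-ˡ X x))) (rj y yR))
        where open Scanned
      go₁ false e e₂ = ok-weaken
        (λ { r k (s , le) → record
          { X₀⊆ = X₀⊆ s ; R₀⊆ = R₀⊆ s
          ; X⊆ = ⊆-trans (X⊆ s) (∪-monoʳ X tail-in)
          ; R⊆ = ⊆-trans (R⊆ s) (∪-monoʳ R tail-in)
          ; ind₁ = ind₁ s ; ind₂ = ind₂ s ; rejected = rejected s
          ; covered = λ y m → ∨-elim (y == x) m
              (λ q → inj₂ (inj₂ (subst (λ z → J false (Q ∪ proj₁ r ⊕ z) ≡ false) (sym (==-sound q))
                   (M.up false (⊕-mono {f = Q ∪ X} {Q ∪ proj₁ r} x (∪-monoʳ Q {Y = proj₁ r} (X₀⊆ s))) (M.up false (⊕∪-assoc Q X x) e)))))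
              (covered s y) } ,
          ≤-trans (s≤s (s≤s le)) (≤-reflexive (sym (*-suc 2 (length xs)))) })
        (scan-ok N Q xs X R i₁ i₂ rj)
        where open Scanned
      go₂ : ∀ b₂ → J true (N ∪ (X ⊕ x)) ≡ b₂ →
            Ok (if b₂ then (query false (Q ∪ (X ⊕ x)) >>= λ b₁ → scan N Q xs (if b₁ then X ⊕ x else X) R)
                      else scan N Q xs X (R ⊕ x))
               (λ r k → Scanned N Q (x ∷ xs) X R (proj₁ r) (proj₂ r) × suc k ≤ 2 * suc (length xs)) 0
      go₂ true e = ok-query (go₁ (J false (Q ∪ (X ⊕ x))) refl e)
      go₂ false e = ok-weaken
        (λ { r k (s , le) → record
          { X₀⊆ = X₀⊆ s ; R₀⊆ = ⊆-trans (⊕-ˡ R x) (R₀⊆ s)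
          ; X⊆ = ⊆-trans (X⊆ s) (∪-monoʳ X tail-in)
          ; R⊆ = ⊆-trans (R⊆ s) (∪-lub (⊕-lub (∪-ˡ R _) (∪-ʳ R (mem (x ∷ xs)) x head-in))
                                         (⊆-trans tail-in (∪-ʳ R _)))
          ; ind₁ = ind₁ s ; ind₂ = ind₂ s ; rejected = rejected s
          ; covered = λ y m → ∨-elim (y == x) m
              (λ q → inj₁ (R₀⊆ s y (subst (_∈ R ⊕ x) (sym (==-sound q)) (⊕-self R x))))
              (covered s y) } ,
          1≤2 le })
        (scan-ok N Q xs X (R ⊕ x) i₁ i₂ λ y yR → ⊕-elim R x yR (rj y)
           λ { refl → M.up true (⊕∪-assoc N X x) e })
        where open Scanned

    module Circuit (i : Bool) (S : BSet n) (x : Fin n) (jS : Ind i S) (dep : J i (S ⊕ x) ≡ false) where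

      -- The fundamental circuit of `x` in `S` without `x` itself, that is, the neighbours of `x` in
      -- the exchange graph of matroid `i`.
      circuit : BSet n
      circuit u = J i (S ⊖ u ⊕ x)

      hit-query : ∀ zs {u} → u ∈ mem zs → u ∈ circuit → J i (S ∖ mem zs ⊕ x) ≡ true
      hit-query zs {u} m h = M.down i (⊕-mono x λ y k → ⊖-in S u (∖-ˡ S (mem zs) y k)
        λ { refl → true≢false m (∖-ʳ S (mem zs) k) }) h

      query-hit : ∀ zs → J i (S ∖ mem zs ⊕ x) ≡ true → ∃ λ u → u ∈ mem zs × u ∈ S × u ∈ circuit
      query-hit zs h = M.circuit-hit i S zs jS (λ _ k → k) dep h

      miss : ∀ zs → J i (S ∖ mem zs ⊕ x) ≡ false → ∀ u → u ∈ mem zs → u ∉ circuit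
      miss zs h u m = not-true λ k → true≢false (hit-query zs m k) h

      length-halves : ∀ L (zs : List (Fin n)) → length zs ≤ 2 ^ suc L →
                      length (take (2 ^ L) zs) ≤ 2 ^ L × length (drop (2 ^ L) zs) ≤ 2 ^ L
      length-halves L zs le =
        ≤-trans (≤-reflexive (length-take (2 ^ L) zs)) (m⊓n≤m (2 ^ L) _) ,
        ≤-trans (≤-reflexive (length-drop (2 ^ L) zs))
          (≤-trans (∸-monoˡ-≤ (2 ^ L) (≤-trans le (≤-reflexive (cong (2 ^ L +_) (+-identityʳ (2 ^ L))))))
                   (≤-reflexive (m+n∸m≡n (2 ^ L) (2 ^ L))))

      -- Every positive node of the halving tree contains a circuit element, so there are at most
      -- `L` splitting nodes per element found. Each of them causes two further queries, and the
      -- root is the extra one.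
      collect-ok : ∀ L zs → length zs ≤ 2 ^ L →
                   Ok (collect i S x L zs) (λ us k → us ≡ sel circuit zs × k ≤ 1 + 2 * L * length us) 0
      collect-ok zero zs le = ok-query (ok-ret (go zs le (J i (S ∖ mem zs ⊕ x)) refl , s≤s z≤n))
        where
        go : ∀ zs → length zs ≤ 1 → ∀ b → J i (S ∖ mem zs ⊕ x) ≡ b → (if b then zs else []) ≡ sel circuit zs
        go zs le false e = sym (sel-none circuit zs (miss zs e))
        go [] le true e = refl
        go (z ∷ []) le true e with query-hit (z ∷ []) e
        ... | u , m , _ , k with mem-single {x = u} {z} m
        ... | refl rewrite k = refl
        go (_ ∷ _ ∷ _) (s≤s ()) true e
      collect-ok (suc L) zs le = ok-query (go (J i (S ∖ mem zs ⊕ x)) refl)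
        where
        A B : List (Fin n)
        A = take (2 ^ L) zs
        B = drop (2 ^ L) zs
        cost : ∀ L a b k j → 1 ≤ a + b → k ≤ 1 + 2 * L * a → j ≤ 1 + 2 * L * b →
               suc (k + (j + 0)) ≤ 1 + 2 * suc L * (a + b)
        cost L a b k j h p q = lin 0 (+-mono-≤ (+-mono-≤ p q) (+-mono-≤ h h)) (eq L a b k j)
          where
          eq : ∀ L a b k j → suc (k + (j + 0)) + (1 + 2 * L * a + (1 + 2 * L * b) + (a + b + (a + b))) + 0
                           ≡ 1 + 2 * suc L * (a + b) + (k + j + (1 + 1))
          eq = solve-∀
        go : ∀ b → J i (S ∖ mem zs ⊕ x) ≡ b →
             Ok (if b then (collect i S x L A >>= λ us → collect i S x L B >>= λ vs → ret (us ++ vs)) else ret [])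
                (λ us k → us ≡ sel circuit zs × suc k ≤ 1 + 2 * suc L * length us) 0
        go false e = ok-ret (sym (sel-none circuit zs (miss zs e)) , s≤s z≤n)
        go true e = ok-bind (collect-ok L A (proj₁ (length-halves L zs le))) λ { us k (refl , ck) →
          ok-bind (collect-ok L B (proj₂ (length-halves L zs le))) λ { vs j (refl , cj) →
          ok-ret (whole , subst (λ l → suc (k + (j + 0)) ≤ 1 + 2 * suc L * l) (sym (length-++ (sel circuit A)))
            (cost L _ _ k j some ck cj)) } }
          where
          whole : sel circuit A ++ sel circuit B ≡ sel circuit zs
          whole = trans (sym (sel-++ circuit A B)) (cong (sel circuit) (take++drop≡id (2 ^ L) zs))
          some : 1 ≤ length (sel circuit A) + length (sel circuit B)
          some with query-hit zs e
          ... | u , m , _ , k = ≤-trans (sel-some circuit zs m k)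
            (≤-reflexive (trans (cong length (sym whole)) (length-++ (sel circuit A))))

      bsearch-ok : ∀ L zs {u} → length zs ≤ 2 ^ L → u ∈ mem zs → u ∈ circuit →
                   Ok (bsearch i S x L zs) (λ z k → z ∈ mem zs × z ∈ circuit × k ≤ L) 0
      bsearch-ok zero (z ∷ []) {u} le m c = ok-ret (∨-introˡ false (==-refl z) ,
        subst (_∈ circuit) (mem-single {x = u} {z} m) c , z≤n)
      bsearch-ok zero (_ ∷ _ ∷ _) (s≤s ()) m c
      bsearch-ok (suc L) zs {u} le m c = ok-query (go (J i (S ∖ mem A ⊕ x)) refl)
        where
        A B : List (Fin n)
        A = take (2 ^ L) zs
        B = drop (2 ^ L) zs
        parts : ∀ y → mem zs y ≡ mem A y ∨ mem B y
        parts y = trans (cong (λ l → mem l y) (sym (take++drop≡id (2 ^ L) zs))) (mem-++ A B y)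
        go : ∀ b → J i (S ∖ mem A ⊕ x) ≡ b →
             Ok (if b then bsearch i S x L A else bsearch i S x L B)
                (λ z k → z ∈ mem zs × z ∈ circuit × suc k ≤ suc L) 0
        go true e with query-hit A e
        ... | v , vA , _ , vc = ok-weaken (λ { z k (p , q , r) → trans (parts z) (∨-introˡ _ p) , q , s≤s r })
          (bsearch-ok L A (proj₁ (length-halves L zs le)) vA vc)
        go false e = ok-weaken (λ { z k (p , q , r) → trans (parts z) (∨-introʳ (mem A z) p) , q , s≤s r })
          (bsearch-ok L B (proj₂ (length-halves L zs le))
            (∨-elim (mem A u) (trans (sym (parts u)) m) (λ uA → true≢false c (miss A e u uA)) (λ k → k)) c)

-- One relabelling step of the push-relabel scheme.

module LevelSteps where
  open FiniteSets
  open Matroids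
  open RandomizedPrograms
  open OracleProcedures
  open import Data.Nat
  open import Data.Nat.Properties
  open import Data.Rational using (ℚ; 0ℚ) renaming (_≤_ to _≤ℚ_)
  open import Relation.Binary using (tri<; tri≈; tri>)
  open import Data.Nat.Tactic.RingSolver

  T-true : ∀ {b} → T b → b ≡ true
  T-true {true} _ = refl

  <ᵇ-sound : ∀ m t → (m <ᵇ t) ≡ true → m < t
  <ᵇ-sound m t h = <ᵇ⇒< m t (subst T (sym h) tt)

  <ᵇ-in : ∀ {m t} → m < t → (m <ᵇ t) ≡ true
  <ᵇ-in h = T-true (<⇒<ᵇ h)

  <ᵇ-no : ∀ {m t} → (m <ᵇ t) ≡ false → t ≤ m
  <ᵇ-no h = ≮⇒≥ λ l → true≢false (<ᵇ-in l) h

  <ᵇ-out : ∀ {m t} → t ≤ m → (m <ᵇ t) ≡ false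
  <ᵇ-out {m} {t} h = not-true λ k → <-irrefl refl (<-≤-trans (<ᵇ-sound m t k) h)

  module _ {n : ℕ} where

    opaque
     below : (Fin n → ℕ) → ℕ → BSet n
     below a t x = a x <ᵇ t

     at : (Fin n → ℕ) → ℕ → BSet n
     at a t x = a x ≡ᵇ t

     below-sound : ∀ a t {x} → x ∈ below a t → a x < t
     below-sound a t {x} h = <ᵇ-sound (a x) t h

     below-in : ∀ a t {x} → a x < t → x ∈ below a t
     below-in a t {x} h = <ᵇ-in h

     below-no : ∀ a t {x} → x ∉ below a t → t ≤ a x
     below-no a t {x} h = <ᵇ-no h

     below-out : ∀ a t {x} → t ≤ a x → x ∉ below a t
     below-out a t {x} h = <ᵇ-out h

     at-sound : ∀ a t {x} → x ∈ at a t → a x ≡ t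
     at-sound a t {x} h = ≡ᵇ⇒≡ (a x) t (subst T (sym h) tt)

     at-in : ∀ a t {x} → a x ≡ t → x ∈ at a t
     at-in a t {x} h = T-true (≡⇒≡ᵇ (a x) t h)

  sumTo : ℕ → (ℕ → ℕ) → ℕ
  sumTo zero    f = 0
  sumTo (suc D) f = sumTo D f + f D

  sumTo-mono : ∀ D {f g} → (∀ s → s < D → f s ≤ g s) → sumTo D f ≤ sumTo D g
  sumTo-mono zero h = z≤n
  sumTo-mono (suc D) h = +-mono-≤ (sumTo-mono D λ s l → h s (m<n⇒m<1+n l)) (h D ≤-refl)

  sumTo-gain : ∀ D {f g t c} → (∀ s → s < D → f s ≤ g s) → t < D → f t + c ≤ g t → sumTo D f + c ≤ sumTo D g
  sumTo-gain (suc D) {f} {g} {t} {c} h l gain with t ≟ D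
  ... | yes refl = ≤-trans (≤-reflexive (+-assoc (sumTo D f) (f D) c))
          (+-mono-≤ (sumTo-mono D λ s l' → h s (m<n⇒m<1+n l')) gain)
  ... | no ne = lin 0
          (+-mono-≤ (sumTo-gain D {f} {g} {t} {c} (λ s l' → h s (m<n⇒m<1+n l')) (≤∧≢⇒< (≤-pred l) ne) gain) (h D ≤-refl))
          (eq (sumTo D f) (f D) c (sumTo D g) (g D))
    where
    eq : ∀ F f c G g → F + f + c + (G + g) + 0 ≡ G + g + (F + c + f)
    eq = solve-∀

  sumTo-≤ : ∀ D {f c} → (∀ s → s < D → f s ≤ c) → sumTo D f ≤ D * c
  sumTo-≤ zero h = z≤n
  sumTo-≤ (suc D) {f} {c} h = ≤-trans (+-mono-≤ (sumTo-≤ D λ s l → h s (m<n⇒m<1+n l)) (h D ≤-refl))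
    (≤-reflexive (+-comm (D * c) c))

  record State (n : ℕ) : Set where
    constructor st
    field
      S₁ S : BSet n
      a b  : Fin n → ℕ

  module LevelPrograms (n : ℕ) (query : Bool → BSet n → Prog n Bool) where
    open Programs n query
    open State

    tokens : State n → ℕ → BSet n
    tokens s t = (S₁ s ∖ S s) ∩ at (a s) t

    cand : State n → ℕ → BSet n
    cand s t = (full ∖ S s) ∩ at (a s) t

    upper : State n → ℕ → BSet n
    upper s t = S s ∖ below (b s) (suc t)

    lower : State n → ℕ → BSet n
    lower s t = S₁ s ∩ below (a s) (suc t) ∖ tokens s t

    -- An accepted element stays below the cut for the first matroid and enters above it for the
    -- second, hence only `b` rises. A rejected one is spanned by the upper part of the second
    -- matroid, so both labels may rise.
    relabel : State n → ℕ → BSet n → BSet n → BSet n → BSet n → State n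
    relabel s t X R S₁' S' = st S₁' S'
      (λ x → if R x then suc t else a s x) (λ x → if R x ∨ X x then suc t else b s x)

    -- The active elements of the level give up their places in `S₁`, and all elements of the level
    -- outside `S` then compete for places in both matroids. Completing from the old bases
    -- afterwards ensures that neither loses rank.
    levelStep : State n → ℕ → Prog n (State n)
    levelStep s t =
      scan (upper s t) (lower s t) (elems (cand s t)) ∅ ∅ >>= λ r →
      grow false (lower s t ∪ proj₁ r) (elems (S₁ s)) >>= λ S₁' →
      grow true (upper s t ∪ proj₁ r) (elems (S s)) >>= λ S' →
      ret (relabel s t (proj₁ r) (proj₂ r) S₁' S')

  module LevelSpecs {n : ℕ} (I : Bool → Subset n → Bool) (μ : ℚ) (0≤μ : 0ℚ ≤ℚ μ)
    (query : Bool → BSet n → Prog n Bool) (J : Bool → BSet n → Bool) (mat : ∀ i → Mat (J i))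
    (query-ok : ∀ i f → Logic.Ok I μ 0≤μ (query i f) (λ b k → b ≡ J i f × k ≡ 1) 0) where

    open Specs I μ 0≤μ query J mat query-ok public
    open LevelPrograms n query public

    -- S₁ is a basis of the first matroid taken greedily by increasing a, S one of the second matroid taken
    -- by decreasing b; a and b differ by at most one. Elements of S₁ ∖ S are the active ones.
    record Inv (D : ℕ) (s : State n) : Set where
      open State s
      field
        sub  : S ⊆ S₁
        ind₁ : Ind false S₁
        ind₂ : Ind true S
        low  : ∀ t → t ≤ D → ∀ x → a x < t → Sp false (S₁ ∩ below a t) x
        high : ∀ t → 1 ≤ t → ∀ x → t ≤ b x → Sp true (S ∖ below b t) x
        a≤b  : ∀ x → a x ≤ b x
        b≤a  : ∀ x → b x ≤ suc (a x)

    above₁ above₂ : State n → ℕ → ℕ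
    above₁ s t = card (State.S₁ s ∖ below (State.a s) (suc t))
    above₂ s t = card (State.S s ∖ below (State.b s) (suc t))

    potential : ℕ → State n → ℕ
    potential D s = sumTo D (λ t → above₁ s t + above₂ s t)

    split-≥ : ∀ {f g p q : BSet n} → card f ≤ card g → card (g ∩ q) ≤ card (f ∩ p) → card (f ∖ p) ≤ card (g ∖ q)
    split-≥ {f} {g} {p} {q} h k = lin 0 (+-mono-≤ (subst₂ _≤_ (card-split f p) (card-split g q) h) k)
      (eq (card (f ∩ p)) (card (f ∖ p)) (card (g ∩ q)) (card (g ∖ q)))
      where
      eq : ∀ a b c d → b + (c + d + a) + 0 ≡ d + (a + b + c)
      eq = solve-∀

    split-< : ∀ {f g p q : BSet n} → card f ≤ card g → card (g ∖ q) ≤ card (f ∖ p) → card (f ∩ p) ≤ card (g ∩ q)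
    split-< {f} {g} {p} {q} h k = lin 0 (+-mono-≤ (subst₂ _≤_ (card-split f p) (card-split g q) h) k)
      (eq (card (f ∩ p)) (card (f ∖ p)) (card (g ∩ q)) (card (g ∖ q)))
      where
      eq : ∀ a b c d → a + (c + d + b) + 0 ≡ c + (a + b + d)
      eq = solve-∀

    module Step {D : ℕ} {s : State n} {t : ℕ} (inv : Inv D s) (t<D : t < D) {X R S₁' S' : BSet n}
      (scanned : Scanned (upper s t) (lower s t) (elems (cand s t)) ∅ ∅ X R)
      (g₁ : (lower s t ∪ X ⊆ S₁' × S₁' ⊆ lower s t ∪ X ∪ mem (elems (State.S₁ s))) ×
            (Ind false S₁' × (∀ x → x ∈ mem (elems (State.S₁ s)) → Sp false S₁' x)))
      (g₂ : (upper s t ∪ X ⊆ S' × S' ⊆ upper s t ∪ X ∪ mem (elems (State.S s))) ×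
            (Ind true S' × (∀ x → x ∈ mem (elems (State.S s)) → Sp true S' x))) where
      open State s
      open Inv inv
      module Sc = Scanned scanned
      N Q Tk : BSet n
      N = upper s t
      Q = lower s t
      Tk = tokens s t
      a' b' : Fin n → ℕ
      a' = State.a (relabel s t X R S₁' S')
      b' = State.b (relabel s t X R S₁' S')

      X⊆E : X ⊆ cand s t
      X⊆E x h = from-elems (cand s t) x (∪-elim ∅ (mem (elems (cand s t))) {x} (Sc.X⊆ x h) (λ ()) λ k → k)

      R⊆E : R ⊆ cand s t
      R⊆E x h = from-elems (cand s t) x (∪-elim ∅ (mem (elems (cand s t))) {x} (Sc.R⊆ x h) (λ ()) λ k → k)

      E-a : ∀ {x} → x ∈ cand s t → a x ≡ t
      E-a {x} h = at-sound a t (∩-ʳ (full ∖ S) (at a t) x h)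

      E-S : ∀ {x} → x ∈ cand s t → x ∉ S
      E-S {x} h = ∖-ʳ full S (∩-ˡ (full ∖ S) (at a t) x h)

      E-in : ∀ {x} → x ∉ S → a x ≡ t → x ∈ cand s t
      E-in h k = ∩-in (full ∖ S) (at a t) (∖-in full S refl h) (at-in a t k)

      R∉X : ∀ {x} → x ∈ R → x ∉ X
      R∉X {x} h with bool-case (X x)
      ... | inj₂ k = k
      ... | inj₁ k = true≢false (M.down true (⊕-lub (λ _ m → m) (∪-ʳ N X x k)) Sc.ind₂) (Sc.rejected x h)

      Q-in : ∀ {x} → x ∈ S₁ → a x < suc t → (x ∉ S → a x ≢ t) → x ∈ Q
      Q-in {x} h k ne = ∖-in (S₁ ∩ below a (suc t)) Tk (∩-in S₁ _ h (below-in a (suc t) k)) noT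
        where
        noT : x ∉ Tk
        noT with bool-case (Tk x)
        ... | inj₂ m = m
        ... | inj₁ m = ⊥-elim (ne (∖-ʳ S₁ S (∩-ˡ (S₁ ∖ S) (at a t) x m)) (at-sound a t (∩-ʳ (S₁ ∖ S) (at a t) x m)))

      Q⊆S₁ : Q ⊆ S₁
      Q⊆S₁ x h = ∩-ˡ S₁ _ x (∖-ˡ _ Tk x h)

      Q-a : ∀ {x} → x ∈ Q → a x < suc t
      Q-a {x} h = below-sound a (suc t) (∩-ʳ S₁ _ x (∖-ˡ _ Tk x h))

      Q∉R : ∀ {x} → x ∈ Q → x ∉ R
      Q∉R {x} h with bool-case (R x)
      ... | inj₂ k = k
      ... | inj₁ k = true≢false (∩-in (S₁ ∖ S) (at a t) (∖-in S₁ S (Q⊆S₁ x h) (E-S (R⊆E x k))) (at-in a t (E-a (R⊆E x k))))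
                                (∖-ʳ _ Tk h)

      a'-R : ∀ {x} → x ∈ R → a' x ≡ suc t
      a'-R h rewrite h = refl

      a'-¬R : ∀ {x} → x ∉ R → a' x ≡ a x
      a'-¬R h rewrite h = refl

      b'-X : ∀ {x} → x ∈ X → b' x ≡ suc t
      b'-X {x} h rewrite ∨-introʳ (R x) h = refl

      b'-R : ∀ {x} → x ∈ R → b' x ≡ suc t
      b'-R h rewrite h = refl

      b'-¬ : ∀ {x} → x ∉ R → x ∉ X → b' x ≡ b x
      b'-¬ h k rewrite h | k = refl

      a≤a' : ∀ x → a x ≤ a' x
      a≤a' x with bool-case (R x)
      ... | inj₁ h = subst₂ _≤_ (sym (E-a (R⊆E x h))) (sym (a'-R h)) (n≤1+n t)
      ... | inj₂ h = ≤-reflexive (sym (a'-¬R h))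

      b≤b' : ∀ x → b x ≤ b' x
      b≤b' x with bool-case (R x) | bool-case (X x)
      ... | inj₁ h | _ = subst₂ _≤_ refl (trans (cong suc (E-a (R⊆E x h))) (sym (b'-R h))) (b≤a x)
      ... | inj₂ h | inj₁ k = subst₂ _≤_ refl (trans (cong suc (E-a (X⊆E x k))) (sym (b'-X k))) (b≤a x)
      ... | inj₂ h | inj₂ k = ≤-reflexive (sym (b'-¬ h k))

      a'-small : ∀ {x} → a' x ≤ t → x ∉ R × a x ≤ t
      a'-small {x} h with bool-case (R x)
      ... | inj₁ k = ⊥-elim (1+n≰n (subst (_≤ t) (a'-R k) h))
      ... | inj₂ k = k , subst (_≤ t) (a'-¬R k) h

      QX⊆ : Q ∪ X ⊆ S₁'
      QX⊆ = proj₁ (proj₁ g₁)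
      NX⊆ : N ∪ X ⊆ S'
      NX⊆ = proj₁ (proj₁ g₂)
      jS₁' : Ind false S₁'
      jS₁' = proj₁ (proj₂ g₁)
      jS' : Ind true S'
      jS' = proj₁ (proj₂ g₂)

      card₁ : card S₁ ≤ card S₁'
      card₁ = M.rank-≤ false jS₁' ind₁ λ x h → proj₂ (proj₂ g₁) x (in-elems S₁ x h)

      card₂ : card S ≤ card S'
      card₂ = M.rank-≤ true jS' ind₂ λ x h → proj₂ (proj₂ g₂) x (in-elems S x h)

      S'-from : ∀ {x} → x ∈ S' → x ∈ X ⊎ x ∈ S
      S'-from {x} h = ∪-elim (N ∪ X) (mem (elems S)) (proj₂ (proj₁ g₂) x h)
        (λ k → ∪-elim N X k (λ m → inj₂ (∖-ˡ S _ x m)) inj₁) (λ k → inj₂ (from-elems S x k))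

      S₁'-from : ∀ {x} → x ∈ S₁' → x ∈ X ⊎ x ∈ S₁
      S₁'-from {x} h = ∪-elim (Q ∪ X) (mem (elems S₁)) (proj₂ (proj₁ g₁) x h)
        (λ k → ∪-elim Q X k (λ m → inj₂ (Q⊆S₁ x m)) inj₁) (λ k → inj₂ (from-elems S₁ x k))

      S₁'-high : ∀ {x} → x ∈ S₁' → t < a x → x ∈ S₁
      S₁'-high h l with S₁'-from h
      ... | inj₂ k = k
      ... | inj₁ k = ⊥-elim (<-irrefl (sym (E-a (X⊆E _ k))) l)

      ind∩₁ : ∀ p → Ind false (S₁' ∩ p)
      ind∩₁ p = M.down false (∩-ˡ S₁' p) jS₁'

      cardlow : ∀ u → u ≤ D → card (S₁' ∩ below a' u) ≤ card (S₁ ∩ below a u)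
      cardlow u le = M.rank-≤ false (M.down false (∩-ˡ S₁ _) ind₁) (ind∩₁ _)
        λ x h → low u le x (≤-<-trans (a≤a' x) (below-sound a' u (∩-ʳ S₁' _ x h)))

      -- The old low part spans everything with `a` at most t, so the new basis has no more elements
      -- there, yet is no smaller in total. Its high part lies in the old high part and must
      -- therefore be all of it.
      S₁-high : ∀ {x} → x ∈ S₁ → t < a x → x ∈ S₁'
      S₁-high {x} h l = ∖-ˡ S₁' _ x (card-full⊆ sub' (split-≥ card₁ cardB) x (∖-in S₁ _ h (below-out a (suc t) l)))
        where
        sub' : S₁' ∖ below a (suc t) ⊆ S₁ ∖ below a (suc t)
        sub' y m = ∖-in S₁ _ (S₁'-high (∖-ˡ S₁' _ y m) (below-no a (suc t) (∖-ʳ S₁' _ m))) (∖-ʳ S₁' _ m)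
        cardB : card (S₁' ∩ below a (suc t)) ≤ card (S₁ ∩ below a (suc t))
        cardB = M.rank-≤ false (M.down false (∩-ˡ S₁ _) ind₁) (ind∩₁ _)
          λ y m → low (suc t) t<D y (below-sound a (suc t) (∩-ʳ S₁' _ y m))

      S⊆S₁' : S ⊆ S₁'
      S⊆S₁' x h with a x <? suc t
      ... | yes p = QX⊆ x (∪-ˡ Q X x (Q-in (sub x h) p λ k → true≢false h k))
      ... | no p = S₁-high (sub x h) (≮⇒≥ p)

      sub' : S' ⊆ S₁'
      sub' x h with S'-from h
      ... | inj₁ k = QX⊆ x (∪-ʳ Q X x k)
      ... | inj₂ k = S⊆S₁' x k

      below-t⊆ : ∀ u → u ≤ t → S₁ ∩ below a u ⊆ Q
      below-t⊆ u le x h = Q-in (∩-ˡ S₁ _ x h) (m<n⇒m<1+n lt) λ _ e → <-irrefl e lt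
        where
        lt : a x < t
        lt = <-≤-trans (below-sound a u (∩-ʳ S₁ _ x h)) le

      QX⊆low : Q ∪ X ⊆ S₁' ∩ below a' (suc t)
      QX⊆low x h = ∩-in S₁' _ (QX⊆ x h) (below-in a' (suc t) (∪-elim Q X h
        (λ k → subst (_< suc t) (sym (a'-¬R (Q∉R k))) (Q-a k))
        (λ k → s≤s (≤-reflexive (trans (a'-¬R (X∉R k)) (E-a (X⊆E x k)))))))
        where
        X∉R : x ∈ X → x ∉ R
        X∉R k with bool-case (R x)
        ... | inj₁ m = true≢false k (R∉X m)
        ... | inj₂ m = m

      -- Below level t the old basis is untouched and spans as before. At level t an element of `S`
      -- is in `Q`, and any other is either raised or was found spanned by the scan.
      spanQX : ∀ x → a' x ≤ t → Sp false (Q ∪ X) x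
      spanQX x h with a'-small h
      ... | x∉R , le with m≤n⇒m<n∨m≡n le
      ... | inj₁ lt = M.Sp-mono false (λ y m → ∪-ˡ Q X y (below-t⊆ t ≤-refl y m)) (low t (<⇒≤ t<D) x lt)
      ... | inj₂ e with bool-case (S x)
      ...   | inj₁ xS = inj₁ (∪-ˡ Q X x (Q-in (sub x xS) (s≤s le) λ k → true≢false xS k))
      ...   | inj₂ xS with Sc.covered x (in-elems (cand s t) x (E-in xS e))
      ...     | inj₁ xR = true≢false xR x∉R
      ...     | inj₂ sp = sp

      -- Up to t the old part is retained, and at t + 1 `spanQX` applies. Beyond that nothing new
      -- has entered above the threshold, so the part below it is at least as large as before and
      -- spans by counting.
      low' : ∀ u → u ≤ D → ∀ x → a' x < u → Sp false (S₁' ∩ below a' u) x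
      low' u le x h with <-cmp u (suc t)
      ... | tri≈ _ refl _ = M.Sp-mono false QX⊆low (spanQX x (≤-pred h))
      ... | tri< u≤t _ _ = M.Sp-mono false inc (low u le x (≤-<-trans (a≤a' x) h))
        where
        inc : S₁ ∩ below a u ⊆ S₁' ∩ below a' u
        inc y m = ∩-in S₁' _ (QX⊆ y (∪-ˡ Q X y yQ))
          (below-in a' u (subst (_< u) (sym (a'-¬R (Q∉R yQ))) (below-sound a u (∩-ʳ S₁ _ y m))))
          where yQ = below-t⊆ u (≤-pred u≤t) y m
      ... | tri> _ _ u>t = M.spans-by-count false {P = λ y → a y < u} (M.down false (∩-ˡ S₁ _) ind₁) (ind∩₁ _)
              (low u le) (λ y m → ≤-<-trans (a≤a' y) (below-sound a' u (∩-ʳ S₁' _ y m)))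
              (split-< card₁ (card-mono inc)) x (≤-<-trans (a≤a' x) h)
        where
        inc : S₁' ∖ below a' u ⊆ S₁ ∖ below a u
        inc y m = ∖-in S₁ _ (S₁'-high (∖-ˡ S₁' _ y m) (≤-trans (<⇒≤ u>t) ay≥)) (below-out a u ay≥)
          where
          a'y≥ : u ≤ a' y
          a'y≥ = below-no a' u (∖-ʳ S₁' _ m)
          y∉R : y ∉ R
          y∉R with bool-case (R y)
          ... | inj₂ k = k
          ... | inj₁ k = ⊥-elim (<-irrefl refl (<-≤-trans u>t (subst (u ≤_) (a'-R k) a'y≥)))
          ay≥ : u ≤ a y
          ay≥ = subst (u ≤_) (a'-¬R y∉R) a'y≥

      NX⊆high : N ∪ X ⊆ S' ∖ below b' (suc t)
      NX⊆high x h = ∖-in S' _ (NX⊆ x h) (below-out b' (suc t) (∪-elim N X h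
        (λ k → ≤-trans (below-no b (suc t) (∖-ʳ S _ k)) (b≤b' x))
        (λ k → ≤-reflexive (sym (b'-X k)))))

      highinc : ∀ u → suc t ≤ u → S ∖ below b u ⊆ S' ∖ below b' u
      highinc u le y m = ∖-in S' _ (NX⊆ y (∪-ˡ N X y (∖-in S _ (∖-ˡ S _ y m) (below-out b (suc t) (≤-trans le by)))))
        (below-out b' u (≤-trans by (b≤b' y)))
        where by = below-no b u (∖-ʳ S _ m)

      highcount : ∀ u → u ≤ t → card (S ∖ below b u) ≤ card (S' ∖ below b' u)
      highcount u le = split-≥ card₂ (card-mono inc)
        where
        inc : S' ∩ below b' u ⊆ S ∩ below b u
        inc y m with S'-from (∩-ˡ S' _ y m) | below-sound b' u (∩-ʳ S' _ y m)
        ... | inj₁ k | lt = ⊥-elim (<-irrefl refl (<-≤-trans (subst (_< u) (b'-X k) lt) (≤-trans le (n≤1+n t))))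
        ... | inj₂ k | lt = ∩-in S _ k (below-in b u (≤-<-trans (b≤b' y) lt))

      b'-cases : ∀ {A : Set} x → (x ∈ R → A) → (x ∈ X → A) → (b' x ≡ b x → A) → A
      b'-cases x f g h with bool-case (R x) | bool-case (X x)
      ... | inj₁ k | _ = f k
      ... | inj₂ k | inj₁ l = g l
      ... | inj₂ k | inj₂ l = h (b'-¬ k l)

      -- Only thresholds up to t are delicate, as the upper part is renewed there. Candidates
      -- already had `b` at least t, so what the new part contains was spanned by the old one; it
      -- has not become smaller and so spans as much.
      high' : ∀ u → 1 ≤ u → ∀ x → u ≤ b' x → Sp true (S' ∖ below b' u) x
      high' u pos x h with <-cmp u (suc t)
      ... | tri≈ _ refl _ = b'-cases x
              (λ k → M.Sp-mono true NX⊆high (inj₂ (Sc.rejected x k)))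
              (λ k → inj₁ (NX⊆high x (∪-ʳ N X x k)))
              (λ e → M.Sp-mono true (λ y m → NX⊆high y (∪-ˡ N X y m)) (high (suc t) pos x (subst (suc t ≤_) e h)))
      ... | tri> _ _ u>t = b'-cases x
              (λ k → ⊥-elim (<-irrefl refl (<-≤-trans u>t (subst (u ≤_) (b'-R k) h))))
              (λ k → ⊥-elim (<-irrefl refl (<-≤-trans u>t (subst (u ≤_) (b'-X k) h))))
              (λ e → M.Sp-mono true (highinc u (<⇒≤ u>t)) (high u pos x (subst (u ≤_) e h)))
      ... | tri< u≤t _ _ = M.spans-by-count true {P = λ y → u ≤ b' y} (M.down true (∖-ˡ S _) ind₂) (M.down true (∖-ˡ S' _) jS')
              (λ y m → high u pos y (old y m)) (λ y m → below-no b' u (∖-ʳ S' _ m))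
              (highcount u (≤-pred u≤t)) x h
        where
        old : ∀ y → u ≤ b' y → u ≤ b y
        old y m = b'-cases y
          (λ k → ≤-trans (≤-pred u≤t) (≤-trans (≤-reflexive (sym (E-a (R⊆E y k)))) (a≤b y)))
          (λ k → ≤-trans (≤-pred u≤t) (≤-trans (≤-reflexive (sym (E-a (X⊆E y k)))) (a≤b y)))
          (λ e → subst (u ≤_) e m)

      inv' : Inv D (relabel s t X R S₁' S')
      inv' = record
        { sub = sub' ; ind₁ = jS₁' ; ind₂ = jS' ; low = low' ; high = high' ; a≤b = a'≤b' ; b≤a = b'≤a' }
        where
        a'≤b' : ∀ x → a' x ≤ b' x
        a'≤b' x with bool-case (R x)
        ... | inj₁ k = ≤-reflexive (trans (a'-R k) (sym (b'-R k)))
        ... | inj₂ k = ≤-trans (≤-reflexive (a'-¬R k)) (≤-trans (a≤b x) (b≤b' x))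
        b'≤a' : ∀ x → b' x ≤ suc (a' x)
        b'≤a' x = b'-cases x
          (λ k → ≤-trans (≤-reflexive (trans (b'-R k) (sym (a'-R k)))) (n≤1+n _))
          (λ k → ≤-trans (≤-reflexive (trans (b'-X k) (cong suc (sym (E-a (X⊆E x k)))))) (s≤s (a≤a' x)))
          (λ e → ≤-trans (≤-reflexive e) (≤-trans (b≤a x) (s≤s (a≤a' x))))

      above₁-mono : ∀ u → u < D → above₁ s u ≤ above₁ (relabel s t X R S₁' S') u
      above₁-mono u lt = split-≥ card₁ (cardlow (suc u) lt)

      above₂-mono : ∀ u → u < D → above₂ s u ≤ above₂ (relabel s t X R S₁' S') u
      above₂-mono u lt with suc u ≤? t
      ... | yes p = highcount (suc u) p
      ... | no p = card-mono (highinc (suc u) (≰⇒> p))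

      -- Withdrawing the active elements frees `card Tk` low places, of which `X` refills at most
      -- `card X`. The total rank is kept, so the remaining ones reappear above the level.
      above₁-gain : above₁ s t + card Tk ≤ above₁ (relabel s t X R S₁' S') t + card X
      above₁-gain = lin 0 (+-mono-≤ (+-mono-≤ (subst₂ _≤_ (card-split S₁ B) (card-split S₁' (below a' (suc t))) card₁) spanned)
                            (+-mono-≤ (card-union {f = Q ∪ X} {Q} {X} λ _ m → m) parts))
        (eq (card (S₁ ∩ B)) (card (S₁ ∖ B)) (card (S₁' ∩ below a' (suc t))) (card (S₁' ∖ below a' (suc t)))
            (card (Q ∪ X)) (card Q) (card X) (card Tk))
        where
        B = below a (suc t)
        spanned : card (S₁' ∩ below a' (suc t)) ≤ card (Q ∪ X)
        spanned = M.rank-≤ false Sc.ind₁ (ind∩₁ _) λ x h → spanQX x (≤-pred (below-sound a' (suc t) (∩-ʳ S₁' _ x h)))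
        parts : card Q + card Tk ≤ card (S₁ ∩ B)
        parts = card-disj (∖-ˡ (S₁ ∩ B) Tk)
          (λ x h → ∩-in S₁ B (∖-ˡ S₁ S x (∩-ˡ (S₁ ∖ S) _ x h))
            (below-in a (suc t) (s≤s (≤-reflexive (at-sound a t (∩-ʳ (S₁ ∖ S) (at a t) x h))))))
          (λ x h → ∖-ʳ (S₁ ∩ B) Tk h)
        eq : ∀ p q p' q' u Q X Tk → q + Tk + (p' + q' + u + (Q + X + p)) + 0 ≡ q' + X + (p + q + p' + (u + (Q + Tk)))
        eq = solve-∀

      above₂-gain : above₂ s t + card X ≤ above₂ (relabel s t X R S₁' S') t
      above₂-gain = card-disj {f = N} {X} (λ x h → NX⊆high x (∪-ˡ N X x h)) (λ x h → NX⊆high x (∪-ʳ N X x h))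
        λ x h → ∉-⊆ X⊆E (case x h)
        where
        case : ∀ x → x ∈ N → x ∉ cand s t
        case x h with bool-case (cand s t x)
        ... | inj₂ k = k
        ... | inj₁ k = true≢false (∖-ˡ S _ x h) (E-S k)

      -- The `card X` missing from the first matroid's gain is exactly what the second gains, so the
      -- potential rises by the number of active elements however the scan turns out.
      gain : potential D s + card Tk ≤ potential D (relabel s t X R S₁' S')
      gain = sumTo-gain D (λ u lt → +-mono-≤ (above₁-mono u lt) (above₂-mono u lt)) t<D
        (lin 0 (+-mono-≤ above₁-gain above₂-gain)
          (eq (above₁ s t) (above₂ s t) (card Tk) (card X) (above₁ (relabel s t X R S₁' S') t) (above₂ (relabel s t X R S₁' S') t)))
        where
        eq : ∀ p q Tk X p' q' → p + q + Tk + (p' + X + q') + 0 ≡ p' + q' + (p + Tk + (q + X))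
        eq = solve-∀

    length-elems≤ : ∀ (f : BSet n) → length (elems f) ≤ n
    length-elems≤ f = ≤-trans (≤-reflexive (length-elems f)) (card-≤n f)

    levelStep-ok : ∀ D s t → Inv D s → t < D →
                   Ok (levelStep s t) (λ s' k → (Inv D s' × potential D s + card (tokens s t) ≤ potential D s') ×
                                                k ≤ 4 * n) 0
    levelStep-ok D s t inv t<D =
      ok-bind (scan-ok (upper s t) (lower s t) (elems (cand s t)) ∅ ∅
                (M.down false (∪-lub (⊆-trans (∖-ˡ _ (tokens s t)) (∩-ˡ (State.S₁ s) _)) λ _ ()) (Inv.ind₁ inv))
                (M.down true (∪-lub (∖-ˡ (State.S s) _) λ _ ()) (Inv.ind₂ inv)) (λ _ ())) λ { r k (sc , ck) →
      ok-bind (grow-ok false (lower s t ∪ proj₁ r) (elems (State.S₁ s)) (Scanned.ind₁ sc)) λ { S₁' l (p , q , cl) →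
      ok-bind (grow-ok true (upper s t ∪ proj₁ r) (elems (State.S s)) (Scanned.ind₂ sc)) λ { S' m (p' , q' , cm) →
      ok-ret ((Step.inv' inv t<D sc (p , q) (p' , q') , Step.gain inv t<D sc (p , q) (p' , q')) ,
        lin 0 (+-mono-≤ (≤-trans ck (*-monoʳ-≤ 2 (length-elems≤ (cand s t))))
                (+-mono-≤ (≤-trans cl (length-elems≤ (State.S₁ s))) (≤-trans cm (length-elems≤ (State.S s)))))
          (eq k l m n)) } } }
      where
      eq : ∀ k l m n → k + (l + (m + 0)) + (2 * n + (n + n)) + 0 ≡ 4 * n + (k + (l + m))
      eq = solve-∀

-- Phase 1: duality gap and number of relabelling steps.

module Approximation where
  open FiniteSets
  open Matroids
  open RandomizedPrograms
  open OracleProcedures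
  open LevelSteps
  open import Data.Nat
  open import Data.Nat.Properties
  open import Data.Rational using (ℚ; 0ℚ) renaming (_≤_ to _≤ℚ_)
  open import Data.Nat.Tactic.RingSolver

  crowded : (f : ℕ → ℕ) (K D : ℕ) → (∃ λ t → t < D × K ≤ f t) ⊎ (∀ t → t < D → f t < K)
  crowded f K zero = inj₂ λ _ ()
  crowded f K (suc D) with K ≤? f D
  ... | yes p = inj₁ (D , ≤-refl , p)
  ... | no p with crowded f K D
  ...   | inj₁ (t , l , q) = inj₁ (t , m<n⇒m<1+n l , q)
  ...   | inj₂ q = inj₂ all
    where
    all : ∀ t → t < suc D → f t < K
    all t l with t ≟ D
    ... | yes refl = ≰⇒> p
    ... | no ne = q t (≤∧≢⇒< (≤-pred l) ne)

  module Phase1Programs (n : ℕ) (query : Bool → BSet n → Prog n Bool) where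
    open Programs n query
    open LevelPrograms n query
    open State

    -- The outcome of the search for a crowded level is an argument, so that program and
    -- specification branch on the same term.
    phase1Choice : ∀ {P : ℕ → Set} {R : Set} → State n → (∃ λ t → P t) ⊎ R → Prog n (State n ⊎ BSet n)
    phase1Choice s (inj₁ (t , _)) = levelStep s t >>= λ s' → ret (inj₁ s')
    phase1Choice s (inj₂ _)       = ret (inj₂ (S s))

    phase1Step : ℕ → ℕ → State n → Prog n (State n ⊎ BSet n)
    phase1Step D K s = phase1Choice s (crowded (λ t → card (tokens s t)) K D)

    phase1 : ℕ → ℕ → ℕ → Prog n (BSet n)
    phase1 D K F = grow false ∅ (elems full) >>= λ S₁ →
      while (phase1Step D K) F S (st S₁ ∅ (λ _ → 0) (λ _ → 0))

  module Phase1Specs {n : ℕ} (I : Bool → Subset n → Bool) (μ : ℚ) (0≤μ : 0ℚ ≤ℚ μ)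
    (query : Bool → BSet n → Prog n Bool) (J : Bool → BSet n → Bool) (mat : ∀ i → Mat (J i))
    (query-ok : ∀ i f → Logic.Ok I μ 0≤μ (query i f) (λ b k → b ≡ J i f × k ≡ 1) 0) where

    open LevelSpecs I μ 0≤μ query J mat query-ok public
    open Phase1Programs n query public

    Common : BSet n → Set
    Common f = Ind false f × Ind true f

    -- Weak duality: a common independent set splits into a part of {a < t} and a part of {t ≤ b}.
    cut-bound : ∀ {D s} → Inv D s → ∀ {f} → Common f → ∀ t → 1 ≤ t → t ≤ D →
                card f ≤ card (State.S₁ s ∩ below (State.a s) t) + card (State.S s ∖ below (State.b s) t)
    cut-bound {D} {s} inv {f} (j₁ , j₂) t pos le = ≤-trans (≤-reflexive (card-split f (below a t))) (+-mono-≤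
      (M.rank-≤ false (M.down false (∩-ˡ S₁ (below a t)) ind₁) (M.down false (∩-ˡ f (below a t)) j₁)
        λ x h → low t le x (below-sound a t (∩-ʳ f (below a t) x h)))
      (M.rank-≤ true (M.down true (∖-ˡ S (below b t)) ind₂) (M.down true (∖-ˡ f (below a t)) j₂)
        λ x h → high t pos x (≤-trans (below-no a t (∖-ʳ f (below a t) h)) (a≤b x))))
      where
      open State s
      open Inv inv

    -- Each element of S crosses at most one of the levels.
    crossing-sum : ∀ {D s} → Inv D s → ∀ E → let open State s in
                   sumTo E (λ u → card ((S ∩ below a (suc u)) ∖ below b (suc u))) ≤ card (S ∩ below a E)
    crossing-sum inv zero = z≤n
    crossing-sum {D} {s} inv (suc E) = ≤-trans
      (+-mono-≤ (crossing-sum inv E) (card-mono {g = S ∩ at a E} only))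
      (card-disj (λ x h → ∩-in S _ (∩-ˡ S _ x h) (below-in a (suc E) (m<n⇒m<1+n (below-sound a E (∩-ʳ S _ x h)))))
                 (λ x h → ∩-in S _ (∩-ˡ S _ x h) (below-in a (suc E) (s≤s (≤-reflexive (at-sound a E (∩-ʳ S _ x h))))))
                 λ x h → not-true λ k → <-irrefl (at-sound a E (∩-ʳ S _ x k)) (below-sound a E (∩-ʳ S _ x h)))
      where
      open State s
      open Inv inv
      only : (S ∩ below a (suc E)) ∖ below b (suc E) ⊆ S ∩ at a E
      only x h = ∩-in S _ (∩-ˡ S _ x (∖-ˡ _ _ x h)) (at-in a E (≤-antisym
        (≤-pred (below-sound a (suc E) (∩-ʳ S _ x (∖-ˡ _ _ x h))))
        (≤-pred (≤-trans (below-no b (suc E) (∖-ʳ (S ∩ below a (suc E)) _ h)) (b≤a x)))))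

    active-below : ∀ {D s K} → Inv D s → (∀ u → u < D → card (tokens s u) ≤ K) → ∀ t → t ≤ D →
                   card ((State.S₁ s ∖ State.S s) ∩ below (State.a s) t) ≤ t * K
    active-below {s = s} inv h zero le = ≤-trans
      (card-mono {g = ∅} λ x k → ⊥-elim (n≮0 (below-sound (State.a s) 0 (∩-ʳ (State.S₁ s ∖ State.S s) _ x k))))
      (≤-reflexive card-∅)
    active-below {s = s} {K} inv h (suc t) le = ≤-trans (card-union {g = tokens s t} {h = V ∩ below a t} cover)
      (+-mono-≤ (h t le) (active-below inv h t (<⇒≤ le)))
      where
      open State s
      V = S₁ ∖ S
      cover : V ∩ below a (suc t) ⊆ tokens s t ∪ V ∩ below a t
      cover x k with m≤n⇒m<n∨m≡n (≤-pred (below-sound a (suc t) (∩-ʳ V _ x k)))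
      ... | inj₁ lt = ∪-ʳ (tokens s t) _ x (∩-in V _ (∩-ˡ V _ x k) (below-in a t lt))
      ... | inj₂ e  = ∪-ˡ (tokens s t) _ x (∩-in V _ (∩-ˡ V _ x k) (at-in a t e))

    -- At each level the cut bound exceeds `card S` by the active elements below it and by the
    -- elements of `S` crossing it. Summing over all `D` levels, where the crossings total at most
    -- `card S`, replaces the choice of a sparsest level and avoids division.
    gap-bound : ∀ {D s K} → Inv D s → (∀ u → u < D → card (tokens s u) ≤ K) → ∀ {f} → Common f →
                D * card f ≤ D * (card (State.S s) + D * K) + card (State.S s)
    gap-bound {D} {s} {K} inv few {f} cf = begin
      D * card f                                          ≡⟨ sum-const D (card f) ⟨
      sumTo D (λ _ → card f)                              ≤⟨ sumTo-mono D each ⟩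
      sumTo D (λ u → (card S + D * K) + crossing u)       ≡⟨ sum-+ D (card S + D * K) crossing ⟩
      D * (card S + D * K) + sumTo D crossing             ≤⟨ +-monoʳ-≤ (D * (card S + D * K))
                                                             (≤-trans (crossing-sum inv D) (card-mono (∩-ˡ S _))) ⟩
      D * (card S + D * K) + card S                       ∎
      where
      open State s
      open Inv inv
      open ≤-Reasoning
      crossing : ℕ → ℕ
      crossing u = card ((S ∩ below a (suc u)) ∖ below b (suc u))
      sum-const : ∀ D c → sumTo D (λ _ → c) ≡ D * c
      sum-const zero c = refl
      sum-const (suc D) c = trans (cong (_+ c) (sum-const D c)) (+-comm (D * c) c)
      sum-+ : ∀ D c g → sumTo D (λ u → c + g u) ≡ D * c + sumTo D g
      sum-+ zero c g = refl
      sum-+ (suc D) c g = trans (cong (_+ (c + g D)) (sum-+ D c g)) (eq (D * c) (sumTo D g) c (g D))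
        where
        eq : ∀ a b c d → a + b + (c + d) ≡ c + a + (b + d)
        eq = solve-∀
      each : ∀ u → u < D → card f ≤ (card S + D * K) + crossing u
      each u lt = begin
        card f ≤⟨ cut-bound inv cf (suc u) (s≤s z≤n) lt ⟩
        card (S₁ ∩ A) + card (S ∖ B)
          ≤⟨ +-mono-≤ (card-union {g = (S₁ ∖ S) ∩ A} {h = S ∩ A} cover) (card-union {g = (S ∖ A)} {h = (S ∩ A) ∖ B} cover') ⟩
        (card ((S₁ ∖ S) ∩ A) + card (S ∩ A)) + (card (S ∖ A) + crossing u)
          ≤⟨ +-monoˡ-≤ _ (+-monoˡ-≤ _ (≤-trans (active-below inv few (suc u) lt) (*-monoˡ-≤ K lt))) ⟩
        (D * K + card (S ∩ A)) + (card (S ∖ A) + crossing u)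
          ≡⟨ eq (D * K) (card (S ∩ A)) (card (S ∖ A)) (crossing u) ⟩
        ((card (S ∩ A) + card (S ∖ A)) + D * K) + crossing u
          ≡⟨ cong (λ z → z + D * K + crossing u) (card-split S A) ⟨
        (card S + D * K) + crossing u ∎
        where
        A B : BSet n
        A = below a (suc u)
        B = below b (suc u)
        eq : ∀ k p q c → (k + p) + (q + c) ≡ ((p + q) + k) + c
        eq = solve-∀
        cover : S₁ ∩ A ⊆ (S₁ ∖ S) ∩ A ∪ S ∩ A
        cover x h with bool-case (S x)
        ... | inj₁ k = ∪-ʳ ((S₁ ∖ S) ∩ A) _ x (∩-in S A k (∩-ʳ S₁ A x h))
        ... | inj₂ k = ∪-ˡ ((S₁ ∖ S) ∩ A) _ x (∩-in (S₁ ∖ S) A (∖-in S₁ S (∩-ˡ S₁ A x h) k) (∩-ʳ S₁ A x h))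
        cover' : S ∖ B ⊆ S ∖ A ∪ ((S ∩ A) ∖ B)
        cover' x h with bool-case (A x)
        ... | inj₁ k = ∪-ʳ (S ∖ A) _ x (∖-in (S ∩ A) B (∩-in S A (∖-ˡ S B x h) k) (∖-ʳ S B h))
        ... | inj₂ k = ∪-ˡ (S ∖ A) _ x (∖-in S A (∖-ˡ S B x h) k)

    -- The potential adds two cardinals of at most `cap` over `D` levels, and a crowded level raises
    -- it by at least `K`; the hypothesis `enough` thus rules out that the fuel is exhausted.
    phase1-ok : ∀ D K F cap → (∀ f → Ind false f → card f ≤ cap) → D * (cap + cap) < K * F →
                Ok (phase1 D K F) (λ S k → (Common S ×
                      (∀ {f} → Common f → D * card f ≤ D * (card S + D * K) + card S)) × k ≤ n + 4 * n * F) (F * 0)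
    phase1-ok D K F cap bounded enough =
      ok-bind (grow-ok false ∅ (elems full) (M.J∅ false)) λ { S₁ k ((_ , _) , (jS₁ , sp) , ck) →
      ok-weaken (λ { S j (c , le) → c , (begin
          k + j ≤⟨ +-mono-≤ (≤-trans ck (length-elems≤ full)) (≤-trans (m≤m+n j 0) (≤-trans (≤-reflexive (+-identityʳ j)) le)) ⟩
          n + 4 * n * F ∎) })
        (ok-while P Q 0 (λ {s} {c} p → halt {s} {c} p) body F (st S₁ ∅ (λ _ → 0) (λ _ → 0)) 0
          (initial S₁ jS₁ (λ x → sp x (in-elems full x refl)) , ≤-trans (m≤n+m _ _) ≤-refl , ≤-refl)) }
      where
      open ≤-Reasoning
      P : ℕ → State n → ℕ → Set
      P f s c = Inv D s × K * F ≤ potential D s + K * f × c + 4 * n * f ≤ 4 * n * F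
      Q : BSet n → ℕ → Set
      Q S k = (Common S × (∀ {f} → Common f → D * card f ≤ D * (card S + D * K) + card S)) × k ≤ 4 * n * F
      initial : ∀ S₁ → Ind false S₁ → (∀ x → Sp false S₁ x) → Inv D (st S₁ ∅ (λ _ → 0) (λ _ → 0))
      initial S₁ j sp = record
        { sub = λ _ () ; ind₁ = j ; ind₂ = M.J∅ true
        ; low = λ t _ x l → M.Sp-mono false (λ y h → ∩-in S₁ _ h (below-in (λ _ → 0) t l)) (sp x)
        ; high = λ { (suc t) _ x () } ; a≤b = λ _ → z≤n ; b≤a = λ _ → z≤n }
      halt : ∀ {s c} → P 0 s c → ⊥
      halt {s} (inv , le , _) = <-irrefl refl (begin-strict
        D * (cap + cap)         <⟨ enough ⟩
        K * F                   ≤⟨ le ⟩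
        potential D s + K * 0   ≡⟨ trans (cong (potential D s +_) (*-zeroʳ K)) (+-identityʳ _) ⟩
        potential D s           ≤⟨ sumTo-≤ D (λ u _ → +-mono-≤
                                     (≤-trans (card-mono (∖-ˡ S₁ _)) (bounded _ ind₁))
                                     (≤-trans (card-mono (⊆-trans (∖-ˡ S _) sub)) (bounded _ ind₁))) ⟩
        D * (cap + cap)         ∎)
        where
        open State s
        open Inv inv
      body : ∀ f s c → P (suc f) s c → Ok (phase1Step D K s) (After P Q f c) 0
      body f s c (inv , le , cost) with crowded (λ t → card (tokens s t)) K D
      ... | inj₂ few = ok-ret (((M.down false (Inv.sub inv) (Inv.ind₁ inv) , Inv.ind₂ inv) ,
              gap-bound inv λ u l → <⇒≤ (few u l)) , ≤-trans (≤-reflexive (+-identityʳ c)) (≤-trans (m≤m+n c _) cost))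
      ... | inj₁ (t , t<D , K≤) = ok-bind (levelStep-ok D s t inv t<D) λ { s' k ((inv' , up) , ck) → ok-ret
              (inv' ,
               lin 0 (+-mono-≤ le (+-mono-≤ up K≤)) (eq₁ (K * F) (potential D s') K f (potential D s) (card (tokens s t))) ,
               lin 0 (+-mono-≤ cost ck) (eq₂ c k n f (4 * n * F))) }
        where
        eq₁ : ∀ KF p' K f p t → KF + (p + K * suc f + (p' + t)) + 0 ≡ p' + K * f + (KF + (p + t + K))
        eq₁ = solve-∀
        eq₂ : ∀ c k n f B → c + (k + 0) + 4 * n * f + (B + 4 * n) + 0 ≡ B + (c + 4 * n * suc f + k)
        eq₂ = solve-∀

-- Augmentation along paths without shortcuts.

module Augmentation where
  open FiniteSets
  open Matroids
  open import Data.Nat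
  open import Data.Nat.Properties
  open import Data.Nat.Tactic.RingSolver

  module _ {n : ℕ} where

    Pairs : Set
    Pairs = List (Fin n × Fin n)

    us vs : Pairs → BSet n
    us ps = mem (map proj₁ ps)
    vs ps = mem (map proj₂ ps)

    -- The symmetric difference of S with the alternating path v, u₁, v₁, u₂, v₂, ….
    aug : BSet n → Fin n → Pairs → BSet n
    aug S v []             = S ⊕ v
    aug S v ((u , w) ∷ ps) = aug S w ps ⊖ u ⊕ v

    aug-from : ∀ S v ps {x} → x ∈ aug S v ps → (x ≡ v ⊎ x ∈ vs ps) ⊎ (x ∈ S × x ∉ us ps)
    aug-from S v [] {x} h = ⊕-elim S v h (λ k → inj₂ (k , refl)) (λ e → inj₁ (inj₁ e))
    aug-from S v ((u , w) ∷ ps) {x} h = ⊕-elim (aug S w ps ⊖ u) v h rest (λ e → inj₁ (inj₁ e))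
      where
      rest : x ∈ aug S w ps ⊖ u → (x ≡ v ⊎ x ∈ vs ((u , w) ∷ ps)) ⊎ (x ∈ S × x ∉ us ((u , w) ∷ ps))
      rest k with aug-from S w ps (⊖-ˡ (aug S w ps) u x k)
      ... | inj₁ (inj₁ refl) = inj₁ (inj₂ (∨-introˡ (vs ps x) (==-refl x)))
      ... | inj₁ (inj₂ m)    = inj₁ (inj₂ (∨-introʳ (x == w) m))
      ... | inj₂ (s , m)     = inj₂ (s , not-true λ q → ∨-elim (x == u) q
                                 (λ e → ⊖-≢ (aug S w ps) u k (==-sound e)) (λ r → true≢false r m))

    card-insert : ∀ (T p : BSet n) {v} → v ∉ T → card (T ∩ p) + # (p v) ≤ card ((T ⊕ v) ∩ p)
    card-insert T p {v} vT with bool-case (p v)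
    ... | inj₁ h rewrite h = ≤-trans (≤-reflexive (trans (+-comm _ 1) (sym (card-⊕ _ v (∉-⊆ (∩-ˡ T p) vT)))))
            (card-mono (⊕-lub (λ x k → ∩-in (T ⊕ v) p (⊕-ˡ T v x (∩-ˡ T p x k)) (∩-ʳ T p x k))
                              (∩-in (T ⊕ v) p (⊕-self T v) h)))
    ... | inj₂ h rewrite h = ≤-trans (≤-reflexive (+-identityʳ _))
            (card-mono λ x k → ∩-in (T ⊕ v) p (⊕-ˡ T v x (∩-ˡ T p x k)) (∩-ʳ T p x k))

    card-delete : ∀ (T p : BSet n) u → card (T ∩ p) ≤ card ((T ⊖ u) ∩ p) + # (p u)
    card-delete T p u with bool-case (p u)
    ... | inj₁ h rewrite h = ≤-trans (card-⊖≤ (T ∩ p) u) (≤-trans (s≤s (card-mono λ x k →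
            ∩-in (T ⊖ u) p (⊖-in T u (∩-ˡ T p x (⊖-ˡ (T ∩ p) u x k)) (⊖-≢ (T ∩ p) u k)) (∩-ʳ T p x (⊖-ˡ (T ∩ p) u x k))))
            (≤-reflexive (+-comm 1 _)))
    ... | inj₂ h rewrite h = ≤-trans (card-mono λ x k → ∩-in (T ⊖ u) p
            (⊖-in T u (∩-ˡ T p x k) λ { refl → true≢false (∩-ʳ T p x k) h }) (∩-ʳ T p x k)) (m≤m+n _ 0)

    card-swap : ∀ (T p : BSet n) {u v} → v ∉ T → card (T ∩ p) + # (p v) ≤ card ((T ⊖ u ⊕ v) ∩ p) + # (p u)
    card-swap T p {u} {v} vT = lin 0 (+-mono-≤ (card-delete T p u) (card-insert (T ⊖ u) p {v} (∉-⊆ (⊖-ˡ T u) vT)))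
      (eq (card (T ∩ p)) (# (p v)) (card ((T ⊖ u) ∩ p)) (# (p u)) (card ((T ⊖ u ⊕ v) ∩ p)))
      where
      eq : ∀ a b c d e → a + b + (c + d + e) + 0 ≡ e + d + (a + (c + b))
      eq = solve-∀

  module Chains {n : ℕ} {J : BSet n → Bool} (mat : Mat J) (S : BSet n) where
    open MatLemmas mat

    -- No edge of the first exchange graph jumps ahead along the path; the list holds the u's passed.
    data Forward : List (Fin n) → Pairs → Set where
      []  : ∀ {us₀} → Forward us₀ []
      hop : ∀ {us₀ u w ps} → u ∈ S → w ∉ S → Ind (S ⊖ u ⊕ w) → J (S ∖ mem us₀ ⊕ w) ≡ false →
            Forward (u ∷ us₀) ps → Forward us₀ ((u , w) ∷ ps)

    -- The same for the second exchange graph, read from the far end of the path.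
    data Backward : Fin n → Pairs → Set where
      end : ∀ {v} → v ∉ S → Ind (S ⊕ v) → Backward v []
      hop : ∀ {v u w ps} → Ind (S ⊖ u ⊕ v) → J (S ∖ us ps ⊕ v) ≡ false → Backward w ps → Backward v ((u , w) ∷ ps)

    -- A missing edge from `v` to later elements means that the circuit of `v` lies in `S ∖ us ps`,
    -- which the partial augmentation still contains. So `exchange-circuit` transfers the swap of
    -- `u` for `v` to it.
    backward-ok : ∀ v ps → Backward v ps →
      (Ind (aug S v ps) × card (aug S v ps) ≡ suc (card S)) × S ∖ us ps ⊆ aug S v ps
    backward-ok v [] (end vS j) = (j , card-⊕ S v vS) , λ x k → ⊕-ˡ S v x (∖-ˡ S ∅ x k)
    backward-ok v ((u , w) ∷ ps) (hop j dep rest) with backward-ok w ps rest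
    ... | (jT , cT) , inc with exchange-circuit {u = u} inc jT dep (down (⊕-mono v (⊖-mono u (∖-ˡ S (us ps)))) j)
    ...   | jT' , uA , vT = (jT' , trans (card-⊕ _ v (∉-⊆ (⊖-ˡ _ u) vT)) (trans (card-⊖ _ u (inc u uA)) cT)) ,
            λ x k → ⊕-ˡ _ v x (⊖-in _ u (inc x (∖-in S (us ps) (∖-ˡ S _ x k)
                      (not-true λ m → true≢false (∨-introʳ (x == u) m) (∖-ʳ S (us ((u , w) ∷ ps)) k))))
                    λ { refl → true≢false (∨-introˡ (us ps x) (==-refl x)) (∖-ʳ S (us ((u , w) ∷ ps)) k) })

    us⊆ : ∀ {us₀ ps} → Forward us₀ ps → us ps ⊆ S
    us⊆ (hop {u = u} {ps = ps} uS _ _ _ rest) x m =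
      ∨-elim (x == u) m (λ e → subst (_∈ S) (sym (==-sound e)) uS) (us⊆ rest x)

    -- The same argument started at the source. Only inclusions are tracked: it suffices that the
    -- final independent set contains the augmented one.
    forward-ok : ∀ {us₀ T ps} → Forward us₀ ps → Ind T → S ∖ mem us₀ ⊆ T →
                 ∃ λ T' → Ind T' × (∀ x → x ∈ T → x ∉ us ps → x ∈ T') × vs ps ⊆ T'
    forward-ok {T = T} [] jT inc = T , jT , (λ _ h _ → h) , λ _ ()
    forward-ok {us₀} {T} (hop {u = u} {w} {ps} uS wS j dep rest) jT inc
      with exchange-circuit {u = u} inc jT dep (down (⊕-mono w (⊖-mono u (∖-ˡ S (mem us₀)))) j)
    ... | jT₁ , uA , wT
      with forward-ok rest jT₁ (λ x k → ⊕-ˡ (T ⊖ u) w x (⊖-in T u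
             (inc x (∖-in S (mem us₀) (∖-ˡ S _ x k)
               (not-true λ m → true≢false (∨-introʳ (x == u) m) (∖-ʳ S (mem (u ∷ us₀)) k))))
             λ { refl → true≢false (∨-introˡ (mem us₀ x) (==-refl x)) (∖-ʳ S (mem (u ∷ us₀)) k) }))
    ... | T' , jT' , keep , new = T' , jT' ,
          (λ x h k → keep x (⊕-ˡ (T ⊖ u) w x (⊖-in T u h λ { refl → true≢false (∨-introˡ (us ps x) (==-refl x)) k }))
                       (not-true λ m → true≢false (∨-introʳ (x == u) m) k)) ,
          λ x m → ∨-elim (x == w) m
            (λ e → subst (_∈ T') (sym (==-sound e)) (keep w (⊕-self (T ⊖ u) w)
               (not-true λ q → true≢false (us⊆ rest w q) wS)))
            (new x)

    forward-aug : ∀ {v ps} → v ∉ S → Ind (S ⊕ v) → Forward [] ps → Ind (aug S v ps)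
    forward-aug {v} {ps} vS j fw with forward-ok {T = S ⊕ v} fw j (λ x k → ⊕-ˡ S v x (∖-ˡ S _ x k))
    ... | T' , jT' , keep , new = down sub jT'
      where
      sub : aug S v ps ⊆ T'
      sub x h with aug-from S v ps h
      ... | inj₁ (inj₁ refl) = keep x (⊕-self S x) (not-true λ m → true≢false (us⊆ fw x m) vS)
      ... | inj₁ (inj₂ m)    = new x m
      ... | inj₂ (xS , k)    = keep x (⊕-ˡ S v x xS) k

    data SameSide (p : BSet n) : Pairs → Set where
      []  : SameSide p []
      _∷_ : ∀ {u w ps} → p u ≡ p w → SameSide p ps → SameSide p ((u , w) ∷ ps)

    -- Each exchange trades `u` for `v`, and `u` lies on the same side of `p` as the next `w`; the
    -- indicators telescope and only that of the first element remains. Applied to label thresholds,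
    -- this shows that augmenting thins out no part of `S`.
    backward-count : ∀ {v ps} (p : BSet n) → Backward v ps → SameSide p ps →
                     card (S ∩ p) + # (p v) ≤ card (aug S v ps ∩ p)
    backward-count p (end vS j) [] = card-insert S p vS
    backward-count {v} p (hop {u = u} {w} {ps} j dep rest) (e ∷ es)
      with backward-ok w ps rest
    ... | (jT , cT) , inc with exchange-circuit {u = u} inc jT dep (down (⊕-mono v (⊖-mono u (∖-ˡ S (us ps)))) j)
    ...   | jT' , uA , vT = lin 0 (+-mono-≤ (backward-count p rest es) (card-swap (aug S w ps) p {u} vT))
            (trans (cong (λ z → card (S ∩ p) + # (p v) + (card (aug S w ps ∩ p) + (card (aug S v ((u , w) ∷ ps) ∩ p) + # z)) + 0) e)
                   (eq (card (S ∩ p)) (# (p v)) (card (aug S w ps ∩ p)) (card (aug S v ((u , w) ∷ ps) ∩ p)) (# (p w))))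
      where
      eq : ∀ a b c d e → a + b + (c + (d + e)) + 0 ≡ d + (a + e + (c + b))
      eq = solve-∀

-- Phase 2: augmentation with persistent distance labels.

module LabelledSearch where
  open FiniteSets
  open Matroids
  open RandomizedPrograms
  open OracleProcedures
  open LevelSteps
  open Approximation
  open Augmentation
  open import Data.Nat
  open import Data.Nat.Properties
  open import Data.Fin.Properties using () renaming (_≟_ to _≟F_)
  open import Data.Rational using (ℚ; 0ℚ) renaming (_≤_ to _≤ℚ_)
  open import Data.Nat.Tactic.RingSolver

  eq-or : ∀ {n} (x y : Fin n) → x ≡ y ⊎ x ≢ y
  eq-or x y with x ≟F y
  ... | yes e = inj₁ e
  ... | no e  = inj₂ e

  -- A single label d gives both labels: a = d, and b = d + 1 on S, b = d elsewhere.
  opaque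
    upLabel : ∀ {n} → BSet n → (Fin n → ℕ) → Fin n → ℕ
    upLabel S d x = if S x then suc (d x) else d x

    upLabel-∈ : ∀ {n} {S : BSet n} {d x} → x ∈ S → upLabel S d x ≡ suc (d x)
    upLabel-∈ h rewrite h = refl

    upLabel-∉ : ∀ {n} {S : BSet n} {d x} → x ∉ S → upLabel S d x ≡ d x
    upLabel-∉ h rewrite h = refl

    upLabel-≤ : ∀ {n} (S : BSet n) d x → d x ≤ upLabel S d x
    upLabel-≤ S d x with S x
    ... | true  = n≤1+n _
    ... | false = ≤-refl

    upLabel-≥ : ∀ {n} (S : BSet n) d x → upLabel S d x ≤ suc (d x)
    upLabel-≥ S d x with S x
    ... | true  = ≤-refl
    ... | false = n≤1+n _

    upLabel-cong : ∀ {n} (S : BSet n) {d d' : Fin n → ℕ} {x} → d' x ≡ d x → upLabel S d' x ≡ upLabel S d x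
    upLabel-cong S {x = x} e = cong (λ v → if S x then suc v else v) e

  -- `d` bounds the distance to a sink from below, `t` is the level being scanned, and no source has
  -- a label below `δ`. An element outside `S` stores its path to a sink; an element of `S` stores
  -- the same with itself as first pair.
  record Search (n : ℕ) : Set where
    constructor srch
    field
      S    : BSet n
      d    : Fin n → ℕ
      δ t  : ℕ
      path : Fin n → Maybe (Pairs {n})

  module Phase2Programs (n : ℕ) (query : Bool → BSet n → Prog n Bool) where
    open Programs n query
    open Search

    found : (Fin n → Maybe (Pairs {n})) → BSet n
    found path x = is-just (path x)

    fresh : Search n → BSet n
    fresh s = (full ∖ S s) ∩ at (d s) (t s) ∖ found (path s)

    unreached : Search n → BSet n
    unreached s = S s ∩ at (d s) (t s) ∖ found (path s)

    lift : Search n → Fin n → Search n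
    lift s x = srch (S s) (λ z → if z == x then suc (t s) else d s z) (δ s) (t s) (path s)

    record-paths : Search n → Fin n → Pairs → List (Fin n) → Search n
    record-paths s x ps ys = srch (S s) (d s) (δ s) (t s) λ z →
      if z == x then just ps else if mem ys z then just ((z , x) ∷ ps) else path s z

    restart : Search n → Fin n → Pairs → Search n
    restart s x ps = srch (aug (S s) x ps) (d s) (δ s) 0 (λ _ → nothing)

    lift-level : Search n → Search n
    lift-level s = srch (S s) (λ z → if unreached s z then suc (t s) else d s z) (δ s) (suc (t s)) (path s)

    finish : ℕ → Search n → Fin n → Pairs → Prog n (Search n ⊎ BSet n)
    finish L s x ps = query false (S s ⊕ x) >>= λ source →
      if source then ret (inj₁ (restart s x ps))
      else (collect false (S s) x L (elems (unreached s)) >>= λ ys → ret (inj₁ (record-paths s x ps ys)))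

    verify : ℕ → Search n → Fin n → ℕ → Prog n (Search n ⊎ BSet n)
    verify L s x zero     = finish L s x []
    verify L s x (suc t₀) = bsearch true (S s) x L (elems (S s ∩ at (d s) t₀)) >>= λ y →
      finish L s x (fromMaybe [] (path s y))

    -- The labels place the second-matroid circuit of `x` at labels t - 1 and above. If removing
    -- label t - 1 frees `x`, it has an edge to that level and keeps its label; otherwise its label
    -- rises. At t = 0 the query asks whether `x` is a sink.
    examine : ℕ → Search n → Fin n → Prog n (Search n ⊎ BSet n)
    examine L s x = query true ((S s ∖ below (d s) (t s)) ⊕ x) >>= λ b →
      if b then verify L s x (t s) else ret (inj₁ (lift s x))

    advance : ℕ → Search n → Prog n (Search n ⊎ BSet n)
    advance D s with t s <? δ s | δ s <? D
    ... | yes _ | _     = ret (inj₁ (lift-level s))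
    ... | no _  | yes _ = ret (inj₁ (srch (S s) (d s) (suc (δ s)) (t s) (path s)))
    ... | no _  | no _  = ret (inj₂ (S s))

    phase2Choice : ∀ {P : Fin n → Set} {R : Set} → ℕ → ℕ → Search n → (∃ λ x → P x) ⊎ R → Prog n (Search n ⊎ BSet n)
    phase2Choice D L s (inj₁ (x , _)) = examine L s x
    phase2Choice D L s (inj₂ _)       = advance D s

    phase2Step : ℕ → ℕ → Search n → Prog n (Search n ⊎ BSet n)
    phase2Step D L s = phase2Choice D L s (pick (fresh s))

    phase2 : ℕ → ℕ → ℕ → BSet n → Prog n (BSet n)
    phase2 D L F S₀ = while (phase2Step D L) F S (srch S₀ (λ _ → 0) 0 0 (λ _ → nothing))

  module Phase2Specs {n : ℕ} (I : Bool → Subset n → Bool) (μ : ℚ) (0≤μ : 0ℚ ≤ℚ μ)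
    (query : Bool → BSet n → Prog n Bool) (J : Bool → BSet n → Bool) (mat : ∀ i → Mat (J i))
    (query-ok : ∀ i f → Logic.Ok I μ 0≤μ (query i f) (λ b k → b ≡ J i f × k ≡ 1) 0) where

    open Phase1Specs I μ 0≤μ query J mat query-ok public
    open Phase2Programs n query public

    -- Distances count pairs: the edge from `x` to `u` lowers the label by one and the edge from `u`
    -- to `w` keeps it, so stored paths are shortest with respect to the labels.
    data DPath (S : BSet n) (d : Fin n → ℕ) : Fin n → Pairs → Set where
      end : ∀ {x} → x ∉ S → d x ≡ 0 → Ind true (S ⊕ x) → DPath S d x []
      hop : ∀ {x u w ps} → x ∉ S → u ∈ S → d x ≡ suc (d u) → d u ≡ d w →
            Ind true (S ⊖ u ⊕ x) → Ind false (S ⊖ u ⊕ w) → DPath S d w ps → DPath S d x ((u , w) ∷ ps)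

    module _ {S : BSet n} {d : Fin n → ℕ} where

      dpath-∉ : ∀ {x ps} → DPath S d x ps → x ∉ S
      dpath-∉ (end h _ _) = h
      dpath-∉ (hop h _ _ _ _ _ _) = h

      dpath-drop : ∀ {x u w ps} → DPath S d x ((u , w) ∷ ps) → d w < d x
      dpath-drop (hop _ _ e e' _ _ _) = ≤-reflexive (trans (cong suc (sym e')) (sym e))

      dpath-us : ∀ {x ps} → DPath S d x ps → ∀ y → y ∈ us ps → d y < d x
      dpath-us {ps = (u , w) ∷ ps} p@(hop _ _ e e' _ _ q) y m = ∨-elim (y == u) m
        (λ k → subst (λ z → d z < _) (sym (==-sound k)) (≤-reflexive (sym e)))
        (λ k → <-trans (dpath-us q y k) (dpath-drop p))

      dpath-vs : ∀ {x ps} → DPath S d x ps → ∀ y → y ∈ vs ps → d y < d x × y ∉ S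
      dpath-vs {ps = (u , w) ∷ ps} p@(hop _ _ e e' _ _ q) y m = ∨-elim (y == w) m
        (λ k → subst (λ z → d z < _ × z ∉ S) (sym (==-sound k)) (dpath-drop p , dpath-∉ q))
        (λ k → <-trans (proj₁ (dpath-vs q y k)) (dpath-drop p) , proj₂ (dpath-vs q y k))

      dpath-relabel : ∀ {d' t x ps} → (∀ z → d z < t → d' z ≡ d z) → d x ≤ t → d' x ≡ d x →
                      DPath S d x ps → DPath S d' x ps
      dpath-relabel {d'} {t} same le e (end h z j) = end h (trans e z) j
      dpath-relabel {d'} {t} {x} same le e p@(hop {u = u} {w} h uS eu ew j₂ j₁ q) =
        hop h uS (trans e (trans eu (cong suc (sym du)))) (trans du (trans ew (sym dw))) j₂ j₁
          (dpath-relabel same (<⇒≤ w<t) dw q)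
        where
        w<t : d w < t
        w<t = <-≤-trans (dpath-drop p) le
        dw : d' w ≡ d w
        dw = same w w<t
        du : d' u ≡ d u
        du = same u (subst (_< t) (sym ew) w<t)

      dpath-unique : ∀ {x ps} → DPath S d x ps → ∀ m → ∃ λ y* → ∀ y → y ≡ x ⊎ y ∈ vs ps → d y ≡ m → y ≡ y*
      dpath-unique {x} {ps} p m with d x ≟ m
      ... | yes e = x , λ { y (inj₁ h) k → h
                          ; y (inj₂ h) k → ⊥-elim (<-irrefl (trans k (sym e)) (proj₁ (dpath-vs p y h))) }
      dpath-unique {x} {[]} p m | no ne = x , λ { y (inj₁ h) k → h ; y (inj₂ ()) k }
      dpath-unique {x} {(u , w) ∷ ps} (hop _ _ _ _ _ _ q) m | no ne with dpath-unique q m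
      ... | y* , uniq = y* , λ { y (inj₁ refl) k → ⊥-elim (ne k)
                              ; y (inj₂ h) k → uniq y (∨-elim (y == w) h (λ e → inj₁ (==-sound e)) inj₂) k }

    -- With both bases equal to `S` nothing is active, so the invariant and the duality bound of
    -- phase 1 can be reused, with no active elements in the gap.
    labelled : BSet n → (Fin n → ℕ) → State n
    labelled S d = st S S d (upLabel S d)

    Outside : Search n → Fin n → Pairs → Set
    Outside s x ps = (DPath S d x ps × d x ≤ t) × (J false (S ⊕ x) ≡ false ×
                     (d x ≡ t → ∀ y → y ∈ S → d y ≡ t → Ind false (S ⊖ y ⊕ x) → y ∈ found path))
      where open Search s

    Inside : Search n → Fin n → Pairs → Set
    Inside s y ps = ∃ λ w → ∃ λ qs → ps ≡ (y , w) ∷ qs × (d y ≡ d w × d y ≤ t) × Ind false (S ⊖ y ⊕ w) ×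
                    (w ∈ found path × DPath S d w qs)
      where open Search s

    -- Outside `S` a label may exceed `δ` by one: an element lifted from level `δ` waits there until
    -- `δ` rises. `order` says that levels below `t` are completely found, which makes stored paths
    -- available when `x` is linked to level t - 1.
    record Inv2 (s : Search n) : Set where
      open Search s
      field
        inv : Inv δ (labelled S d)
        dS  : ∀ y → y ∈ S → d y ≤ δ
        dN  : ∀ x → x ∉ S → d x ≤ suc δ
        t≤δ : t ≤ δ
        outside : ∀ x → x ∉ S → ∀ {ps} → path x ≡ just ps → Outside s x ps
        inside  : ∀ y → y ∈ S → ∀ {ps} → path y ≡ just ps → Inside s y ps
        order   : ∀ z → z ∉ found path → t ≤ d z

    is-found : ∀ {path : Fin n → Maybe (Pairs {n})} {z} → z ∈ found path → ∃ λ ps → path z ≡ just ps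
    is-found {path} {z} h with path z
    ... | just ps = ps , refl

    found-just : ∀ {path : Fin n → Maybe (Pairs {n})} {z ps} → path z ≡ just ps → z ∈ found path
    found-just e rewrite e = refl

    module _ {s : Search n} (I2 : Inv2 s) where
      open Search s
      open Inv2 I2
      open Inv inv

      highS : ∀ u → S ∖ below (upLabel S d) (suc u) ⊆ S ∖ below d u
      highS u y h = ∖-in S _ (∖-ˡ S _ y h) (below-out d u (≤-pred (subst (suc u ≤_) (upLabel-∈ {S = S} {d} (∖-ˡ S _ y h))
        (below-no (upLabel S d) (suc u) (∖-ʳ S _ h)))))

      spanned₂ : ∀ u x → suc u ≤ d x → x ∉ S → Sp true (S ∖ below d u) x
      spanned₂ u x le xS = M.Sp-mono true (highS u) (high (suc u) (s≤s z≤n) x (subst (suc u ≤_) (sym (upLabel-∉ {S = S} {d} xS)) le))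

      fresh-in : ∀ {x} → x ∉ S → d x ≡ t → x ∉ found path → x ∈ fresh s
      fresh-in h e k = ∖-in _ _ (∩-in (full ∖ S) (at d t) (∖-in full S refl h) (at-in d t e)) k

      fresh-out : ∀ {x} → x ∈ fresh s → x ∉ S × d x ≡ t × x ∉ found path
      fresh-out {x} h = ∖-ʳ full S (∩-ˡ (full ∖ S) (at d t) x h') , at-sound d t (∩-ʳ (full ∖ S) (at d t) x h') , ∖-ʳ _ _ h
        where h' = ∖-ˡ ((full ∖ S) ∩ at d t) (found path) x h

      unreached-in : ∀ {y} → y ∈ S → d y ≡ t → y ∉ found path → y ∈ unreached s
      unreached-in h e k = ∖-in _ _ (∩-in S (at d t) h (at-in d t e)) k

      unreached-out : ∀ {y} → y ∈ unreached s → y ∈ S × d y ≡ t × y ∉ found path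
      unreached-out {y} h = ∩-ˡ S (at d t) y h' , at-sound d t (∩-ʳ S (at d t) y h') , ∖-ʳ _ _ h
        where h' = ∖-ˡ (S ∩ at d t) (found path) y h

      below-mono : ∀ {d' : Fin n → ℕ} u → (∀ y → y ∈ S → d y < u → d' y < u) → S ∩ below d u ⊆ S ∩ below d' u
      below-mono {d'} u f y h = ∩-in S _ (∩-ˡ S _ y h) (below-in d' u (f y (∩-ˡ S _ y h) (below-sound d u (∩-ʳ S _ y h))))

      above-mono : ∀ {d' : Fin n → ℕ} u → (∀ y → y ∈ S → d y ≤ d' y) →
                   S ∖ below (upLabel S d) u ⊆ S ∖ below (upLabel S d') u
      above-mono {d'} u f y h = ∖-in S _ yS (below-out (upLabel S d') u
        (≤-trans (below-no (upLabel S d) u (∖-ʳ S _ h))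
          (≤-trans (≤-reflexive (upLabel-∈ {S = S} {d} yS)) (≤-trans (s≤s (f y yS)) (≤-reflexive (sym (upLabel-∈ {S = S} {d'} yS)))))))
        where yS = ∖-ˡ S _ y h

      member-high : ∀ S (b : Fin n → ℕ) u x → x ∈ S → u ≤ b x → Sp true (S ∖ below b u) x
      member-high S b u x h le = inj₁ (∖-in S _ h (below-out b u le))

      lift-ok : ∀ x → x ∈ fresh s → J true ((S ∖ below d t) ⊕ x) ≡ false → Inv2 (lift s x)
      lift-ok x xF dep = record
        { inv = record { sub = λ _ h → h ; ind₁ = ind₁ ; ind₂ = ind₂ ; low = low' ; high = high'
                       ; a≤b = upLabel-≤ S d' ; b≤a = upLabel-≥ S d' }
        ; dS = λ y h → subst (_≤ δ) (sym (sameS y h)) (dS y h)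
        ; dN = dN'
        ; t≤δ = t≤δ
        ; outside = outside'
        ; inside = inside'
        ; order = λ z h → ≤-trans (order z h) (d≤d' z) }
        where
        x∉S = proj₁ (fresh-out xF)
        dx = proj₁ (proj₂ (fresh-out xF))
        xnew = proj₂ (proj₂ (fresh-out xF))
        d' : Fin n → ℕ
        d' = Search.d (lift s x)
        same : ∀ z → z ≢ x → d' z ≡ d z
        same z ne rewrite ==-false ne = refl
        sameS : ∀ z → z ∈ S → d' z ≡ d z
        sameS z h = same z λ { refl → true≢false h x∉S }
        d'x : d' x ≡ suc t
        d'x rewrite ==-refl x = refl
        d≤d' : ∀ z → d z ≤ d' z
        d≤d' z with z ≟F x
        ... | yes refl = ≤-trans (≤-reflexive dx) (n≤1+n t)
        ... | no _ = ≤-refl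
        low' : ∀ u → u ≤ δ → ∀ z → d' z < u → Sp false (S ∩ below d' u) z
        low' u le z h = M.Sp-mono false (below-mono u λ y yS k → subst (_< u) (sym (sameS y yS)) k)
          (low u le z (≤-<-trans (d≤d' z) h))
        high' : ∀ u → 1 ≤ u → ∀ z → u ≤ upLabel S d' z → Sp true (S ∖ below (upLabel S d') u) z
        high' u pos z h with eq-or z x
        ... | inj₂ ne = M.Sp-mono true (above-mono u λ y _ → d≤d' y) (high u pos z (subst (u ≤_) eq h))
          where
          eq : upLabel S d' z ≡ upLabel S d z
          eq = upLabel-cong S (same z ne)
        ... | inj₁ refl = inj₂ (M.up true (⊕-mono x inc) dep)
          where
          inc : S ∖ below d t ⊆ S ∖ below (upLabel S d') u
          inc y k = ∖-in S _ (∖-ˡ S _ y k) (below-out (upLabel S d') u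
            (≤-trans h (≤-trans (≤-reflexive (trans (upLabel-∉ {S = S} {d'} x∉S) d'x))
              (≤-trans (s≤s (below-no d t (∖-ʳ S _ k)))
                (≤-reflexive (trans (cong suc (sym (sameS y (∖-ˡ S _ y k)))) (sym (upLabel-∈ {S = S} {d'} (∖-ˡ S _ y k)))))))))
        dN' : ∀ z → z ∉ S → d' z ≤ suc δ
        dN' z h with z ≟F x
        ... | yes _ = s≤s t≤δ
        ... | no _  = dN z h
        unchanged : ∀ {ps} z → path z ≡ just ps → d' z ≡ d z
        unchanged z e = same z λ { refl → true≢false (found-just {path} {z} e) xnew }
        small : ∀ z → d z < t → d' z ≡ d z
        small z h = same z λ { refl → <-irrefl dx h }
        outside' : ∀ z → z ∉ S → ∀ {ps} → path z ≡ just ps → Outside (lift s x) z ps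
        outside' z h e with outside z h e
        ... | (p , le) , src , exh = (dpath-relabel {d' = d'} small le (unchanged z e) p , subst (_≤ t) (sym (unchanged z e)) le) ,
              src , λ dz y yS dy → exh (trans (sym (unchanged z e)) dz) y yS (trans (sym (sameS y yS)) dy)
        inside' : ∀ y → y ∈ S → ∀ {ps} → path y ≡ just ps → Inside (lift s x) y ps
        inside' y h e with inside y h e
        ... | w , qs , eps , (ew , le) , j , wf , p =
              w , qs , eps , (trans (sameS y h) (trans ew (sym dw)) , subst (_≤ t) (sym (sameS y h)) le) , j ,
              wf , dpath-relabel {d' = d'} small (subst (_≤ t) ew le) dw p
          where
          dw : d' w ≡ d w
          dw = same w λ { refl → true≢false wf xnew }

      record-ok : ∀ x ps ys → x ∈ fresh s → DPath S d x ps → J false (S ⊕ x) ≡ false →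
                  ys ≡ sel (λ u → J false (S ⊖ u ⊕ x)) (elems (unreached s)) →
                  Inv2 (record-paths s x ps ys) × card (found path) + suc (length ys) ≤ card (found (Search.path (record-paths s x ps ys)))
      record-ok x ps ys xF p src refl = record
        { inv = inv ; dS = dS ; dN = dN ; t≤δ = t≤δ ; outside = outside' ; inside = inside'
        ; order = λ z h → order z (not-true λ k → true≢false (grows z k) h) } , count
        where
        x∉S = proj₁ (fresh-out xF)
        dx = proj₁ (proj₂ (fresh-out xF))
        xnew = proj₂ (proj₂ (fresh-out xF))
        circ : BSet n
        circ u = J false (S ⊖ u ⊕ x)
        path' = Search.path (record-paths s x ps ys)
        at-x : path' x ≡ just ps
        at-x rewrite ==-refl x = refl
        at-y : ∀ {y} → y ≢ x → y ∈ mem ys → path' y ≡ just ((y , x) ∷ ps)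
        at-y ne m rewrite ==-false ne | m = refl
        else-z : ∀ {z} → z ≢ x → z ∉ mem ys → path' z ≡ path z
        else-z ne m rewrite ==-false ne | m = refl
        ys-out : ∀ {y} → y ∈ mem ys → y ∈ unreached s × y ∈ circ
        ys-out {y} m with ∧-split (mem (elems (unreached s)) y) (trans (sym (mem-sel circ (elems (unreached s)) y)) m)
        ... | k , c = from-elems _ y k , c
        ys-in : ∀ {y} → y ∈ unreached s → y ∈ circ → y ∈ mem ys
        ys-in {y} k c = trans (mem-sel circ (elems (unreached s)) y) (∧-intro (in-elems _ y k) c)
        grows : found path ⊆ found path'
        grows z h with eq-or z x | bool-case (mem ys z)
        ... | inj₁ refl | _ = found-just {path'} {z} at-x
        ... | inj₂ ne | inj₁ m = found-just {path'} {z} (at-y ne m)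
        ... | inj₂ ne | inj₂ m with is-found {path} {z} h
        ...   | qs , e = found-just {path'} {z} (trans (else-z ne m) e)
        exhausted : d x ≡ t → ∀ y → y ∈ S → d y ≡ t → Ind false (S ⊖ y ⊕ x) → y ∈ found path'
        exhausted _ y yS dy c with bool-case (found path y)
        ... | inj₁ k = grows y k
        ... | inj₂ k = found-just {path'} {y} (at-y (λ { refl → true≢false yS x∉S }) (ys-in (unreached-in yS dy k) c))
        outside' : ∀ z → z ∉ S → ∀ {qs} → path' z ≡ just qs → Outside (record-paths s x ps ys) z qs
        outside' z zS e with eq-or z x
        ... | inj₁ refl with trans (sym at-x) e
        ...   | refl = (p , ≤-reflexive dx) , src , exhausted
        outside' z zS e | inj₂ ne with bool-case (mem ys z)
        ...   | inj₁ m = true≢false (proj₁ (unreached-out (proj₁ (ys-out m)))) zS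
        ...   | inj₂ m with outside z zS (trans (sym (else-z ne m)) e)
        ...     | l , q , r = l , q , λ dz y yS dy c → grows y (r dz y yS dy c)
        inside' : ∀ y → y ∈ S → ∀ {qs} → path' y ≡ just qs → Inside (record-paths s x ps ys) y qs
        inside' y yS e with bool-case (mem ys y)
        ... | inj₁ m with trans (sym (at-y (λ { refl → true≢false yS x∉S }) m)) e
        ...   | refl = x , ps , refl , (trans dy (sym dx) , ≤-reflexive dy) , proj₂ (ys-out m) , found-just {path'} {x} at-x , p
          where dy = proj₁ (proj₂ (unreached-out (proj₁ (ys-out m))))
        inside' y yS e | inj₂ m with inside y yS (trans (sym (else-z (λ { refl → true≢false yS x∉S }) m)) e)
        ... | w , qs , a , b , c , wf , q = w , qs , a , b , c , grows w wf , q
        count : card (found path) + suc (length ys) ≤ card (found path')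
        count = ≤-trans (+-monoʳ-≤ (card (found path)) (≤-trans (s≤s (length-sel circ (distinct-elems (unreached s))))
            (≤-reflexive (sym (card-⊕ _ x (not-true λ k → true≢false (U-S k) x∉S))))))
          (card-disj grows (⊕-lub new (found-just {path'} {x} at-x)) λ z h → not-true λ k → true≢false h (⊕-elim _ x k (old z) λ { refl → xnew }))
          where
          U-S : ∀ {z} → z ∈ mem (elems (unreached s)) ∩ circ → z ∈ S
          U-S {z} k = proj₁ (unreached-out (from-elems _ z (∩-ˡ _ circ z k)))
          new : mem (elems (unreached s)) ∩ circ ⊆ found path'
          new z k = found-just {path'} {z} (at-y (λ { refl → true≢false (U-S k) x∉S }) (ys-in (from-elems _ z (∩-ˡ _ circ z k)) (∩-ʳ _ circ z k)))
          old : ∀ z → z ∈ mem (elems (unreached s)) ∩ circ → z ∉ found path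
          old z k = proj₂ (proj₂ (unreached-out (from-elems _ z (∩-ˡ _ circ z k))))

      lift-level-ok : t < δ → (∀ x → x ∉ fresh s) → Inv2 (lift-level s)
      lift-level-ok t<δ none = record
        { inv = record { sub = λ _ h → h ; ind₁ = ind₁ ; ind₂ = ind₂ ; low = low' ; high = high'
                       ; a≤b = upLabel-≤ S d' ; b≤a = upLabel-≥ S d' }
        ; dS = dS' ; dN = λ x h → subst (_≤ suc δ) (sym (sameN x h)) (dN x h) ; t≤δ = t<δ
        ; outside = outside' ; inside = inside' ; order = order' }
        where
        U : BSet n
        U = unreached s
        d' : Fin n → ℕ
        d' = Search.d (lift-level s)
        d'-U : ∀ {z} → z ∈ U → d' z ≡ suc t
        d'-U h rewrite h = refl
        same : ∀ {z} → z ∉ U → d' z ≡ d z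
        same h rewrite h = refl
        sameN : ∀ z → z ∉ S → d' z ≡ d z
        sameN z h = same (not-true λ k → true≢false (proj₁ (unreached-out k)) h)
        small : ∀ z → d z < t → d' z ≡ d z
        small z h = same (not-true λ k → <-irrefl (proj₁ (proj₂ (unreached-out k))) h)
        d≤d' : ∀ z → d z ≤ d' z
        d≤d' z with bool-case (U z)
        ... | inj₁ h = ≤-trans (≤-reflexive (proj₁ (proj₂ (unreached-out h)))) (≤-trans (n≤1+n t) (≤-reflexive (sym (d'-U h))))
        ... | inj₂ h = ≤-reflexive (sym (same h))
        foundN : ∀ z → z ∉ S → d z ≡ t → z ∈ found path
        foundN z h e with bool-case (found path z)
        ... | inj₁ k = k
        ... | inj₂ k = true≢false (fresh-in h e k) (none z)
        dS' : ∀ y → y ∈ S → d' y ≤ δ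
        dS' y h with bool-case (U y)
        ... | inj₁ k = ≤-trans (≤-reflexive (d'-U k)) t<δ
        ... | inj₂ k = ≤-trans (≤-reflexive (same k)) (dS y h)
        below-inc : ∀ u v → (∀ y → y ∈ S → d y < u → d' y < v) → S ∩ below d u ⊆ S ∩ below d' v
        below-inc u v f y h = ∩-in S _ (∩-ˡ S _ y h) (below-in d' v (f y (∩-ˡ S _ y h) (below-sound d u (∩-ʳ S _ y h))))
        -- The circuit of a verified z of level t avoids the unreached elements, which may then leave the level.
        dep-t : ∀ z → z ∉ S → d z ≡ t → J false (S ∩ below d' (suc t) ⊕ z) ≡ false
        dep-t z zS e = not-true λ ind → clash (M.circuit-hit false S (elems U) ind₁ (∩-ˡ S _)
            (M.Sp-dep false (low (suc t) t<δ z (s≤s (≤-reflexive e))) (∉-⊆ (∩-ˡ S _) zS))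
            (M.down false (⊕-mono z inc) ind))
          where
          inc : S ∩ below d (suc t) ∖ mem (elems U) ⊆ S ∩ below d' (suc t)
          inc y h = ∩-in S _ (∩-ˡ S _ y h') (below-in d' (suc t) (subst (_< suc t) (sym (same y∉U)) (below-sound d (suc t) (∩-ʳ S _ y h'))))
            where
            h' = ∖-ˡ (S ∩ below d (suc t)) _ y h
            y∉U = not-true λ k → true≢false (in-elems U y k) (∖-ʳ (S ∩ below d (suc t)) _ h)
          clash : (∃ λ u → u ∈ mem (elems U) × u ∈ S ∩ below d (suc t) × Ind false (S ⊖ u ⊕ z)) → ⊥
          clash (u , m , _ , c) with is-found {path} {z} (foundN z zS e)
          ... | ps , eq with outside z zS eq | unreached-out (from-elems U u m)
          ...   | _ , _ , exh | uS , du , unew = true≢false (exh e u uS du c) unew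
        low' : ∀ u → u ≤ δ → ∀ z → d' z < u → Sp false (S ∩ below d' u) z
        low' u le z h with bool-case (S z)
        ... | inj₁ k = inj₁ (∩-in S _ k (below-in d' u h))
        ... | inj₂ k with u ≟ suc t
        ...   | no ne = M.Sp-mono false (below-inc u u keep) (low u le z (≤-<-trans (d≤d' z) h))
          where
          keep : ∀ y → y ∈ S → d y < u → d' y < u
          keep y yS l with bool-case (U y)
          ... | inj₂ m = subst (_< u) (sym (same m)) l
          ... | inj₁ m = subst (_< u) (sym (d'-U m)) (≤∧≢⇒< (subst (_< u) (proj₁ (proj₂ (unreached-out m))) l) (λ e → ne (sym e)))
        ...   | yes refl with m≤n⇒m<n∨m≡n (≤-pred (subst (_< suc t) (sameN z k) h))
        ...     | inj₂ e  = inj₂ (dep-t z k e)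
        ...     | inj₁ lt = M.Sp-mono false (below-inc t (suc t) λ y _ l → m<n⇒m<1+n (subst (_< t) (sym (small y l)) l))
                              (low t t≤δ z lt)
        high' : ∀ u → 1 ≤ u → ∀ z → u ≤ upLabel S d' z → Sp true (S ∖ below (upLabel S d') u) z
        high' u pos z h with bool-case (S z)
        ... | inj₁ k = member-high S (upLabel S d') u z k h
        ... | inj₂ k = M.Sp-mono true (above-mono u λ y _ → d≤d' y) (high u pos z (subst (u ≤_) (upLabel-cong S (sameN z k)) h))
        outside' : ∀ z → z ∉ S → ∀ {ps} → path z ≡ just ps → Outside (lift-level s) z ps
        outside' z h e with outside z h e
        ... | (p , le) , src , exh = (dpath-relabel {d' = d'} small le (sameN z h) p , ≤-trans (≤-reflexive (sameN z h)) (≤-trans le (n≤1+n t))) ,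
              src , λ dz y yS dy c → ⊥-elim (<-irrefl refl (≤-trans (≤-reflexive (sym (trans (sym (sameN z h)) dz))) le))
        inside' : ∀ y → y ∈ S → ∀ {ps} → path y ≡ just ps → Inside (lift-level s) y ps
        inside' y h e with inside y h e
        ... | w , qs , eps , (ew , le) , j , wf , p =
              w , qs , eps , (trans dy (trans ew (sym dw)) , ≤-trans (≤-reflexive dy) (≤-trans le (n≤1+n t))) , j ,
              wf , dpath-relabel {d' = d'} small (subst (_≤ t) ew le) dw p
          where
          dw : d' w ≡ d w
          dw = sameN w (dpath-∉ p)
          dy : d' y ≡ d y
          dy = same (not-true λ k → true≢false (found-just {path} {y} e) (proj₂ (proj₂ (unreached-out k))))
        order' : ∀ z → z ∉ found path → suc t ≤ d' z
        order' z h with m≤n⇒m<n∨m≡n (order z h)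
        ... | inj₁ lt = ≤-trans lt (d≤d' z)
        ... | inj₂ e with bool-case (S z)
        ...   | inj₁ k = ≤-reflexive (sym (d'-U (unreached-in k (sym e) h)))
        ...   | inj₂ k = true≢false (foundN z k (sym e)) h

      -- Every element outside `S` at level `δ` has been found and is no source, hence it is spanned
      -- by `S`, all of whose labels are at most `δ`. This is the missing threshold of the
      -- invariant.
      raise-δ-ok : t ≡ δ → (∀ x → x ∉ fresh s) → Inv2 (srch S d (suc δ) t path)
      raise-δ-ok refl none = record
        { inv = record { sub = λ _ h → h ; ind₁ = ind₁ ; ind₂ = ind₂ ; low = low' ; high = high
                       ; a≤b = a≤b ; b≤a = b≤a }
        ; dS = λ y h → m≤n⇒m≤1+n (dS y h) ; dN = λ x h → m≤n⇒m≤1+n (dN x h) ; t≤δ = n≤1+n t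
        ; outside = outside ; inside = inside ; order = order }
        where
        low' : ∀ u → u ≤ suc t → ∀ z → d z < u → Sp false (S ∩ below d u) z
        low' u le z h with m≤n⇒m<n∨m≡n le
        ... | inj₁ l = low u (≤-pred l) z h
        ... | inj₂ refl with bool-case (S z)
        ...   | inj₁ k = inj₁ (∩-in S _ k (below-in d (suc t) h))
        ...   | inj₂ k with m≤n⇒m<n∨m≡n (≤-pred h)
        ...     | inj₁ l = M.Sp-mono false below-step (low t ≤-refl z l)
          where
          below-step : S ∩ below d t ⊆ S ∩ below d (suc t)
          below-step y m = ∩-in S _ (∩-ˡ S _ y m) (below-in d (suc t) (m<n⇒m<1+n (below-sound d t (∩-ʳ S _ y m))))
        ...     | inj₂ e with bool-case (found path z)
        ...       | inj₂ m = true≢false (fresh-in k e m) (none z)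
        ...       | inj₁ m with is-found {path} {z} m
        ...         | ps , eq = inj₂ (M.up false (⊕-mono z λ y yS → ∩-in S _ yS (below-in d (suc t) (s≤s (dS y yS))))
                                      (proj₁ (proj₂ (outside z k eq))))

      -- Labels forbid shortcuts: the first-matroid circuit of `w` lies at labels up to `d w`, while
      -- all elements of `S` passed earlier on the path have larger labels.
      forward : ∀ {us₀ x ps} → (∀ y → y ∈ mem us₀ → d x ≤ d y) → d x ≤ δ → DPath S d x ps →
                Chains.Forward (mat false) S us₀ ps
      forward h le (end _ _ _) = Chains.[]
      forward {us₀} {x} h le p@(hop {u = u} {w} x∉S uS e e' j₂ j₁ q) = Chains.hop uS (dpath-∉ q) j₁
        (M.up false (⊕-mono w inc)
          (M.Sp-dep false (low (suc (d w)) w<δ w ≤-refl) (∉-⊆ (∩-ˡ S _) (dpath-∉ q))))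
        (forward h' (<⇒≤ w<δ) q)
        where
        w<δ : d w < δ
        w<δ = <-≤-trans (dpath-drop p) le
        inc : S ∩ below d (suc (d w)) ⊆ S ∖ mem us₀
        inc y k = ∖-in S _ (∩-ˡ S _ y k) (not-true λ m → <-irrefl refl
          (<-≤-trans (below-sound d (suc (d w)) (∩-ʳ S _ y k)) (≤-trans (dpath-drop p) (h y m))))
        h' : ∀ y → y ∈ mem (u ∷ us₀) → d w ≤ d y
        h' y m = ∨-elim (y == u) m (λ k → subst (λ z → d w ≤ d z) (sym (==-sound k)) (≤-reflexive (sym e')))
          (λ k → ≤-trans (<⇒≤ (dpath-drop p)) (h y k))

      backward : ∀ {x ps} → DPath S d x ps → Chains.Backward (mat true) S x ps
      backward (end h _ j) = Chains.end h j
      backward {x} (hop {u = u} {w} {ps} x∉S uS e e' j₂ j₁ q) = Chains.hop j₂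
        (M.Sp-dep true (M.Sp-mono true inc (spanned₂ (d u) x (≤-reflexive (sym e)) x∉S)) (∉-⊆ (∖-ˡ S _) x∉S))
        (backward q)
        where
        inc : S ∖ below d (d u) ⊆ S ∖ us ps
        inc y k = ∖-in S _ (∖-ˡ S _ y k) (not-true λ m → <-irrefl refl
          (≤-<-trans (below-no d (d u) (∖-ʳ S _ k)) (<-≤-trans (dpath-us q y m) (≤-reflexive (sym e')))))

      sameSide : ∀ {x ps} (p : ℕ → Bool) → DPath S d x ps → Chains.SameSide (mat true) S (λ z → p (d z)) ps
      sameSide p (end _ _ _) = Chains.[]
      sameSide p (hop _ _ _ e' _ _ q) = cong p e' Chains.∷ sameSide p q

      -- A source cannot be spanned below `δ`, so its label is exactly `δ`. Exchanged pairs share a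
      -- label, hence `S` loses no element, in number, on either side of any threshold, and counting
      -- shows that the old labels remain valid for the augmented set.
      restart-ok : ∀ x ps → x ∈ fresh s → DPath S d x ps → Ind false (S ⊕ x) →
                   Inv2 (restart s x ps) × card (aug S x ps) ≡ suc (card S)
      restart-ok x ps xF p src = record
        { inv = record { sub = λ _ h → h ; ind₁ = jS₁ ; ind₂ = proj₁ (proj₁ bk) ; low = low' ; high = high'
                       ; a≤b = upLabel-≤ S' d ; b≤a = upLabel-≥ S' d }
        ; dS = dS' ; dN = dN' ; t≤δ = z≤n ; outside = λ _ _ () ; inside = λ _ _ () ; order = λ _ _ → z≤n } ,
        proj₂ (proj₁ bk)
        where
        x∉S = proj₁ (fresh-out xF)
        dx : d x ≡ δ
        dx with m≤n⇒m<n∨m≡n (≤-trans (≤-reflexive (proj₁ (proj₂ (fresh-out xF)))) t≤δ)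
        ... | inj₂ e = e
        ... | inj₁ l = true≢false src (M.up false (⊕-mono x (∩-ˡ S _))
                (M.Sp-dep false (low (suc (d x)) l x ≤-refl) (∉-⊆ (∩-ˡ S _) x∉S)))
        S' : BSet n
        S' = aug S x ps
        fw = forward {[]} (λ _ ()) (≤-reflexive dx) p
        bk = Chains.backward-ok (mat true) S x ps (backward p)
        jS₁ : Ind false S'
        jS₁ = Chains.forward-aug (mat false) S x∉S src fw
        count : ∀ (q : ℕ → Bool) → card (S ∩ (λ z → q (d z))) + # (q (d x)) ≤ card (S' ∩ (λ z → q (d z)))
        count q = Chains.backward-count (mat true) S (λ z → q (d z)) (backward p) (sameSide q p)
        new-d : ∀ y → y ≡ x ⊎ y ∈ vs ps → d y ≤ δ
        new-d y (inj₁ refl) = ≤-reflexive dx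
        new-d y (inj₂ m) = <⇒≤ (<-≤-trans (proj₁ (dpath-vs p y m)) (≤-reflexive dx))
        dS' : ∀ y → y ∈ S' → d y ≤ δ
        dS' y h with aug-from S x ps h
        ... | inj₁ k = new-d y k
        ... | inj₂ (k , _) = dS y k
        dN' : ∀ y → y ∉ S' → d y ≤ suc δ
        dN' y h with bool-case (S y)
        ... | inj₁ k = m≤n⇒m≤1+n (dS y k)
        ... | inj₂ k = dN y k
        low' : ∀ u → u ≤ δ → ∀ z → d z < u → Sp false (S' ∩ below d u) z
        low' u le = M.spans-by-count false {P = λ z → d z < u} (M.down false (∩-ˡ S _) ind₁) (M.down false (∩-ˡ S' _) jS₁)
          (low u le) (λ y h → below-sound d u (∩-ʳ S' _ y h)) counted
          where
          B : ℕ → Bool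
          B v = v <ᵇ u
          to : ∀ T → T ∩ below d u ⊆ T ∩ (λ z → B (d z))
          to T y h = ∩-in T _ (∩-ˡ T _ y h) (<ᵇ-in (below-sound d u (∩-ʳ T _ y h)))
          from : ∀ T → T ∩ (λ z → B (d z)) ⊆ T ∩ below d u
          from T y h = ∩-in T _ (∩-ˡ T _ y h) (below-in d u (<ᵇ-sound (d y) u (∩-ʳ T (λ z → B (d z)) y h)))
          counted : card (S ∩ below d u) ≤ card (S' ∩ below d u)
          counted = ≤-trans (card-mono (to S)) (≤-trans (m≤m+n _ _) (≤-trans (count B) (card-mono (from S'))))
        high' : ∀ u → 1 ≤ u → ∀ z → u ≤ upLabel S' d z → Sp true (S' ∖ below (upLabel S' d) u) z
        high' (suc u) _ z h with bool-case (S' z)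
        ... | inj₁ k = member-high S' (upLabel S' d) (suc u) z k h
        ... | inj₂ k = inj₂ (M.up true (⊕-mono z incG) (not-true bad))
          where
          dz : suc u ≤ d z
          dz = subst (suc u ≤_) (upLabel-∉ {S = S'} {d} k) h
          u≤δ : u ≤ δ
          u≤δ with bool-case (S z)
          ... | inj₁ m = ≤-trans (n≤1+n u) (≤-trans dz (dS z m))
          ... | inj₂ m = ≤-pred (≤-trans dz (dN z m))
          f G : BSet n
          f = S ∖ below d u
          G = S' ∖ below d u
          incG : G ⊆ S' ∖ below (upLabel S' d) (suc u)
          incG y m = ∖-in S' _ yS' (below-out (upLabel S' d) (suc u)
            (≤-trans (s≤s (below-no d u (∖-ʳ S' _ m))) (≤-reflexive (sym (upLabel-∈ {S = S'} {d} yS')))))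
            where yS' = ∖-ˡ S' _ y m
          -- Labels fall strictly along the path, so at most one new element has label exactly u,
          -- and it is the only one in `G ⊕ z` that `f` may fail to span. But `G` already exceeds
          -- `f` by one through the source, which leaves no room for `z`.
          y* = proj₁ (dpath-unique p u)
          uniq = proj₂ (dpath-unique p u)
          A : ℕ → Bool
          A v = not (v <ᵇ u)
          grew : suc (card f) ≤ card G
          grew = begin
            suc (card f)                                 ≡⟨ +-comm 1 (card f) ⟩
            card f + 1                                   ≤⟨ +-mono-≤ (card-mono {f = f} {S ∩ (λ w → A (d w))} λ y m →
                                                              ∩-in S _ (∖-ˡ S _ y m) (false-not (<ᵇ-out (below-no d u (∖-ʳ S _ m)))))
                                                              (≤-reflexive (sym (cong # (false-not (<ᵇ-out (≤-trans u≤δ (≤-reflexive (sym dx)))))))) ⟩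
            card (S ∩ (λ w → A (d w))) + # (A (d x))     ≤⟨ count A ⟩
            card (S' ∩ (λ w → A (d w)))                  ≤⟨ card-mono {g = G} (λ y m → ∖-in S' _ (∩-ˡ S' _ y m)
                                                              (below-out d u (<ᵇ-no (not-false (∩-ʳ S' (λ w → A (d w)) y m))))) ⟩
            card G                                       ∎
            where open ≤-Reasoning
          z∉G : z ∉ G
          z∉G = ∉-⊆ (∖-ˡ S' _) k
          spanned : ∀ y → y ∈ G ⊕ z → y ≢ y* → Sp true f y
          spanned y m ne with bool-case (S y)
          ... | inj₁ yS = inj₁ (∖-in S _ yS (below-out d u (⊕-elim G z m (λ g → below-no d u (∖-ʳ S' _ g)) λ { refl → <⇒≤ dz })))
          ... | inj₂ yS = spanned₂ u y (⊕-elim G z m above-u λ { refl → dz }) yS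
            where
            above-u : y ∈ G → suc u ≤ d y
            above-u g with aug-from S x ps (∖-ˡ S' _ y g)
            ... | inj₂ (q , _) = true≢false q yS
            ... | inj₁ q = ≤∧≢⇒< (below-no d u (∖-ʳ S' _ g)) λ e → ne (uniq y q (sym e))
          bad : J true (G ⊕ z) ≡ true → ⊥
          bad ind = <-irrefl refl (begin-strict
            suc (card f)               ≤⟨ grew ⟩
            card G                     <⟨ ≤-reflexive (sym (card-⊕ G z z∉G)) ⟩
            card (G ⊕ z)               ≤⟨ card-⊖≤ (G ⊕ z) y* ⟩
            suc (card (G ⊕ z ⊖ y*))    ≤⟨ s≤s (M.rank-≤ true (M.down true (∖-ˡ S _) ind₂) (M.down true (⊖-ˡ (G ⊕ z) y*) ind)
                                            λ y m → spanned y (⊖-ˡ (G ⊕ z) y* y m) (⊖-≢ (G ⊕ z) y* m)) ⟩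
            suc (card f)               ∎)
            where open ≤-Reasoning

    module Phase2Loop (D L G : ℕ) (n≤2^L : n ≤ 2 ^ L) where
      open Search

      -- An augmentation forgets up to n found elements and resets `t` from at most `D`; this weight
      -- of an element of `S` makes `measure` increase nevertheless.
      weight : ℕ
      weight = suc (n + D)

      measure : Search n → ℕ
      measure s = Σ' (d s) + card (found (path s)) + (t s + δ s) + weight * card (S s)

      -- A step that raises `measure` by m + 1 costs at most 3 + L + 2 L m queries, which is at most
      -- `κ` per unit.
      κ : ℕ
      κ = 3 + 2 * L

      -- One more than `measure` can ever grow: n labels up to D + 1, n found elements, `t` and `δ`
      -- up to `D`, and at most `G` augmentations.
      fuel : ℕ
      fuel = suc (n * suc D + n + (D + D) + weight * G)

      Better : Search n → ℕ → Search n → ℕ → Set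
      Better s k₀ s' k = (Inv2 s' × δ s' ≤ D) × (suc (measure s) ≤ measure s' × k₀ + k + κ * measure s ≤ κ * measure s')

      Next : Search n → ℕ → Search n ⊎ BSet n → ℕ → Set
      Next s k₀ (inj₁ s') k = Better s k₀ s' k
      Next s k₀ (inj₂ T)  k = ⊥

      pay : ∀ s s' k m → k ≤ 3 + L + 2 * L * m → measure s + suc m ≤ measure s' →
            suc (measure s) ≤ measure s' × k + κ * measure s ≤ κ * measure s'
      pay s s' k m ck le =
        ≤-trans (≤-trans (≤-reflexive (+-comm 1 _)) (+-monoʳ-≤ (measure s) (s≤s z≤n))) le ,
        lin (2 * m + m + L) (+-mono-≤ ck (*-monoʳ-≤ κ le)) (eq k L m (measure s) (measure s'))
        where
        eq : ∀ k L m M M' → k + (3 + 2 * L) * M + ((3 + L + 2 * L * m) + (3 + 2 * L) * M') + (2 * m + m + L) ≡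
                            (3 + 2 * L) * M' + (k + (3 + 2 * L) * (M + suc m))
        eq = solve-∀

      card-found≤ : ∀ s → card (found (path s)) ≤ n
      card-found≤ s = card-≤n (found (path s))

      restart-gain : ∀ s x ps → t s ≤ δ s → δ s ≤ D → card (aug (S s) x ps) ≡ suc (card (S s)) →
                     measure s + 1 ≤ measure (restart s x ps)
      restart-gain s x ps t≤ δ≤ e = begin
        Σ' (d s) + card (found (path s)) + (t s + δ s) + weight * card (S s) + 1
          ≤⟨ lin 0 (+-mono-≤ (card-found≤ s) (≤-trans t≤ δ≤))
               (eq (Σ' (d s)) (card (found (path s))) (t s) (δ s) (card (S s)) n D) ⟩
        Σ' (d s) + (0 + δ s) + weight * suc (card (S s))
          ≤⟨ +-monoˡ-≤ _ (+-monoˡ-≤ (0 + δ s) (m≤m+n (Σ' (d s)) _)) ⟩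
        Σ' (d s) + card (found (λ _ → nothing)) + (0 + δ s) + weight * suc (card (S s))
          ≡⟨ cong (λ c → Σ' (d s) + card (found (λ _ → nothing)) + (0 + δ s) + weight * c) e ⟨
        measure (restart s x ps) ∎
        where
        open ≤-Reasoning
        eq : ∀ Σ f t δ c n D → Σ + f + (t + δ) + suc (n + D) * c + 1 + (n + D) + 0 ≡
                               Σ + (0 + δ) + suc (n + D) * suc c + (f + t)
        eq = solve-∀

      finish-ok : ∀ s k₀ x ps → Inv2 s → δ s ≤ D → x ∈ fresh s → DPath (S s) (d s) x ps → k₀ ≤ suc L →
                  Ok (finish L s x ps) (Next s k₀) 0
      finish-ok s k₀ x ps I2 δ≤ xF p k₀≤ = ok-query (go (J false (S s ⊕ x)) refl)
        where
        open Inv2 I2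
        open Inv inv
        go : ∀ b → J false (S s ⊕ x) ≡ b →
             Ok (if b then ret (inj₁ (restart s x ps))
                 else (collect false (S s) x L (elems (unreached s)) >>= λ ys → ret (inj₁ (record-paths s x ps ys))))
                (λ r k → Next s k₀ r (suc k)) 0
        go true e with restart-ok I2 x ps xF p e
        ... | I2' , ce = ok-ret ((I2' , δ≤) , pay s (restart s x ps) (k₀ + 1) 0
                (≤-trans (+-monoˡ-≤ 1 k₀≤) (≤-trans (m≤m+n _ 1) (≤-reflexive (eq L))))
                (restart-gain s x ps t≤δ δ≤ ce))
          where
          eq : ∀ L → suc L + 1 + 1 ≡ 3 + L + 2 * L * 0
          eq = solve-∀
        go false e = ok-bind (Circuit.collect-ok false (S s) x ind₁ e L (elems (unreached s)) (≤-trans (length-elems≤ _) n≤2^L))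
          λ { ys k (eys , ck) → ok-ret (done ys k eys ck) }
          where
          done : ∀ ys k → ys ≡ _ → k ≤ 1 + 2 * L * length ys → Better s k₀ (record-paths s x ps ys) (suc (k + 0))
          done ys k eys ck with record-ok I2 x ps ys xF p e eys
          ... | I2' , up = (I2' , δ≤) , pay s (record-paths s x ps ys) _ (length ys) (lin 0 (+-mono-≤ k₀≤ ck) (eq₁ k₀ k L (length ys)))
                (lin 0 up (eq₂ (Σ' (d s)) (card (found (path s))) (length ys) (t s + δ s) (weight * card (S s))
                   (card (found (path (record-paths s x ps ys))))))
            where
            eq₁ : ∀ k₀ k L m → k₀ + suc (k + 0) + (suc L + (1 + 2 * L * m)) + 0 ≡ 3 + L + 2 * L * m + (k₀ + k)
            eq₁ = solve-∀
            eq₂ : ∀ Σ f m td w f' → Σ + f + td + w + suc m + f' + 0 ≡ Σ + f' + td + w + (f + suc m)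
            eq₂ = solve-∀

      verify-ok : ∀ s x t₀ → t₀ ≡ t s → Inv2 s → δ s ≤ D → x ∈ fresh s → Ind true ((S s ∖ below (d s) (t s)) ⊕ x) →
                  Ok (verify L s x t₀) (Next s 1) 0
      verify-ok s x zero refl I2 δ≤ xF ind = finish-ok s 1 x [] I2 δ≤ xF
        (end (proj₁ (fresh-out I2 xF)) (proj₁ (proj₂ (fresh-out I2 xF)))
          (M.down true (⊕-mono x λ y h → ∖-in (S s) _ h (below-out (d s) 0 z≤n)) ind)) (s≤s z≤n)
      verify-ok s x (suc t₀) refl I2 δ≤ xF ind = start
        where
        open Inv2 I2
        open Inv inv
        x∉S = proj₁ (fresh-out I2 xF)
        dx = proj₁ (proj₂ (fresh-out I2 xF))
        zs : List (Fin n)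
        zs = elems (S s ∩ at (d s) t₀)
        depA : J true ((S s ∖ below (d s) t₀) ⊕ x) ≡ false
        depA = M.Sp-dep true (spanned₂ I2 t₀ x (≤-reflexive (sym dx)) x∉S) (∉-⊆ (∖-ˡ (S s) _) x∉S)
        dep : J true (S s ⊕ x) ≡ false
        dep = M.up true (⊕-mono x (∖-ˡ (S s) _)) depA
        hit : ∃ λ u → u ∈ mem zs × u ∈ S s ∖ below (d s) t₀ × Ind true (S s ⊖ u ⊕ x)
        hit = M.circuit-hit true (S s) zs ind₂ (∖-ˡ (S s) _) depA (M.down true (⊕-mono x inc) ind)
          where
          inc : S s ∖ below (d s) t₀ ∖ mem zs ⊆ S s ∖ below (d s) (suc t₀)
          inc y h = ∖-in (S s) _ (∖-ˡ (S s) _ y h') (below-out (d s) (suc t₀)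
              (≤∧≢⇒< (below-no (d s) t₀ (∖-ʳ (S s) _ h')) λ e →
                true≢false (in-elems _ y (∩-in (S s) (at (d s) t₀) (∖-ˡ (S s) _ y h') (at-in (d s) t₀ (sym e)))) (∖-ʳ _ (mem zs) h)))
            where h' = ∖-ˡ (S s ∖ below (d s) t₀) (mem zs) y h
        extend-path : ∀ y → y ∈ S s → d s y ≡ t₀ → Ind true (S s ⊖ y ⊕ x) → DPath (S s) (d s) x (fromMaybe [] (path s y))
        extend-path y yS dy c with bool-case (found (path s) y)
        ... | inj₂ k = ⊥-elim (<-irrefl (sym dy) (order y k))
        ... | inj₁ k with is-found {path s} {y} k
        ...   | ps , e with inside y yS e
        ...     | w , qs , refl , (ew , _) , j , _ , q rewrite e = hop x∉S yS (trans dx (cong suc (sym dy))) ew c j q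
        start : Ok (verify L s x (suc t₀)) (Next s 1) 0
        start with hit
        ... | u , um , _ , uc = ok-bind (Circuit.bsearch-ok true (S s) x ind₂ dep L zs (≤-trans (length-elems≤ _) n≤2^L) um uc) next
          where
          next : ∀ y k → y ∈ mem zs × Ind true (S s ⊖ y ⊕ x) × k ≤ L →
                 Ok (finish L s x (fromMaybe [] (path s y))) (λ r j → Next s 1 r (k + j)) 0
          next y k (ym , yc , ck) = ok-weaken shift
            (finish-ok s (suc k) x _ I2 δ≤ xF (extend-path y (∩-ˡ (S s) _ y yS) (at-sound (d s) t₀ (∩-ʳ (S s) _ y yS)) yc) (s≤s ck))
            where
            yS = from-elems _ y ym
            shift : ∀ r j → Next s (suc k) r j → Next s 1 r (k + j)
            shift (inj₁ s') j h = h

      phase2-ok : ∀ S₀ → Common S₀ → (∀ {f} → Common f → card f ≤ card S₀ + G) →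
                  Ok (phase2 D L fuel S₀) (λ S k → (Common S × (∀ {f} → Common f → D * card f ≤ D * card S + card S)) ×
                        k ≤ κ * (n * suc D + n + (D + D) + weight * G)) (fuel * 0)
      phase2-ok S₀ (j₁ , j₂) near = ok-while P Q 0 (λ {s} {c} → halt {s} {c}) body fuel s₀ 0
        ((start , z≤n) , ≤-refl , ≤-refl)
        where
        s₀ : Search n
        s₀ = srch S₀ (λ _ → 0) 0 0 (λ _ → nothing)
        most : ℕ
        most = n * suc D + n + (D + D)
        P : ℕ → Search n → ℕ → Set
        P f s c = (Inv2 s × δ s ≤ D) × (measure s₀ + fuel ≤ measure s + f × c + κ * measure s₀ ≤ κ * measure s)
        Q : BSet n → ℕ → Set
        Q S k = (Common S × (∀ {f} → Common f → D * card f ≤ D * card S + card S)) × k ≤ κ * (most + weight * G)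
        start : Inv2 s₀
        start = record
          { inv = record { sub = λ _ h → h ; ind₁ = j₁ ; ind₂ = j₂ ; low = λ { zero _ x () ; (suc u) () }
                         ; high = λ u pos x le → high₀ u pos x le
                         ; a≤b = upLabel-≤ S₀ _ ; b≤a = upLabel-≥ S₀ _ }
          ; dS = λ _ _ → z≤n ; dN = λ _ _ → z≤n ; t≤δ = z≤n ; outside = λ _ _ () ; inside = λ _ _ () ; order = λ _ _ → z≤n }
          where
          high₀ : ∀ u → 1 ≤ u → ∀ x → u ≤ upLabel S₀ (λ _ → 0) x → Sp true (S₀ ∖ below (upLabel S₀ (λ _ → 0)) u) x
          high₀ u pos x le with bool-case (S₀ x)
          ... | inj₁ h = inj₁ (∖-in S₀ _ h (below-out _ u le))
          ... | inj₂ h = ⊥-elim (n≮0 (≤-trans pos (subst (u ≤_) (upLabel-∉ {S = S₀} h) le)))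
        measure-≤ : ∀ s → Inv2 s → δ s ≤ D → measure s ≤ most + weight * (card S₀ + G)
        measure-≤ s I2 δ≤ = +-mono-≤ (+-mono-≤ (+-mono-≤ (≤-trans (Σ-mono dle) (≤-reflexive (Σ-const n (suc D)))) (card-found≤ s))
            (+-mono-≤ (≤-trans t≤δ δ≤) δ≤)) (*-monoʳ-≤ weight (near (Inv.ind₁ inv , Inv.ind₂ inv)))
          where
          open Inv2 I2
          dle : ∀ z → d s z ≤ suc D
          dle z with bool-case (S s z)
          ... | inj₁ h = ≤-trans (dS z h) (≤-trans δ≤ (n≤1+n D))
          ... | inj₂ h = ≤-trans (dN z h) (s≤s δ≤)
        base : weight * card S₀ ≤ measure s₀
        base = m≤n+m (weight * card S₀) (Σ' (d s₀) + card (found (path s₀)) + (t s₀ + δ s₀))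
        halt : ∀ {s c} → P 0 s c → ⊥
        halt {s} ((I2 , δ≤) , le , _) = <-irrefl {measure s₀} refl (lin 0
          (+-mono-≤ le (+-mono-≤ (measure-≤ s I2 δ≤) base))
          (eq (measure s₀) most weight (card S₀) G (measure s)))
          where
          eq : ∀ M m w c G M' → suc M + (M' + 0 + (m + w * (c + G) + M)) + 0 ≡ M + (M + suc (m + w * G) + (M' + w * c))
          eq = solve-∀
        close : ∀ s c → Inv2 s → δ s ≤ D → c + κ * measure s₀ ≤ κ * measure s → c ≤ κ * (most + weight * G)
        close s c I2 δ≤ le = lin 0 (+-mono-≤ le (+-mono-≤ (*-monoʳ-≤ κ (measure-≤ s I2 δ≤)) (*-monoʳ-≤ κ base)))
          (eq κ (measure s₀) most weight (card S₀) G (measure s) c)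
          where
          eq : ∀ κ M m w x G M' c → c + (κ * M' + (κ * (m + w * (x + G)) + κ * M)) + 0 ≡
                                    κ * (m + w * G) + (c + κ * M + (κ * M' + κ * (w * x)))
          eq = solve-∀
        step : ∀ f s c k s' → P (suc f) s c → Better s 0 s' k → P f s' (c + k)
        step f s c k s' (_ , le , cost) (i' , up , ck) = i' ,
          lin 0 (+-mono-≤ le up) (eq₁ (measure s₀ + fuel) (measure s) f (measure s')) ,
          lin 0 (+-mono-≤ cost ck) (eq₂ c k (κ * measure s₀) (κ * measure s) (κ * measure s'))
          where
          eq₁ : ∀ A M f M' → A + (M + suc f + M') + 0 ≡ M' + f + (A + suc M)
          eq₁ = solve-∀
          eq₂ : ∀ c k X Y Z → c + k + X + (Y + Z) + 0 ≡ Z + (c + X + (0 + k + Y))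
          eq₂ = solve-∀
        continue' : ∀ f s c k₀ r k → P (suc f) s c → Next s k₀ r k → After P Q f c r (k₀ + k)
        continue' f s c k₀ (inj₁ s') k p h = step f s c (k₀ + k) s' p h
        body : ∀ f s c → P (suc f) s c → Ok (phase2Step D L s) (After P Q f c) 0
        body f s c p@((I2 , δ≤) , le , cost) with pick (fresh s)
        ... | inj₁ (x , xF) = ok-query (go (J true ((S s ∖ below (d s) (t s)) ⊕ x)) refl)
          where
          go : ∀ b → J true ((S s ∖ below (d s) (t s)) ⊕ x) ≡ b →
               Ok (if b then verify L s x (t s) else ret (inj₁ (lift s x))) (λ r k → After P Q f c r (suc k)) 0
          go true e = ok-weaken (λ r k h → continue' f s c 1 r k p h) (verify-ok s x (t s) refl I2 δ≤ xF e)
          go false e = ok-ret (step f s c 1 (lift s x) p ((lift-ok I2 x xF e , δ≤) , pay s (lift s x) 1 0 (s≤s z≤n) gained))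
            where
            pt : ∀ z → d s z + # (z == x) ≤ d (lift s x) z
            pt z with eq-or z x
            ... | inj₁ refl rewrite ==-refl x = ≤-reflexive (trans (+-comm (d s x) 1) (cong suc (proj₁ (proj₂ (fresh-out I2 xF)))))
            ... | inj₂ ne rewrite ==-false ne = ≤-reflexive (+-identityʳ _)
            gained : measure s + 1 ≤ measure (lift s x)
            gained = lin 0 (≤-trans (≤-reflexive (sym (trans (Σ-+ (d s) (λ z → # (z == x))) (cong (Σ' (d s) +_) (Σ-δ x))))) (Σ-mono pt))
              (eq (Σ' (d s)) (card (found (path s))) (t s + δ s) (weight * card (S s)) (Σ' (d (lift s x))))
              where
              eq : ∀ Σ f td w Σ₂ → Σ + f + td + w + 1 + Σ₂ + 0 ≡ Σ₂ + f + td + w + (Σ + 1)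
              eq = solve-∀
        ... | inj₂ none with t s <? δ s | δ s <? D
        ...   | yes t<δ | _ = ok-ret (step f s c 0 (lift-level s) p ((lift-level-ok I2 t<δ none , δ≤) , pay s (lift-level s) 0 0 z≤n gained))
          where
          dle : ∀ z → d s z ≤ d (lift-level s) z
          dle z with bool-case (unreached s z)
          ... | inj₁ h rewrite h = ≤-trans (≤-reflexive (proj₁ (proj₂ (unreached-out I2 h)))) (n≤1+n _)
          ... | inj₂ h rewrite h = ≤-refl
          gained : measure s + 1 ≤ measure (lift-level s)
          gained = lin 0 (Σ-mono dle) (eq (Σ' (d s)) (card (found (path s))) (t s) (δ s) (weight * card (S s)) (Σ' (d (lift-level s))))
            where
            eq : ∀ Σ f t δ w Σ₂ → Σ + f + (t + δ) + w + 1 + Σ₂ + 0 ≡ Σ₂ + f + (suc t + δ) + w + Σ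
            eq = solve-∀
        ...   | no t≮δ | yes δ<D = ok-ret (step f s c 0 _ p
                ((raise-δ-ok I2 (≤-antisym (Inv2.t≤δ I2) (≮⇒≥ t≮δ)) none , δ<D) ,
                 pay s (srch (S s) (d s) (suc (δ s)) (t s) (path s)) 0 0 z≤n (≤-reflexive (eq (Σ' (d s)) (card (found (path s))) (t s) (δ s) (weight * card (S s))))))
          where
          eq : ∀ Σ f t δ w → Σ + f + (t + δ) + w + 1 ≡ Σ + f + (t + suc δ) + w
          eq = solve-∀
        ...   | no _ | no δ≮D = ok-ret (((ind₁ , ind₂) , bound) , close s (c + 0) I2 δ≤ (≤-trans (≤-reflexive (cong (_+ κ * measure s₀) (+-identityʳ c))) cost))
          where
          open Inv2 I2
          open Inv (subst (λ D → Inv D (labelled (S s) (d s))) (≤-antisym δ≤ (≮⇒≥ δ≮D)) inv)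
          bound : ∀ {f} → Common f → D * card f ≤ D * card (S s) + card (S s)
          bound cf = ≤-trans (gap-bound {K = 0} (subst (λ D → Inv D (labelled (S s) (d s))) (≤-antisym δ≤ (≮⇒≥ δ≮D)) inv) no-active cf)
            (≤-reflexive (cong (λ z → D * z + card (S s)) (trans (cong (card (S s) +_) (*-zeroʳ D)) (+-identityʳ _))))
            where
            no-active : ∀ u → u < D → card (tokens (labelled (S s) (d s)) u) ≤ 0
            no-active u _ = ≤-trans (card-mono {g = ∅} λ x h →
              true≢false (∖-ˡ (S s) (S s) x (∩-ˡ (S s ∖ S s) _ x h)) (∖-ʳ (S s) (S s) (∩-ˡ (S s ∖ S s) _ x h))) (≤-reflexive card-∅)

-- Random tests separating short circuits from long ones.

module Sampling where
  open FiniteSets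
  open Matroids
  open RandomizedPrograms
  open OracleProcedures
  open import Data.Nat as ℕ using (ℕ; zero; suc)
  import Data.Nat.Properties as ℕP
  open import Data.Rational using (ℚ; 0ℚ; 1ℚ; ½; _+_; _*_; _-_; _≤_; nonNegative)
  open import Data.Rational.Properties
  open import Data.Rational.Solver
  open import Data.Nat.Tactic.RingSolver using (solve-∀)
  open +-*-Solver using (solve; _:+_; _:*_; _:-_; _:=_; con)

  pow : ℚ → ℕ → ℚ
  pow q zero    = 1ℚ
  pow q (suc k) = q * pow q k

  pow-+ : ∀ q a b → pow q (a ℕ.+ b) ≡ pow q a * pow q b
  pow-+ q zero b = sym (*-identityˡ _)
  pow-+ q (suc a) b = trans (cong (q *_) (pow-+ q a b)) (sym (*-assoc q (pow q a) (pow q b)))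

  module _ (j : ℕ) where
    p q : ℚ
    p = ½^ j
    q = 1ℚ - p

    0≤q : 0ℚ ≤ q
    0≤q = subst (_≤ q) (+-inverseʳ p) (+-mono-≤ {p} {1ℚ} (½^≤1 j) ≤-refl)

    q≤1 : q ≤ 1ℚ
    q≤1 = subst (q ≤_) (solve 1 (λ p → (con 1ℚ :- p) :+ p := con 1ℚ) refl p) (≤+ʳ (0≤½^ j))

    0≤powq : ∀ k → 0ℚ ≤ pow q k
    0≤powq zero    = nonNegative⁻¹ 1ℚ
    0≤powq (suc k) = *-nonneg 0≤q (0≤powq k)

    powq≤1 : ∀ k → pow q k ≤ 1ℚ
    powq≤1 zero    = ≤-refl
    powq≤1 (suc k) = ≤-trans (*-mono (0≤powq k) (nonNegative⁻¹ 1ℚ) q≤1 (powq≤1 k)) (≤-reflexive (*-identityˡ 1ℚ))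

    powq-anti : ∀ {a b} → a ℕ.≤ b → pow q b ≤ pow q a
    powq-anti {a} {b} h = begin
      pow q b                       ≡⟨ cong (pow q) (ℕP.m+[n∸m]≡n h) ⟨
      pow q (a ℕ.+ (b ℕ.∸ a))       ≡⟨ pow-+ q a (b ℕ.∸ a) ⟩
      pow q a * pow q (b ℕ.∸ a)     ≤⟨ *-mono (0≤powq (b ℕ.∸ a)) (0≤powq a) (≤-refl {pow q a}) (powq≤1 (b ℕ.∸ a)) ⟩
      pow q a * 1ℚ                  ≡⟨ *-identityʳ (pow q a) ⟩
      pow q a                       ∎
      where open ≤-Reasoning

    -- A division-free upper bound for (1 - p)^k, inductive because (1 - p)(1 + (k + 1) p) is at
    -- most 1 + k p. At k = 2^j it says that 2^j trials of bias 2^-j all miss with probability at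
    -- most one half.
    bernoulli : ∀ k → pow q k * (1ℚ + toℚ k * p) ≤ 1ℚ
    bernoulli zero = ≤-reflexive (trans (*-identityˡ _) (trans (cong (1ℚ +_) (*-zeroˡ p)) (+-identityʳ 1ℚ)))
    bernoulli (suc k) = begin
      q * pow q k * (1ℚ + toℚ (suc k) * p)
        ≡⟨ cong (λ z → q * pow q k * (1ℚ + z * p)) (toℚ-+ 1 k) ⟩
      q * pow q k * (1ℚ + (1ℚ + toℚ k) * p)
        ≡⟨ solve 3 (λ p a k → (con 1ℚ :- p) :* a :* (con 1ℚ :+ (con 1ℚ :+ k) :* p)
                   := a :* (con 1ℚ :+ k :* p) :- a :* (p :* p :* (con 1ℚ :+ k))) refl p (pow q k) (toℚ k) ⟩
      pow q k * (1ℚ + toℚ k * p) - pow q k * (p * p * (1ℚ + toℚ k))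
        ≤⟨ +-mono-≤ (bernoulli k) (neg-antimono-≤ (*-nonneg (0≤powq k)
             (*-nonneg (*-nonneg (0≤½^ j) (0≤½^ j)) (+-nonneg (nonNegative⁻¹ 1ℚ) (0≤toℚ k))))) ⟩
      1ℚ - 0ℚ ≡⟨⟩
      1ℚ ∎
      where open ≤-Reasoning

    powq-half : pow q (2 ℕ.^ j) ≤ ½
    powq-half = begin
      x                                 ≡⟨ solve 1 (λ x → x := con ½ :* (x :* (con 1ℚ :+ con 1ℚ))) refl x ⟩
      ½ * (x * (1ℚ + 1ℚ))               ≡⟨ cong (λ z → ½ * (x * (1ℚ + z))) (2^*½^ j) ⟨
      ½ * (x * (1ℚ + toℚ (2 ℕ.^ j) * p)) ≤⟨ *-monoˡ-≤-nonNeg ½ (bernoulli (2 ℕ.^ j)) ⟩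
      ½ * 1ℚ                            ≡⟨ *-identityʳ ½ ⟩
      ½                                 ∎
      where
      open ≤-Reasoning
      x = pow q (2 ℕ.^ j)

    powq-halves : ∀ K → pow q (K ℕ.* 2 ℕ.^ j) ≤ ½^ K
    powq-halves zero = ≤-refl
    powq-halves (suc K) = ≤-trans (≤-reflexive (pow-+ q (2 ℕ.^ j) (K ℕ.* 2 ℕ.^ j)))
      (*-mono (0≤powq (K ℕ.* 2 ℕ.^ j)) 0≤½ powq-half (powq-halves K))

  n≤2^n : ∀ n → n ℕ.≤ 2 ℕ.^ n
  n≤2^n zero    = ℕ.z≤n
  n≤2^n (suc n) = ℕP.≤-trans (ℕP.+-mono-≤ (ℕP.m^n>0 2 n) (n≤2^n n)) (ℕP.≤-reflexive (cong (2 ℕ.^ n ℕ.+_) (sym (ℕP.+-identityʳ _))))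

  n½^n≤1 : ∀ n → toℚ n * ½^ n ≤ 1ℚ
  n½^n≤1 n = ≤-trans (*-monoʳ-≤-nonNeg (½^ n) {{nonNegative (0≤½^ n)}} (toℚ-mono (n≤2^n n))) (≤-reflexive (2^*½^ n))

  module SamplePrograms (n : ℕ) (query : Bool → BSet n → Prog n Bool) where

    bern : ℕ → Prog n Bool
    bern zero    = ret true
    bern (suc j) = toss λ b → if b then bern j else ret false

    sample : ℕ → List (Fin n) → List (Fin n) → Prog n (List (Fin n))
    sample j []       R = ret R
    sample j (u ∷ us) R = bern j >>= λ b → sample j us (if b then u ∷ R else R)

    -- Is the circuit of S ⊕ x hit by each of m random subsets of us of density 2^-j?
    classify : ℕ → BSet n → Fin n → List (Fin n) → ℕ → Prog n Bool
    classify j S x us zero    = ret true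
    classify j S x us (suc m) = sample j us [] >>= λ R →
      query true (S ∖ mem R ⊕ x) >>= λ b → if b then classify j S x us m else ret false

  module SampleSpecs {n : ℕ} (I : Bool → Subset n → Bool) (M : ℕ)
    (query : Bool → BSet n → Prog n Bool) (J : Bool → BSet n → Bool) (mat : ∀ i → Mat (J i))
    (query-ok : ∀ i f → Logic.Ok I (½^ M) (0≤½^ M) (query i f) (λ b k → b ≡ J i f × k ≡ 1) 0) where

    open Err I
    open Specs I (½^ M) (0≤½^ M) query J mat query-ok hiding (module M)
    open SamplePrograms n query public

    err-both : {A : Set} (p : Prog n A) {Q R : A → ℕ → Set} {e e' : ℚ} →
               Err p Q e → Err p R e' → Err p (λ a k → Q a k × R a k) (e + e')
    err-both (ret a) (h , inj₁ a₁) (h' , inj₁ a₂) = +-nonneg h h' , inj₁ (a₁ , a₂)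
    err-both (ret a) (h , inj₂ l) (h' , _) = +-nonneg h h' , inj₂ (≤-trans l (≤+ʳ h'))
    err-both (ret a) (h , inj₁ _) (h' , inj₂ l) = +-nonneg h h' , inj₂ (≤-trans l (≤+ˡ h))
    err-both (ask i X t) h h' = err-both (t (I i X)) h h'
    err-both (toss t) {e = e} {e'} (a , b , ha , hb , le) (a' , b' , ha' , hb' , le') =
      a + a' , b + b' , err-both (t true) ha ha' , err-both (t false) hb hb' ,
      ≤-trans (≤-reflexive (solve 4 (λ a b c d → con ½ :* ((a :+ c) :+ (b :+ d)) := con ½ :* (a :+ b) :+ con ½ :* (c :+ d))
                              refl a b a' b')) (+-mono-≤ le le')

    err-query : ∀ {i f A} {t : Bool → Prog n A} {R : A → ℕ → Set} {e} → 0ℚ ≤ e →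
                Err (t (J i f)) (λ a k → R a (suc k)) e → Err (query i f >>= t) R e
    err-query {i} {f} {t = t} {R} {e} z h = subst (Err (query i f >>= t) R)
      (trans (cong (e +_) (*-zeroˡ (½^ M))) (+-identityʳ e))
      (err-bind (query i f) z (err (query-ok i f)) λ { b k (refl , refl) → h })

    err-bern : ∀ j {A} {f : Bool → Prog n A} {Q : A → ℕ → Set} {e₁ e₀} →
               Err (f true) Q e₁ → Err (f false) Q e₀ → Err (bern j >>= f) Q (p j * e₁ + q j * e₀)
    err-bern zero {f = f} {e₁ = e₁} {e₀} h₁ h₀ = err-mono (f true) (λ _ _ r → r)
      (≤-reflexive (solve 2 (λ a b → a := con 1ℚ :* a :+ (con 1ℚ :- con 1ℚ) :* b) refl e₁ e₀)) h₁
    err-bern (suc j) {e₁ = e₁} {e₀} h₁ h₀ = p j * e₁ + q j * e₀ , e₀ , err-bern j h₁ h₀ , h₀ ,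
      ≤-reflexive (solve 3 (λ x a b → con ½ :* ((x :* a :+ (con 1ℚ :- x) :* b) :+ b) := con ½ :* x :* a :+ (con 1ℚ :- con ½ :* x) :* b)
                     refl (p j) e₁ e₀)

    err-bern-same : ∀ j {A} {f : Bool → Prog n A} {Q : A → ℕ → Set} {e} →
                    Err (f true) Q e → Err (f false) Q e → Err (bern j >>= f) Q e
    err-bern-same j {f = f} {Q} {e} h₁ h₀ = subst (Err (bern j >>= f) Q)
      (solve 2 (λ x e → x :* e :+ (con 1ℚ :- x) :* e := e) refl (p j) e) (err-bern j h₁ h₀)

    module _ (X : BSet n) where

      Hits Misses : List (Fin n) → Set
      Hits R   = ∃ λ u → u ∈ mem R × u ∈ X
      Misses R = ∀ u → u ∈ mem R → u ∉ X

      hits-∷ : ∀ {u R} → Hits R → Hits (u ∷ R)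
      hits-∷ {u} (v , m , k) = v , ∨-introʳ (v == u) m , k

      misses-∷ : ∀ {u R} → u ∉ X → Misses R → Misses (u ∷ R)
      misses-∷ {u} h k v m = ∨-elim (v == u) m (λ e → subst (_∉ X) (sym (==-sound e)) h) (k v)

      sample-hit₀ : ∀ j us R → Hits R → Err (sample j us R) (λ R _ → Hits R) 0ℚ
      sample-hit₀ j [] R h = ≤-refl , inj₁ h
      sample-hit₀ j (u ∷ us) R h = err-bern-same j (sample-hit₀ j us (u ∷ R) (hits-∷ {u} {R} h)) (sample-hit₀ j us R h)

      sample-hit : ∀ j us R → Err (sample j us R) (λ R _ → Hits R) (pow (q j) (length (sel X us)))
      sample-hit j [] R = nonNegative⁻¹ 1ℚ , inj₂ ≤-refl
      sample-hit j (u ∷ us) R with X u in uX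
      ... | false = err-bern-same j (sample-hit j us (u ∷ R)) (sample-hit j us R)
      ... | true  = err-mono (sample j (u ∷ us) R) (λ _ _ h → h)
            (≤-reflexive (trans (cong (_+ q j * rest) (*-zeroʳ (p j))) (+-identityˡ _)))
            (err-bern j (sample-hit₀ j us (u ∷ R) (u , ∨-introˡ (mem R u) (==-refl u) , uX)) (sample-hit j us R))
        where rest = pow (q j) (length (sel X us))

      sample-miss : ∀ j us R → Misses R → Err (sample j us R) (λ R _ → Misses R) (toℚ (length (sel X us)) * p j)
      sample-miss j [] R h = ≤-reflexive (sym (*-zeroˡ (p j))) , inj₁ h
      sample-miss j (u ∷ us) R h with X u in uX
      ... | false = err-bern-same j (sample-miss j us (u ∷ R) (misses-∷ {u} {R} uX h)) (sample-miss j us R h)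
      ... | true  = err-mono (sample j (u ∷ us) R) (λ _ _ h → h) le
            (err-bern j (err-trivial (sample j us (u ∷ R)) (≤-refl {1ℚ})) (sample-miss j us R h))
        where
        rest = toℚ (length (sel X us)) * p j
        le : p j * 1ℚ + q j * rest ≤ toℚ (suc (length (sel X us))) * p j
        le = begin
          p j * 1ℚ + q j * rest   ≤⟨ +-mono-≤ (≤-reflexive (*-identityʳ (p j)))
                (≤-trans (*-monoʳ-≤-nonNeg rest {{nonNegative (*-nonneg (0≤toℚ (length (sel X us))) (0≤½^ j))}} (q≤1 j)) (≤-reflexive (*-identityˡ rest))) ⟩
          p j + rest              ≡⟨ solve 2 (λ x y → x :+ y :* x := (con 1ℚ :+ y) :* x) refl (p j) (toℚ (length (sel X us))) ⟩
          (1ℚ + toℚ (length (sel X us))) * p j ≡⟨ cong (_* p j) (toℚ-+ 1 (length (sel X us))) ⟨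
          toℚ (suc (length (sel X us))) * p j ∎
          where open ≤-Reasoning

    sample-free : ∀ j us R → Err (sample j us R) (λ _ k → k ≡ 0) 0ℚ
    sample-free j [] R = ≤-refl , inj₁ refl
    sample-free j (u ∷ us) R = err-bern-same j (sample-free j us (u ∷ R)) (sample-free j us R)

    module _ (j : ℕ) (S : BSet n) (x : Fin n) (jS : Ind true S) (dep : J true (S ⊕ x) ≡ false) (us : List (Fin n)) where
      open Circuit true S x jS dep

      hitCount : ℕ
      hitCount = length (sel circuit us)

      classify-cost : ∀ m → Err (classify j S x us m) (λ _ k → k ℕ.≤ m) 0ℚ
      classify-cost zero = ≤-refl , inj₁ ℕ.z≤n
      classify-cost (suc m) = err-bind (sample j us []) ≤-refl (sample-free j us []) λ { R k refl →
        err-query ≤-refl (go (J true (S ∖ mem R ⊕ x))) }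
        where
        go : ∀ b → Err (if b then classify j S x us m else ret false) (λ _ k → suc k ℕ.≤ suc m) 0ℚ
        go true  = err-mono (classify j S x us m) (λ _ _ → ℕ.s≤s) ≤-refl (classify-cost m)
        go false = ≤-refl , inj₁ (ℕ.s≤s ℕ.z≤n)

      classify-large : ∀ m → Err (classify j S x us m) (λ b _ → b ≡ true) (toℚ m * pow (q j) hitCount)
      classify-large zero = ≤-reflexive (sym (*-zeroˡ (pow (q j) hitCount))) , inj₁ refl
      classify-large (suc m) = subst (Err (classify j S x us (suc m)) (λ b _ → b ≡ true)) eq
        (err-bind (sample j us []) {e₁ = toℚ m * ε} z (sample-hit circuit j us []) λ { R _ (u , m' , c) →
          err-query z (subst (λ b → Err (if b then classify j S x us m else ret false) (λ b _ → b ≡ true) (toℚ m * ε)) (sym (hit-query R m' c)) (classify-large m)) })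
        where
        ε = pow (q j) hitCount
        z : 0ℚ ≤ toℚ m * ε
        z = *-nonneg (0≤toℚ m) (0≤powq j hitCount)
        eq : toℚ m * ε + ε ≡ toℚ (suc m) * ε
        eq = trans (solve 2 (λ a b → a :* b :+ b := (con 1ℚ :+ a) :* b) refl (toℚ m) ε) (cong (_* ε) (sym (toℚ-+ 1 m)))

      -- A sample meets a short circuit with probability at most `hitCount` times 2^-j, hence at
      -- most one half. Only a hit leads to another test, so the halves multiply; this is where the
      -- product rule is used.
      classify-small : 2 ℕ.* hitCount ℕ.≤ 2 ℕ.^ j → ∀ m → Err (classify j S x us m) (λ b _ → b ≡ false) (½^ m)
      classify-small few zero = nonNegative⁻¹ 1ℚ , inj₂ ≤-refl
      classify-small few (suc m) = subst (Err (classify j S x us (suc m)) (λ b _ → b ≡ false)) (+-identityˡ (½ * ½^ m))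
        (err-bind× (sample j us []) {e = ½} {0ℚ} {½^ m} ≤-refl (0≤½^ m)
          (err-mono (sample j us []) (λ _ _ h → h) half (sample-miss circuit j us [] λ _ ()))
          (λ R _ ms → err-query ≤-refl (subst (λ b → Err (if b then classify j S x us m else ret false) (λ b _ → b ≡ false) 0ℚ)
            (sym (not-true λ h → hitless R ms (query-hit R h))) (≤-refl , inj₁ refl)))
          (λ R _ → err-query (0≤½^ m) (go (J true (S ∖ mem R ⊕ x)))))
        where
        hitless : ∀ R → Misses circuit R → (∃ λ u → u ∈ mem R × u ∈ S × u ∈ circuit) → ⊥
        hitless R ms (u , m , _ , c) = true≢false c (ms u m)
        go : ∀ b → Err (if b then classify j S x us m else ret false) (λ b _ → b ≡ false) (½^ m)
        go true  = classify-small few m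
        go false = 0≤½^ m , inj₁ refl
        half : toℚ hitCount * p j ≤ ½
        half = begin
          toℚ hitCount * p j                  ≡⟨ solve 2 (λ a b → a :* b := con ½ :* ((con 1ℚ :+ con 1ℚ) :* a :* b)) refl (toℚ hitCount) (p j) ⟩
          ½ * (toℚ 2 * toℚ hitCount * p j)    ≡⟨ cong (λ y → ½ * (y * p j)) (toℚ-* 2 hitCount) ⟨
          ½ * (toℚ (2 ℕ.* hitCount) * p j)    ≤⟨ *-monoˡ-≤-nonNeg ½ (*-monoʳ-≤-nonNeg (p j) {{nonNegative (0≤½^ j)}} (toℚ-mono few)) ⟩
          ½ * (toℚ (2 ℕ.^ j) * p j)           ≡⟨ cong (½ *_) (2^*½^ j) ⟩
          ½ * 1ℚ                              ≡⟨ *-identityʳ ½ ⟩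
          ½                                   ∎
          where open ≤-Reasoning

      -- The two thresholds differ by a factor of order M. Between them either answer is acceptable,
      -- which is what lets a few tests decide with tiny error.
      Verdict : Bool → Set
      Verdict b = (b ≡ true → 2 ℕ.^ j ℕ.< 2 ℕ.* hitCount) × (b ≡ false → hitCount ℕ.< (M ℕ.+ M) ℕ.* 2 ℕ.^ j)

      classify-ok : Ok (classify j S x us M) (λ b k → Verdict b × k ℕ.≤ M) 1
      classify-ok = mk (subst (Err (classify j S x us M) _) unit (err-both (classify j S x us M) verdict (classify-cost M)))
        where
        unit : ½^ M + 0ℚ ≡ toℚ 1 * ½^ M
        unit = trans (+-identityʳ (½^ M)) (sym (*-identityˡ (½^ M)))
        C = classify j S x us M
        verdict : Err C (λ b _ → Verdict b) (½^ M)
        verdict with 2 ℕ.* hitCount ℕ.≤? 2 ℕ.^ j | (M ℕ.+ M) ℕ.* 2 ℕ.^ j ℕ.≤? hitCount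
        ... | yes few | no ok = err-mono C (λ { _ _ refl → (λ ()) , λ _ → ℕP.≰⇒> ok }) ≤-refl (classify-small few M)
        ... | no ok | no ok' = err-mono C (λ _ _ _ → (λ _ → ℕP.≰⇒> ok) , λ _ → ℕP.≰⇒> ok') (0≤½^ M) (classify-cost M)
        ... | no ok | yes many = err-mono C (λ { _ _ refl → (λ _ → ℕP.≰⇒> ok) , λ () }) le (classify-large M)
          where
          open ≤-Reasoning
          le : toℚ M * pow (q j) hitCount ≤ ½^ M
          le = begin
            toℚ M * pow (q j) hitCount                     ≤⟨ *-monoˡ-≤-nonNeg (toℚ M) {{nonNegative (0≤toℚ M)}}
                                                                (≤-trans (powq-anti j many) (powq-halves j (M ℕ.+ M))) ⟩
            toℚ M * ½^ (M ℕ.+ M)                           ≡⟨ cong (toℚ M *_) (½^-+ M M) ⟩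
            toℚ M * (½^ M * ½^ M)                          ≡⟨ *-assoc (toℚ M) (½^ M) (½^ M) ⟨
            -- Long circuits are missed by one sample with probability 2^-2M: one factor 2^-M
            -- absorbs the union bound over the M tests, the other remains.
            toℚ M * ½^ M * ½^ M                            ≤⟨ *-monoʳ-≤-nonNeg (½^ M) {{nonNegative (0≤½^ M)}} (n½^n≤1 M) ⟩
            1ℚ * ½^ M                                      ≡⟨ *-identityˡ (½^ M) ⟩
            ½^ M                                           ∎
        -- Both conditions can hold only for M = 0, when the allowed error is 1.
        ... | yes few | yes many = err-trivial C (≤-reflexive (cong ½^ (sym (degenerate M few many))))
          where
          degenerate : ∀ M → 2 ℕ.* hitCount ℕ.≤ 2 ℕ.^ j → (M ℕ.+ M) ℕ.* 2 ℕ.^ j ℕ.≤ hitCount → M ≡ 0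
          degenerate zero _ _ = refl
          degenerate (suc m) few many = ⊥-elim (ℕP.<-irrefl {N} refl
            (lin {a = 2 ℕ.* hitCount ℕ.+ 2 ℕ.* ((suc m ℕ.+ suc m) ℕ.* N) ℕ.+ 1} {N ℕ.+ 2 ℕ.* hitCount ℕ.+ N} {suc N} {N} (3 ℕ.* (m ℕ.* N) ℕ.+ 2 ℕ.* N ℕ.+ (m ℕ.* N)) (ℕP.+-mono-≤ (ℕP.+-mono-≤ few (ℕP.*-monoʳ-≤ 2 many)) (ℕP.m^n>0 2 j)) (eq m N hitCount)))
            where
            N = 2 ℕ.^ j
            eq : ∀ m N c → suc N ℕ.+ (N ℕ.+ 2 ℕ.* c ℕ.+ N) ℕ.+ (3 ℕ.* (m ℕ.* N) ℕ.+ 2 ℕ.* N ℕ.+ m ℕ.* N)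
                         ≡ N ℕ.+ (2 ℕ.* c ℕ.+ 2 ℕ.* ((suc m ℕ.+ suc m) ℕ.* N) ℕ.+ 1)
            eq = solve-∀

-- Turning an arbitrary alternating walk into an augmenting path.

module Shortcuts where
  open FiniteSets
  open Matroids
  open RandomizedPrograms
  open OracleProcedures
  open Augmentation
  open import Data.Nat
  open import Data.Nat.Properties
  open import Data.Rational using (ℚ; 0ℚ) renaming (_≤_ to _≤ℚ_)
  open import Data.Nat.Tactic.RingSolver

  module _ {n : ℕ} where

    last : Fin n → Pairs {n} → Fin n
    last v []             = v
    last v ((u , w) ∷ ps) = last w ps

    unwind : Pairs {n} → Pairs {n} → Pairs {n}
    unwind []         acc = acc
    unwind (uw ∷ stk) acc = unwind stk (uw ∷ acc)

    top : Fin n → Pairs {n} → Fin n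
    top v []              = v
    top v ((u , w) ∷ stk) = w

    length-unwind : ∀ stk acc → length (unwind stk acc) ≡ length stk + length acc
    length-unwind [] acc = refl
    length-unwind (_ ∷ stk) acc = trans (length-unwind stk _) (+-suc (length stk) (length acc))

  module PathPrograms (n : ℕ) (query : Bool → BSet n → Prog n Bool) where

    -- The path is kept as a stack (last pair first); an edge of the first exchange graph from an
    -- earlier u to w shortcuts everything in between.
    push : BSet n → Fin n → Pairs → Fin n → Fin n → Prog n (Fin n × Pairs {n})
    pushed : BSet n → Fin n → Pairs → Fin n → Fin n → Bool → Prog n (Fin n × Pairs {n})
    push S v stk u w = query false (S ∖ us stk ⊕ w) >>= pushed S v stk u w
    pushed S v stk                u w false = ret (v , (u , w) ∷ stk)
    pushed S v []                 u w true  = ret (w , [])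
    pushed S v ((u' , w') ∷ stk') u w true  = push S v stk' u' w

    forwardPass : BSet n → Fin n → Pairs → Pairs → Prog n (Fin n × Pairs {n})
    forwardPass S v stk []             = ret (v , unwind stk [])
    forwardPass S v stk ((u , w) ∷ ps) = push S v stk u w >>= λ r → forwardPass S (proj₁ r) (proj₂ r) ps

    skip : BSet n → Fin n → Pairs → Prog n (Pairs {n})
    skip S v []             = ret []
    skip S v ((u , w) ∷ ps) = query true (S ∖ us ps ⊕ v) >>= λ b → if b then skip S v ps else ret ((u , w) ∷ ps)

    backwardPass : BSet n → Fin n → Pairs → Prog n (Pairs {n})
    backwardPass S v []             = ret []
    backwardPass S v ((u , w) ∷ ps) = backwardPass S w ps >>= λ qs → skip S v ((u , w) ∷ qs)

    augment : BSet n → Fin n → Pairs → Prog n (BSet n)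
    augment S v ps = forwardPass S v [] ps >>= λ r →
      backwardPass S (proj₁ r) (proj₂ r) >>= λ qs → ret (aug S (proj₁ r) qs)

  module PathSpecs {n : ℕ} (I : Bool → Subset n → Bool) (μ : ℚ) (0≤μ : 0ℚ ≤ℚ μ)
    (query : Bool → BSet n → Prog n Bool) (J : Bool → BSet n → Bool) (mat : ∀ i → Mat (J i))
    (query-ok : ∀ i f → Logic.Ok I μ 0≤μ (query i f) (λ b k → b ≡ J i f × k ≡ 1) 0) where

    open Specs I μ 0≤μ query J mat query-ok
    open PathPrograms n query public

    module _ (S : BSet n) where

      data Walk : Fin n → Pairs {n} → Set where
        stay : ∀ {v} → v ∉ S → Walk v []
        hop  : ∀ {v u w ps} → v ∉ S → u ∈ S → Ind true (S ⊖ u ⊕ v) → Ind false (S ⊖ u ⊕ w) → Walk w ps →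
               Walk v ((u , w) ∷ ps)

      walk-∉ : ∀ {v ps} → Walk v ps → v ∉ S
      walk-∉ (stay h) = h
      walk-∉ (hop h _ _ _ _) = h

      walk-++ : ∀ {v ps u w qs} → Walk v ps → u ∈ S → Ind true (S ⊖ u ⊕ last v ps) → Ind false (S ⊖ u ⊕ w) →
                Walk w qs → Walk v (ps ++ (u , w) ∷ qs)
      walk-++ (stay h) uS j₂ j₁ q = hop h uS j₂ j₁ q
      walk-++ (hop h uS' k₂ k₁ p) uS j₂ j₁ q = hop h uS' k₂ k₁ (walk-++ p uS j₂ j₁ q)

      last-++ : ∀ v (ps : Pairs {n}) u w qs → last v (ps ++ (u , w) ∷ qs) ≡ last w qs
      last-++ v [] u w qs = refl
      last-++ v ((u' , w') ∷ ps) u w qs = last-++ w' ps u w qs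

      module F = Chains (mat false) S
      module B = Chains (mat true) S

      -- A stack free of shortcuts in the first exchange graph, over the source v.
      data Stack (v : Fin n) : Pairs {n} → Set where
        source : v ∉ S → Ind false (S ⊕ v) → Stack v []
        cell   : ∀ {stk u w} → u ∈ S → w ∉ S → Ind true (S ⊖ u ⊕ top v stk) → Ind false (S ⊖ u ⊕ w) →
                 J false (S ∖ us stk ⊕ w) ≡ false → Stack v stk → Stack v ((u , w) ∷ stk)

      data Tail : Fin n → Pairs {n} → Set where
        sink : ∀ {v} → v ∉ S → Ind true (S ⊕ v) → Tail v []
        hop  : ∀ {v u w ps} → u ∈ S → w ∉ S → Ind true (S ⊖ u ⊕ v) → Tail w ps → Tail v ((u , w) ∷ ps)

      stack-source : ∀ {v stk} → Stack v stk → v ∉ S × Ind false (S ⊕ v)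
      stack-source (source h j) = h , j
      stack-source (cell _ _ _ _ _ s) = stack-source s

      us-cons : ∀ stk {u w} {x : Fin n} → x ∈ S ∖ us ((u , w) ∷ stk) → x ∈ S ⊖ u
      us-cons stk {u} {w} {x} h = ⊖-in S u (∖-ˡ S _ x h)
        λ { refl → true≢false (∨-introˡ (us stk x) (==-refl x)) (∖-ʳ S (us ((u , w) ∷ stk)) h) }

      us-drop : ∀ stk {u w : Fin n} → S ∖ us stk ⊖ u ⊆ S ∖ us ((u , w) ∷ stk)
      us-drop stk {u} {w} x h = ∖-in S _ (∖-ˡ S _ x (⊖-ˡ _ u x h)) (not-true λ m →
        ∨-elim (x == u) m (λ e → ⊖-≢ _ u h (==-sound e)) (λ k → true≢false k (∖-ʳ S (us stk) (⊖-ˡ _ u x h))))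

      -- All queries but the last pop a pair, hence queries and new stack height together exceed the
      -- old height by at most two. Summed over the walk, the pass is linear in its length.
      push-ok : ∀ v (stk : Pairs {n}) u w → Stack v stk → u ∈ S → w ∉ S → Ind true (S ⊖ u ⊕ top v stk) →
                Ind false (S ∖ us ((u , w) ∷ stk) ⊕ w) →
                Ok (push S v stk u w) (λ r k → (Stack (proj₁ r) (proj₂ r) × top (proj₁ r) (proj₂ r) ≡ w) ×
                                               k + length (proj₂ r) ≤ 2 + length stk) 0
      push-ok v stk u w sk uS wS j₂ j₁ = ok-query (go stk sk j₂ j₁ (J false (S ∖ us stk ⊕ w)) refl)
        where
        edge : ∀ stk → J false (S ∖ us stk ⊕ w) ≡ false → Ind false (S ∖ us ((u , w) ∷ stk) ⊕ w) →
               Stack v stk → Ind false (S ⊖ u ⊕ w)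
        edge stk dep ind sk = proj₁ (M.exchange-circuit false (∖-ˡ S (us stk)) (ind-S sk) dep
          (M.down false (⊕-mono w (us-drop stk {w = w})) ind))
          where
          ind-S : ∀ {stk} → Stack v stk → Ind false S
          ind-S sk = M.down false (⊕-ˡ S v) (proj₂ (stack-source sk))
        go : ∀ stk → Stack v stk → Ind true (S ⊖ u ⊕ top v stk) → Ind false (S ∖ us ((u , w) ∷ stk) ⊕ w) →
             ∀ b → J false (S ∖ us stk ⊕ w) ≡ b → Ok (pushed S v stk u w b)
               (λ r k → (Stack (proj₁ r) (proj₂ r) × top (proj₁ r) (proj₂ r) ≡ w) × suc k + length (proj₂ r) ≤ 2 + length stk) 0
        go stk sk j₂ j₁ false e = ok-ret ((cell uS wS j₂ (edge stk e j₁ sk) e sk , refl) , ≤-refl)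
        go [] sk j₂ j₁ true e = ok-ret ((source wS (M.down false (⊕-mono w λ x h → ∖-in S _ h refl) e) , refl) , s≤s z≤n)
        go ((u' , w') ∷ stk') (cell u'S w'S k₂ k₁ dep sk) j₂ j₁ true e =
          ok-weaken (λ { r k (s , le) → s , ≤-trans (s≤s le) (≤-reflexive (eq (length stk'))) })
            (push-ok v stk' u' w sk u'S wS k₂ (M.down false (λ x h → h) e))
          where
          eq : ∀ a → suc (2 + a) ≡ 2 + suc a
          eq a = refl

      forwardPass-ok : ∀ v (stk ps : Pairs {n}) → Stack v stk → Walk (top v stk) ps → Ind true (S ⊕ last (top v stk) ps) →
                       Ok (forwardPass S v stk ps)
                          (λ r k → ((proj₁ r ∉ S × Ind false (S ⊕ proj₁ r)) × F.Forward [] (proj₂ r) × Tail (proj₁ r) (proj₂ r)) ×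
                                   k + length (proj₂ r) ≤ length stk + 2 * length ps) 0
      forwardPass-ok v stk [] sk (stay h) snk = ok-ret ((stack-source sk , fwd stk sk F.[] , tl stk sk (sink h snk)) ,
        ≤-reflexive (trans (length-unwind stk []) (cong (length stk +_) refl)))
        where
        fwd : ∀ stk {acc} → Stack v stk → F.Forward (map proj₁ stk) acc → F.Forward [] (unwind stk acc)
        fwd [] _ f = f
        fwd (_ ∷ stk) (cell uS wS _ j₁ dep sk) f = fwd stk sk (F.hop uS wS j₁ dep f)
        tl : ∀ stk {acc} → Stack v stk → Tail (top v stk) acc → Tail v (unwind stk acc)
        tl [] _ t = t
        tl (_ ∷ stk) (cell uS wS j₂ _ _ sk) t = tl stk sk (hop uS wS j₂ t)
      forwardPass-ok v stk ((u , w) ∷ ps) sk (hop _ uS j₂ j₁ p) snk =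
        ok-bind (push-ok v stk u w sk uS (walk-∉ p) j₂ (M.down false (⊕-mono w λ x h → us-cons stk {w = w} h) j₁))
          λ { (v' , stk') k ((sk' , refl) , le) → ok-weaken
            (λ { r l (q , le') → q , lin 0 (+-mono-≤ le le') (eq k l (length (proj₂ r)) (length stk) (length stk') (length ps)) })
            (forwardPass-ok v' stk' ps sk' p snk) }
        where
        eq : ∀ k l r s s' p → k + l + r + (2 + s + (s' + 2 * p)) + 0 ≡ s + 2 * suc p + (k + s' + (l + r))
        eq = solve-∀

      forward-weaken : ∀ {us₀ us₁ ps} → mem us₁ ⊆ mem us₀ → F.Forward us₀ ps → F.Forward us₁ ps
      forward-weaken s F.[] = F.[]
      forward-weaken s (F.hop {u = u} {w} uS wS j dep f) = F.hop uS wS j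
        (M.up false (⊕-mono w λ x h → ∖-in S _ (∖-ˡ S _ x h) (∉-⊆ s (∖-ʳ S _ h))) dep)
        (forward-weaken (λ x m → ∨-elim (x == u) m (∨-introˡ _) (λ k → ∨-introʳ (x == u) (s x k))) f)

      -- The second pass must not spoil the first. It only drops pairs, which shrinks the sets of
      -- elements passed earlier, and `forward-weaken` shows that absent edges stay absent.
      Shorter : Pairs → Pairs → Set
      Shorter ps qs = ∀ us₀ → F.Forward us₀ ps → F.Forward us₀ qs

      skip-ok : ∀ v ps → v ∉ S → Ind true S → Ind true (S ∖ us ps ⊕ v) → (∀ {u w qs} → ps ≡ (u , w) ∷ qs → B.Backward w qs) →
                Ok (skip S v ps) (λ qs k → (B.Backward v qs × Shorter ps qs) × k + length qs ≤ 1 + length ps) 0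
      skip-ok v [] vS jS j bk = ok-ret ((B.end vS (M.down true (⊕-mono v λ x h → ∖-in S _ h refl) j) , λ _ f → f) , z≤n)
      skip-ok v ((u , w) ∷ ps) vS jS j bk = ok-query (go (J true (S ∖ us ps ⊕ v)) refl)
        where
        rest : ∀ {ps} → B.Backward w ps → ∀ {u' w' qs} → ps ≡ (u' , w') ∷ qs → B.Backward w' qs
        rest (B.hop _ _ b) refl = b
        go : ∀ b → J true (S ∖ us ps ⊕ v) ≡ b → Ok (if b then skip S v ps else ret ((u , w) ∷ ps))
             (λ qs k → (B.Backward v qs × Shorter ((u , w) ∷ ps) qs) × suc k + length qs ≤ 1 + suc (length ps)) 0
        go true e = ok-weaken (λ { qs k ((b , sh) , le) → (b , λ us₀ → λ { (F.hop _ _ _ _ f) → sh us₀ (forward-weaken (λ x m → ∨-introʳ (x == u) m) f) }) , s≤s le })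
          (skip-ok v ps vS jS e (rest (bk refl)))
        go false e = ok-ret ((B.hop (proj₁ (M.exchange-circuit true (∖-ˡ S (us ps)) jS e (M.down true (⊕-mono v (us-drop ps {w = w})) j))) e (bk refl) ,
          λ _ f → f) , ≤-refl)

      backwardPass-ok : ∀ v ps → v ∉ S → Ind true S → Tail v ps →
                        Ok (backwardPass S v ps) (λ qs k → (B.Backward v qs × Shorter ps qs) × k + length qs ≤ 2 * length ps) 0
      backwardPass-ok v [] vS jS (sink h j) = ok-ret ((B.end vS j , λ _ f → f) , z≤n)
      backwardPass-ok v ((u , w) ∷ ps) vS jS (hop uS wS j t) =
        ok-bind (backwardPass-ok w ps wS jS t) λ { qs k ((b , sh) , le) → ok-weaken
          (λ { rs l ((b' , sh') , le') → (b' , λ us₀ → λ { (F.hop uS wS j dep f) → sh' us₀ (F.hop uS wS j dep (sh _ f)) }) ,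
                lin 0 (+-mono-≤ le le') (eq k l (length qs) (length rs) (length ps)) })
          (skip-ok v ((u , w) ∷ qs) vS jS (M.down true (⊕-mono v λ x h → us-cons qs {w = w} h) j) λ { refl → b }) }
        where
        eq : ∀ k l q r p → k + l + r + (2 * p + (1 + suc q)) + 0 ≡ 2 * suc p + (k + q + (l + r))
        eq = solve-∀

      augment-ok : ∀ v ps → Ind true S → v ∉ S → Ind false (S ⊕ v) → Walk v ps → Ind true (S ⊕ last v ps) →
                   Ok (augment S v ps) (λ S' k → ((Ind false S' × Ind true S') × card S' ≡ suc (card S)) × k ≤ 6 * length ps) 0
      augment-ok v ps jS vS j p snk = ok-bind (forwardPass-ok v [] ps (source vS j) p snk) λ { (v' , qs) k (((v'S , j') , f , t) , le) →
        ok-bind (backwardPass-ok v' qs v'S jS t) λ { rs l ((b , sh) , le') →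
        ok-ret (((F.forward-aug v'S j' (sh [] f) , proj₁ (proj₁ (B.backward-ok v' rs b))) , proj₂ (proj₁ (B.backward-ok v' rs b))) ,
          lin (k + length rs + 2 * length ps) (+-mono-≤ (*-monoʳ-≤ 2 le) le') (eq k l (length qs) (length rs) (length ps))) } }
        where
        eq : ∀ k l q r p → k + (l + 0) + (2 * (2 * p) + 2 * q) + (k + r + 2 * p) ≡ 6 * p + (2 * (k + q) + (l + r))
        eq = solve-∀

-- Phase 3: single augmentations by backward search and forward visits.

module Reachability where
  open FiniteSets
  open Matroids
  open RandomizedPrograms
  open OracleProcedures
  open LevelSteps
  open Approximation
  open Augmentation
  open Sampling
  open Shortcuts
  open import Data.Nat
  open import Data.Nat.Properties
  open import Data.Rational using (ℚ; 0ℚ) renaming (_≤_ to _≤ℚ_)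
  open import Data.List.Properties using (length-++)
  open import Data.Nat.Tactic.RingSolver

  module _ {n : ℕ} {X : Set} where

    has : (Fin n → Maybe X) → BSet n
    has f x = is-just (f x)

    has-just : ∀ (f : Fin n → Maybe X) {x a} → f x ≡ just a → x ∈ has f
    has-just f e rewrite e = refl

    has-elim : ∀ (f : Fin n → Maybe X) {x} → x ∈ has f → ∃ λ a → f x ≡ just a
    has-elim f {x} h with f x
    ... | just a = a , refl

    has-not : ∀ (f : Fin n → Maybe X) {x} → x ∉ has f → f x ≡ nothing
    has-not f {x} h with f x
    ... | nothing = refl

    has-nothing : ∀ (f : Fin n → Maybe X) {x} → f x ≡ nothing → x ∉ has f
    has-nothing f e rewrite e = refl

  module _ {n : ℕ} where

    meet : Maybe (List (Fin n)) → List (Fin n) → Maybe (Fin n)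
    meet nothing   us = nothing
    meet (just zs) us with find zs (mem us)
    ... | inj₁ (u , _) = just u
    ... | inj₂ _       = nothing

    meet-sound : ∀ k us {u} → meet k us ≡ just u → ∃ λ zs → k ≡ just zs × u ∈ mem zs × u ∈ mem us
    meet-sound (just zs) us e with find zs (mem us)
    meet-sound (just zs) us refl | inj₁ (u , a , b) = zs , refl , a , b

    meet-complete : ∀ zs us {u} → u ∈ mem zs → u ∈ mem us → ∃ λ w → meet (just zs) us ≡ just w
    meet-complete zs us {u} a b with find zs (mem us)
    ... | inj₁ (w , _) = w , refl
    ... | inj₂ none = true≢false b (none u a)

  Partial : ℕ → Set
  Partial n = Fin n → Maybe (Pairs {n})

  Known : ℕ → Set
  Known n = Fin n → Maybe (List (Fin n))

  -- Forward-visited elements u of S with the walk from a source to an element having an edge to u.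
  Visited : ℕ → Set
  Visited n = Fin n → Maybe (Fin n × Pairs {n})

  module Phase3Programs (n : ℕ) (query : Bool → BSet n → Prog n Bool) (j L M : ℕ) where
    open Programs n query
    open SamplePrograms n query
    open PathPrograms n query

    testAll : Bool → BSet n → List (Fin n) → BSet n → Prog n (BSet n)
    testAll i S []       acc = ret acc
    testAll i S (x ∷ xs) acc = query i (S ⊕ x) >>= λ b → testAll i S xs (λ z → if z == x then b else acc z)

    learn : Known n → Fin n → List (Fin n) → Known n
    learn K x zs z = if z == x then just zs else K z

    -- An unknown element is heavy if it passes all random tests; otherwise its circuit is learnt.
    sortOne : BSet n → List (Fin n) → Fin n → Maybe (List (Fin n)) → BSet n → Known n → Prog n (BSet n × Known n)
    judged : BSet n → List (Fin n) → Fin n → BSet n → Known n → Bool → Prog n (BSet n × Known n)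
    sortOne S U x (just _) H K = ret (H , K)
    sortOne S U x nothing  H K = classify j S x U M >>= judged S U x H K
    judged S U x H K true  = ret (H ⊕ x , K)
    judged S U x H K false = collect true S x L U >>= λ zs → ret (H , learn K x zs)

    sortAll : BSet n → List (Fin n) → List (Fin n) → BSet n → Known n → Prog n (BSet n × Known n)
    sortAll S U []       H K = ret (H , K)
    sortAll S U (x ∷ xs) H K = sortOne S U x (K x) H K >>= λ r → sortAll S U xs (proj₁ r) (proj₂ r)

    Back : Set
    Back = Partial n × BSet n

    todo : BSet n → Back → BSet n
    todo S (path , done) = (full ∖ S) ∩ has path ∖ done

    extendAt : BSet n → Known n → List (Fin n) → Fin n → Pairs {n} → Fin n → Maybe (Pairs {n}) → Maybe (Pairs {n})
    extendOut : Maybe (Fin n) → Fin n → Pairs {n} → Maybe (Pairs {n})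
    extendAt S K us v ps z (just qs) = just qs
    extendAt S K us v ps z nothing   =
      if S z then (if mem us z then just ((z , v) ∷ ps) else nothing) else extendOut (meet (K z) us) v ps
    extendOut (just u) v ps = just ((u , v) ∷ ps)
    extendOut nothing  v ps = nothing

    spread : BSet n → Known n → Back → Fin n → Pairs {n} → List (Fin n) → Back
    spread S K (path , done) v ps us = (λ z → extendAt S K us v ps z (path z)) , done ⊕ v

    pathOf : Maybe (Pairs {n}) → Pairs {n}
    pathOf (just ps) = ps
    pathOf nothing   = []

    join : Maybe (Fin n × Pairs {n}) → Maybe (Pairs {n}) → Maybe (Fin n × Pairs {n})
    join (just (v , ps)) (just qs) = just (v , ps ++ qs)
    join _               _         = nothing

    -- Learnt circuits may omit visited elements, so the backward search can overlook edges into
    -- them. If it reaches a visited element, however, that element is already connected to a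
    -- source, and joining the two walks gives an answer.
    meetVisited : ∀ {P : Fin n → Set} {R : Set} → Visited n → Back → (∃ λ u → P u) ⊎ R → Maybe (Fin n × Pairs {n})
    meetVisited F (path , _) (inj₁ (u , _)) = join (F u) (path u)
    meetVisited F _          (inj₂ _)       = nothing

    backChoice : ∀ {P : Fin n → Set} {R : Set} → BSet n → BSet n → Visited n → Known n → Back →
                 (∃ λ v → P v) ⊎ R → Prog n (Back ⊎ Maybe (Fin n × Pairs {n}))
    backChoice S src F K s (inj₁ (v , _)) =
      if src v then ret (inj₂ (just (v , pathOf (proj₁ s v))))
      else (collect false S v L (elems (S ∖ has (proj₁ s))) >>= λ us → ret (inj₁ (spread S K s v (pathOf (proj₁ s v)) us)))
    backChoice S src F K s (inj₂ _) = ret (inj₂ (meetVisited F s (pick (S ∩ has (proj₁ s) ∩ has F))))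

    backStep : BSet n → BSet n → Visited n → Known n → Back → Prog n (Back ⊎ Maybe (Fin n × Pairs {n}))
    backStep S src F K s = backChoice S src F K s (pick (todo S s))

    -- Heavy elements act as provisional sinks: a walk from a source to one of them does not augment
    -- `S`, but it permits visiting the whole rest of its long circuit.
    startBack : BSet n → BSet n → BSet n → Back
    startBack S snk H = (λ x → if S x then nothing else if snk x ∨ H x then just [] else nothing) , ∅

    unvisited : BSet n → Visited n → List (Fin n)
    unvisited S F = elems (S ∖ has F)

    visit : Visited n → Fin n → Pairs {n} → List (Fin n) → Visited n
    visit F v ps zs z = if mem zs z then just (v , ps) else F z

    roundEnd : BSet n → BSet n → Visited n → Known n → Maybe (Fin n × Pairs {n}) →
               Prog n ((Visited n × Known n) ⊎ Maybe (BSet n))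
    roundEnd S snk F K nothing         = ret (inj₂ nothing)
    roundEnd S snk F K (just (v , ps)) =
      if snk (last v ps) then (augment S v ps >>= λ S' → ret (inj₂ (just S')))
      else (collect true S (last v ps) L (unvisited S F) >>= λ zs → ret (inj₁ (visit F v ps zs , K)))

    -- Heaviness refers to the unvisited elements and is judged anew in each round, whereas learnt
    -- circuits are kept.
    roundStep : BSet n → BSet n → BSet n → Visited n × Known n → Prog n ((Visited n × Known n) ⊎ Maybe (BSet n))
    roundStep S src snk (F , K) =
      sortAll S (unvisited S F) (elems (full ∖ S ∖ snk)) ∅ K >>= λ r →
      while (backStep S src F (proj₂ r)) (suc n) (λ _ → nothing) (startBack S snk (proj₁ r)) >>= λ out →
      roundEnd S snk F (proj₂ r) out

    improve : ℕ → BSet n → Prog n (Maybe (BSet n))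
    improve Rf S = testAll false S (elems full) ∅ >>= λ src → testAll true S (elems full) ∅ >>= λ snk →
      while (roundStep S src snk) Rf (λ _ → nothing) ((λ _ → nothing) , (λ _ → nothing))

    improved : BSet n → Maybe (BSet n) → BSet n ⊎ BSet n
    improved S (just S') = inj₁ S'
    improved S nothing   = inj₂ S

    phase3 : ℕ → ℕ → BSet n → Prog n (BSet n)
    phase3 Rf F S = while (λ S → improve Rf S >>= λ o → ret (improved S o)) F (λ S → S) S

  module Phase3Specs {n : ℕ} (I : Bool → Subset n → Bool) (M : ℕ)
    (query : Bool → BSet n → Prog n Bool) (J : Bool → BSet n → Bool) (mat : ∀ i → Mat (J i))
    (query-ok : ∀ i f → Logic.Ok I (½^ M) (0≤½^ M) (query i f) (λ b k → b ≡ J i f × k ≡ 1) 0)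
    (j L : ℕ) (n≤2^L : n ≤ 2 ^ L) where

    open Phase1Specs I (½^ M) (0≤½^ M) query J mat query-ok
    open SampleSpecs I M query J mat query-ok
    open PathSpecs I (½^ M) (0≤½^ M) query J mat query-ok
    open Phase3Programs n query j L M

    testAll-ok : ∀ i S xs acc (P : Fin n → Set) → (∀ x → P x → acc x ≡ J i (S ⊕ x)) →
                 Ok (testAll i S xs acc) (λ r k → (∀ x → P x ⊎ x ∈ mem xs → r x ≡ J i (S ⊕ x)) × k ≤ length xs) 0
    testAll-ok i S [] acc P h = ok-ret ((λ { x (inj₁ p) → h x p }) , z≤n)
    testAll-ok i S (x ∷ xs) acc P h = ok-query (ok-weaken
      (λ { r k (g , le) → (λ { z (inj₁ p) → g z (inj₁ (inj₁ p))
                             ; z (inj₂ m) → ∨-elim (z == x) m (λ e → g z (inj₁ (inj₂ (==-sound e)))) (λ m' → g z (inj₂ m')) }) , s≤s le })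
      (testAll-ok i S xs (λ z → if z == x then J i (S ⊕ x) else acc z) (λ z → P z ⊎ z ≡ x) upd))
      where
      upd : ∀ z → P z ⊎ z ≡ x → (if z == x then J i (S ⊕ x) else acc z) ≡ J i (S ⊕ z)
      upd z p with bool-case (z == x)
      ... | inj₁ e rewrite e = cong (λ y → J i (S ⊕ y)) (sym (==-sound e))
      upd z (inj₁ p) | inj₂ e rewrite e = h z p
      upd z (inj₂ refl) | inj₂ e = true≢false (==-refl z) e

    module _ (S : BSet n) (cS : Common S) where
      jS₁ = proj₁ cS
      jS₂ = proj₂ cS

      circ : Bool → Fin n → BSet n
      circ i x u = J i (S ⊖ u ⊕ x)

      Heavy : Visited n → Fin n → Set
      Heavy F x = J true (S ⊕ x) ≡ false × 2 ^ j < 2 * card ((S ∖ has F) ∩ circ true x)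

      -- Only unvisited circuit elements have to be listed, so the property persists when `F` grows.
      KnownOk : Visited n → Known n → Set
      KnownOk F K = ∀ x {zs} → K x ≡ just zs →
        (∀ u → u ∈ S → u ∉ has F → u ∈ circ true x → u ∈ mem zs) × (∀ u → u ∈ mem zs → u ∈ S × u ∈ circ true x)

      -- Bound on the cost of learning the circuit of one light element.
      A : ℕ
      A = 1 + 2 * L * ((M + M) * 2 ^ j)

      record Sorted (F : Visited n) (xs : List (Fin n)) (H : BSet n) (K : Known n) (H' : BSet n) (K' : Known n) : Set where
        field
          heavy : ∀ x → x ∈ H' → Heavy F x
          known : KnownOk F K'
          cover : ∀ x → x ∈ mem xs → x ∈ H' ⊎ x ∈ has K'
          H⊆    : H ⊆ H'
          K⊆    : has K ⊆ has K'

      module _ (F : Visited n) where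

        U : List (Fin n)
        U = unvisited S F

        -- The number of learnt circuits is a potential: learning a light circuit costs at most `A`
        -- beyond the tests and is paid by the growth of `K`, so over all rounds an element is
        -- charged `A` at most once.
        sortOne-ok : ∀ x k H K → J true (S ⊕ x) ≡ false → K x ≡ k → (∀ x → x ∈ H → Heavy F x) → KnownOk F K →
                     Ok (sortOne S U x k H K)
                        (λ r c → Sorted F (x ∷ []) H K (proj₁ r) (proj₂ r) × c + A * card (has K) ≤ M + A * card (has (proj₂ r))) 1
        sortOne-ok x (just zs) H K dep e hv kn = ok-ret (record
          { heavy = hv ; known = kn ; cover = λ z m → inj₂ (subst (_∈ has K) (sym (mem-single {x = z} {x} m)) (has-just K e))
          ; H⊆ = λ _ h → h ; K⊆ = λ _ h → h } , m≤n+m _ M)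
        sortOne-ok x nothing H K dep e hv kn =
          ok-bind (classify-ok j S x jS₂ dep U) λ { b c ((big , small) , le) → judge b c big small le }
          where
          open Circuit true S x jS₂ dep
          selU : ∀ u → u ∈ mem (sel circuit U) → u ∈ S × u ∈ circ true x
          selU u m with ∧-split (mem U u) (trans (sym (mem-sel circuit U u)) m)
          ... | a , c = ∖-ˡ S _ u (from-elems _ u a) , c
          judge : ∀ b c → (b ≡ true → 2 ^ j < 2 * length (sel circuit U)) → (b ≡ false → length (sel circuit U) < (M + M) * 2 ^ j) → c ≤ M →
                  Ok (judged S U x H K b)
                     (λ r k → Sorted F (x ∷ []) H K (proj₁ r) (proj₂ r) × c + k + A * card (has K) ≤ M + A * card (has (proj₂ r))) 0
          judge true c big small le = ok-ret (record
            { heavy = λ z m → ⊕-elim H x m (hv z) λ { refl → dep , <-≤-trans (big refl) (*-monoʳ-≤ 2 (sel-elems circuit (S ∖ has F))) }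
            ; known = kn ; cover = λ z m → inj₁ (subst (_∈ H ⊕ x) (sym (mem-single {x = z} {x} m)) (⊕-self H x))
            ; H⊆ = ⊕-ˡ H x ; K⊆ = λ _ h → h } , +-monoˡ-≤ _ (≤-trans (≤-reflexive (+-identityʳ c)) le))
          judge false c big small le = ok-bind (collect-ok L U (≤-trans (length-elems≤ _) n≤2^L)) λ { zs k (refl , ck) → ok-ret (record
            { heavy = hv ; known = known'
            ; cover = λ z m → inj₂ (subst (_∈ has K') (sym (mem-single {x = z} {x} m)) (has-just K' at-x))
            ; H⊆ = λ _ h → h ; K⊆ = grows } ,
            lin 0 (+-mono-≤ le (+-mono-≤ (≤-trans ck (s≤s (*-monoʳ-≤ (2 * L) (<⇒≤ (small refl))))) (*-monoʳ-≤ A more)))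
              (eq c k A M (card (has K)) (card (has K')))) }
            where
            K' = learn K x (sel circuit U)
            at-x : K' x ≡ just (sel circuit U)
            at-x rewrite ==-refl x = refl
            else-x : ∀ {z} → (z == x) ≡ false → K' z ≡ K z
            else-x h rewrite h = refl
            grows : has K ⊆ has K'
            grows z h with bool-case (z == x)
            ... | inj₁ q = has-just K' (trans (cong K' (==-sound q)) at-x)
            ... | inj₂ q with has-elim K {z} h
            ...   | zs , k = has-just K' (trans (else-x q) k)
            more : suc (card (has K)) ≤ card (has K')
            more = ≤-trans (≤-reflexive (sym (card-⊕ (has K) x (has-nothing K e)))) (card-mono (⊕-lub grows (has-just K' at-x)))
            known' : KnownOk F K'
            known' z h with bool-case (z == x)
            ... | inj₂ q = kn z (trans (sym (else-x q)) h)
            ... | inj₁ q with ==-sound {x = z} {x} q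
            ...   | refl with trans (sym at-x) h
            ...     | refl = (λ u uS uF c → trans (mem-sel circuit U u) (∧-intro (in-elems _ u (∖-in S _ uS uF)) c)) , selU
            eq : ∀ c k A M y y' → c + (k + 0) + A * y + (M + (A + A * y')) + 0 ≡ M + A * y' + (c + (k + A * suc y))
            eq = solve-∀

        sortAll-ok : ∀ xs H K → (∀ x → x ∈ mem xs → J true (S ⊕ x) ≡ false) → (∀ x → x ∈ H → Heavy F x) → KnownOk F K →
                     Ok (sortAll S U xs H K)
                        (λ r c → Sorted F xs H K (proj₁ r) (proj₂ r) × c + A * card (has K) ≤ M * length xs + A * card (has (proj₂ r)))
                        (length xs)
        sortAll-ok [] H K dep hv kn = ok-ret (record
          { heavy = hv ; known = kn ; cover = λ _ () ; H⊆ = λ _ h → h ; K⊆ = λ _ h → h } , m≤n+m _ (M * 0))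
        sortAll-ok (x ∷ xs) H K dep hv kn =
          ok-bind (sortOne-ok x (K x) H K (dep x (∨-introˡ (mem xs x) (==-refl x))) refl hv kn) λ { (H₁ , K₁) c (s₁ , le₁) →
          ok-weaken (λ { (H₂ , K₂) k (s₂ , le₂) → record
              { heavy = Sorted.heavy s₂ ; known = Sorted.known s₂
              ; cover = λ z m → ∨-elim (z == x) m (λ e → first s₁ s₂ z (Sorted.cover s₁ z (∨-introˡ false e))) (Sorted.cover s₂ z)
              ; H⊆ = ⊆-trans (Sorted.H⊆ s₁) (Sorted.H⊆ s₂) ; K⊆ = ⊆-trans (Sorted.K⊆ s₁) (Sorted.K⊆ s₂) } ,
              lin 0 (+-mono-≤ le₁ le₂) (eq c k (A * card (has K)) (A * card (has K₁)) (A * card (has K₂)) M (length xs)) })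
            (sortAll-ok xs H₁ K₁ (λ z m → dep z (∨-introʳ (z == x) m)) (Sorted.heavy s₁) (Sorted.known s₁)) }
          where
          first : ∀ {H₁ K₁ H₂ K₂} → Sorted F (x ∷ []) H K H₁ K₁ → Sorted F xs H₁ K₁ H₂ K₂ → ∀ z → z ∈ H₁ ⊎ z ∈ has K₁ → z ∈ H₂ ⊎ z ∈ has K₂
          first s₁ s₂ z (inj₁ h) = inj₁ (Sorted.H⊆ s₂ z h)
          first s₁ s₂ z (inj₂ h) = inj₂ (Sorted.K⊆ s₂ z h)
          eq : ∀ c k X Y Z M l → c + k + X + (M + Y + (M * l + Z)) + 0 ≡ M * suc l + Z + (c + X + (k + Y))
          eq = solve-∀

        module BackSearch (src snk H : BSet n) (K : Known n) (r : ℕ)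
          (src-ok : ∀ x → src x ≡ J false (S ⊕ x)) (snk-ok : ∀ x → snk x ≡ J true (S ⊕ x))
          (known : KnownOk F K)
          (cover : ∀ x → x ∉ S → x ∉ snk → x ∈ H ⊎ x ∈ has K)
          (visited : ∀ u {v ps} → F u ≡ just (v , ps) →
             u ∈ S × (v ∉ S × Ind false (S ⊕ v)) × Walk S v ps × Ind true (S ⊖ u ⊕ last v ps) × length ps ≤ r * n) where

          Terminal : Fin n → Set
          Terminal e = e ∈ snk ⊎ e ∈ H

          Leads : Back → Fin n → Pairs {n} → Set
          Leads s v ps = Walk S v ps × Terminal (last v ps) × length ps ≤ card (proj₂ s)

          -- `fin` and `cl` are the closure properties that turn the reached set into a certificate
          -- once the search stops. An expansion prolongs a path by at most one pair, whence the
          -- bound on lengths by the number of completed elements.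
          record InvB (s : Back) : Set where
            path = proj₁ s
            done = proj₂ s
            field
              out  : ∀ v → v ∉ S → ∀ {ps} → path v ≡ just ps → Leads s v ps
              ins  : ∀ u → u ∈ S → ∀ {ps} → path u ≡ just ps → ∃ λ w → ∃ λ qs → ps ≡ (u , w) ∷ qs ×
                     u ∈ circ false w × Walk S w qs × Terminal (last w qs) × length ps ≤ card done
              ends : ∀ x → x ∉ S → Terminal x → x ∈ has path
              fin  : ∀ v → v ∈ done → (v ∉ S × v ∈ has path) × J false (S ⊕ v) ≡ false ×
                     (∀ u → u ∈ S → u ∈ circ false v → u ∈ has path)
              cl   : ∀ x → x ∉ S → ∀ {zs u} → K x ≡ just zs → u ∈ mem zs → u ∈ S → u ∈ has path → x ∈ has path

          Answer : Maybe (Fin n × Pairs {n}) → Set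
          Answer nothing         = ∀ {T} → Common T → card T ≤ card S
          Answer (just (v , ps)) = (v ∉ S × Ind false (S ⊕ v)) × Walk S v ps × Terminal (last v ps) × length ps ≤ suc r * n

          startB : InvB (startBack S snk H)
          startB = record
            { out = out ; ins = λ u uS e → true≢false (has-just path e) (has-nothing path (in-S u uS)) ; ends = ends
            ; fin = λ _ () ; cl = λ x _ _ _ uS h → true≢false h (has-nothing path (in-S _ uS)) }
            where
            path = proj₁ (startBack S snk H)
            in-S : ∀ u → u ∈ S → path u ≡ nothing
            in-S u h rewrite h = refl
            out : ∀ v → v ∉ S → ∀ {ps} → path v ≡ just ps → Leads (startBack S snk H) v ps
            out v h e rewrite h with snk v in sv | H v in hv
            out v h refl | true  | _    = stay h , inj₁ sv , z≤n
            out v h refl | false | true = stay h , inj₂ hv , z≤n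
            ends : ∀ x → x ∉ S → Terminal x → x ∈ has path
            ends x h t = has-just path {x} {[]} (trans (cong (λ b → if b then nothing else (if snk x ∨ H x then just [] else nothing)) h) (pick-end t))
              where
              isEnd : Terminal x → snk x ∨ H x ≡ true
              isEnd (inj₁ q) = ∨-introˡ (H x) q
              isEnd (inj₂ q) = ∨-introʳ (snk x) q
              pick-end : Terminal x → (if snk x ∨ H x then just [] else nothing) ≡ just []
              pick-end t = cong (λ b → if b then just [] else nothing) (isEnd t)

          todo-out : ∀ {s v} → v ∈ todo S s → v ∉ S × v ∈ has (proj₁ s) × v ∉ proj₂ s
          todo-out {s} {v} h = ∖-ʳ full S (∩-ˡ (full ∖ S) _ v h') , ∩-ʳ (full ∖ S) (has (proj₁ s)) v h' , ∖-ʳ _ _ h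
            where h' = ∖-ˡ ((full ∖ S) ∩ has (proj₁ s)) (proj₂ s) v h

          module _ {s : Back} (iB : InvB s) where
            open InvB iB

            spread-ok : ∀ {v ps us} → v ∈ todo S s → path v ≡ just ps → (dep : J false (S ⊕ v) ≡ false) →
                        us ≡ sel (circ false v) (elems (S ∖ has path)) →
                        InvB (spread S K s v ps us) × card (S ∩ has path) + length us ≤ card (S ∩ has (proj₁ (spread S K s v ps us))) ×
                        card (proj₂ (spread S K s v ps us)) ≡ suc (card done)
            spread-ok {v} {ps} {us} vT ev dep refl = record
              { out = out' ; ins = ins' ; ends = λ x h t → grows x (ends x h t) ; fin = fin' ; cl = cl' } , gain , card-⊕ done v v∉done
              where
              v∉S = proj₁ (todo-out {s} vT)
              v∉done = proj₂ (proj₂ (todo-out {s} vT))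
              s' = spread S K s v ps us
              path' = proj₁ s'
              grows : has path ⊆ has path'
              grows z h with has-elim path h
              ... | qs , e = has-just path' (trans (cong (extendAt S K us v ps z) e) refl)
              new-in : ∀ z → path z ≡ nothing → z ∈ S → z ∈ mem us → path' z ≡ just ((z , v) ∷ ps)
              new-in z e h m rewrite e | h | m = refl
              new-out : ∀ z → path z ≡ nothing → z ∉ S → path' z ≡ extendOut (meet (K z) us) v ps
              new-out z e h rewrite e | h = refl
              not-in : ∀ z → path z ≡ nothing → z ∈ S → z ∉ mem us → path' z ≡ nothing
              not-in z e h m rewrite e | h | m = refl
              old : ∀ z {qs} → path z ≡ just qs → path' z ≡ just qs
              old z e rewrite e = refl
              us-out : ∀ {u} → u ∈ mem us → u ∈ S × u ∈ circ false v
              us-out {u} m with ∧-split (mem (elems (S ∖ has path)) u) (trans (sym (mem-sel (circ false v) (elems (S ∖ has path)) u)) m)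
              ... | a , c = ∖-ˡ S _ u (from-elems _ u a) , c
              us-in : ∀ {u} → u ∈ S ∖ has path → u ∈ circ false v → u ∈ mem us
              us-in {u} m c = trans (mem-sel (circ false v) (elems (S ∖ has path)) u) (∧-intro (in-elems (S ∖ has path) u m) c)
              more : ∀ {k} → k ≤ card done → suc k ≤ card (done ⊕ v)
              more le = ≤-trans (s≤s le) (≤-reflexive (sym (card-⊕ done v v∉done)))
              same : ∀ {k} → k ≤ card done → k ≤ card (done ⊕ v)
              same le = ≤-trans (n≤1+n _) (more le)
              here = out v v∉S ev
              out' : ∀ z → z ∉ S → ∀ {qs} → path' z ≡ just qs → Leads s' z qs
              out' z h e with bool-case (has path z)
              ... | inj₁ k with has-elim path k
              ...   | qs , e' with trans (sym (old z e')) e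
              ...     | refl with out z h e'
              ...       | w , t , le = w , t , same le
              out' z h e | inj₂ k with meet (K z) us in em | trans (sym (new-out z (has-not path k) h)) e
              ...   | just u | refl with meet-sound (K z) us em
              ...     | zs , ek , uz , uu with proj₂ (known z ek) u uz | us-out uu
              ...       | uS , c₂ | _ , c₁ = hop h uS c₂ c₁ (proj₁ here) , proj₁ (proj₂ here) , more (proj₂ (proj₂ here))
              ins' : ∀ u → u ∈ S → ∀ {qs} → path' u ≡ just qs → ∃ λ w → ∃ λ rs → qs ≡ (u , w) ∷ rs ×
                     u ∈ circ false w × Walk S w rs × Terminal (last w rs) × length qs ≤ card (done ⊕ v)
              ins' u h e with bool-case (has path u)
              ... | inj₁ k with has-elim path k
              ...   | qs , e' with trans (sym (old u e')) e
              ...     | refl with ins u h e'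
              ...       | w , rs , q , c , wk , t , le = w , rs , q , c , wk , t , same le
              ins' u h e | inj₂ k with bool-case (mem us u)
              ...   | inj₂ m = true≢false (has-just path' e) (has-nothing path' (not-in u (has-not path k) h m))
              ...   | inj₁ m with trans (sym (new-in u (has-not path k) h m)) e
              ...     | refl = v , ps , refl , proj₂ (us-out m) , proj₁ here , proj₁ (proj₂ here) , more (proj₂ (proj₂ here))
              fin' : ∀ z → z ∈ done ⊕ v → (z ∉ S × z ∈ has path') × J false (S ⊕ z) ≡ false ×
                     (∀ u → u ∈ S → u ∈ circ false z → u ∈ has path')
              fin' z m = ⊕-elim done v m
                (λ k → (proj₁ (proj₁ (fin z k)) , grows z (proj₂ (proj₁ (fin z k)))) , proj₁ (proj₂ (fin z k)) ,
                       λ u uS c → grows u (proj₂ (proj₂ (fin z k)) u uS c))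
                (λ { refl → (v∉S , grows v (has-just path ev)) , dep , reach })
                where
                reach : ∀ u → u ∈ S → u ∈ circ false v → u ∈ has path'
                reach u uS c with bool-case (has path u)
                ... | inj₁ k = grows u k
                ... | inj₂ k = has-just path' (new-in u (has-not path k) uS
                        (us-in (∖-in S (has path) uS k) c))
              cl' : ∀ x → x ∉ S → ∀ {zs u} → K x ≡ just zs → u ∈ mem zs → u ∈ S → u ∈ has path' → x ∈ has path'
              cl' x h {zs} {u} ek uz uS up with bool-case (has path x) | bool-case (has path u)
              ... | inj₁ k | _ = grows x k
              ... | inj₂ _ | inj₁ k = grows x (cl x h ek uz uS k)
              ... | inj₂ k | inj₂ l with bool-case (mem us u)
              ...   | inj₂ m = true≢false up (has-nothing path' (not-in u (has-not path l) uS m))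
              ...   | inj₁ m with meet-complete zs us uz m
              ...     | w , em = has-just path' (trans (new-out x (has-not path k) h)
                            (cong (λ y → extendOut y v ps) (trans (cong (λ y → meet y us) ek) em)))
              gain : card (S ∩ has path) + length us ≤ card (S ∩ has path')
              gain = ≤-trans (+-monoʳ-≤ _ (sel-elems (circ false v) (S ∖ has path)))
                (card-disj (λ z m → ∩-in S _ (∩-ˡ S _ z m) (grows z (∩-ʳ S _ z m)))
                  (λ z m → ∩-in S _ (∖-ˡ S _ z (∩-ˡ (S ∖ has path) _ z m))
                     (has-just path' (new-in z (has-not path (∖-ʳ S _ (∩-ˡ (S ∖ has path) _ z m))) (∖-ˡ S _ z (∩-ˡ (S ∖ has path) _ z m))
                       (us-in (∩-ˡ (S ∖ has path) _ z m) (∩-ʳ (S ∖ has path) _ z m)))))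
                  (λ z m → not-true λ k → true≢false (∩-ʳ S _ z m) (∖-ʳ S _ (∩-ˡ (S ∖ has path) _ z k))))

            -- The elements with a path and the others certify that S is maximum.
            maximum : (∀ v → v ∉ todo S s) → (∀ u → u ∉ S ∩ has path ∩ has F) → ∀ {T} → Common T → card T ≤ card S
            maximum none apart {T} (jT₁ , jT₂) = begin
              card T                                ≡⟨ card-split T W ⟩
              card (T ∩ W) + card (T ∖ W)           ≤⟨ +-mono-≤
                (M.rank-≤ false (M.down false (∩-ˡ S W) jS₁) (M.down false (∩-ˡ T W) jT₁) λ x h → spans₁ x (∩-ʳ T W x h))
                (M.rank-≤ true (M.down true (∖-ˡ S W) jS₂) (M.down true (∖-ˡ T W) jT₂) λ x h → spans₂ x (∖-ʳ T W h)) ⟩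
              card (S ∩ W) + card (S ∖ W)           ≡⟨ card-split S W ⟨
              card S                                ∎
              where
              open ≤-Reasoning
              W : BSet n
              W = has path
              spans₁ : ∀ x → x ∈ W → Sp false (S ∩ W) x
              spans₁ x xW with bool-case (S x)
              ... | inj₁ h = inj₁ (∩-in S W h xW)
              ... | inj₂ h with bool-case (done x)
              ...   | inj₂ k = true≢false (∖-in _ _ (∩-in (full ∖ S) W (∖-in full S refl h) xW) k) (none x)
              ...   | inj₁ k = inj₂ (not-true λ ind → clash (M.circuit-hit false S (elems (S ∖ W)) jS₁ (λ _ m → m)
                        (proj₁ (proj₂ (fin x k))) (M.down false (⊕-mono x inc) ind)))
                where
                inc : S ∖ mem (elems (S ∖ W)) ⊆ S ∩ W
                inc y m with bool-case (W y)
                ... | inj₁ q = ∩-in S W (∖-ˡ S _ y m) q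
                ... | inj₂ q = true≢false (in-elems _ y (∖-in S W (∖-ˡ S _ y m) q)) (∖-ʳ S _ m)
                clash : (∃ λ u → u ∈ mem (elems (S ∖ W)) × u ∈ S × u ∈ circ false x) → ⊥
                clash (u , m , uS , c) = true≢false (proj₂ (proj₂ (fin x k)) u uS c) (∖-ʳ S W (from-elems _ u m))
              spans₂ : ∀ x → x ∉ W → Sp true (S ∖ W) x
              spans₂ x xW with bool-case (S x)
              ... | inj₁ h = inj₁ (∖-in S W h xW)
              ... | inj₂ h = inj₂ (not-true λ ind → clash (M.circuit-hit true S (elems (S ∩ W)) jS₂ (λ _ m → m)
                      (trans (sym (snk-ok x)) not-sink) (M.down true (⊕-mono x inc) ind)))
                where
                not-sink : x ∉ snk
                not-sink = not-true λ k → true≢false (ends x h (inj₁ k)) xW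
                inc : S ∖ mem (elems (S ∩ W)) ⊆ S ∖ W
                inc y m = ∖-in S W (∖-ˡ S _ y m) (not-true λ q → true≢false (in-elems _ y (∩-in S W (∖-ˡ S _ y m) q)) (∖-ʳ S _ m))
                -- An element without a path is neither a sink nor heavy, so its circuit was learnt.
                -- A circuit element with a path would be unvisited by `apart`, hence listed, and
                -- `cl` would then have given `x` a path too.
                clash : (∃ λ u → u ∈ mem (elems (S ∩ W)) × u ∈ S × u ∈ circ true x) → ⊥
                clash (u , m , uS , c) with cover x h not-sink
                ... | inj₁ k = true≢false (ends x h (inj₂ k)) xW
                ... | inj₂ k with has-elim K k
                ...   | zs , e = true≢false (cl x h e (proj₁ (known x e) u uS uF c) uS uW) xW
                  where
                  uW = ∩-ʳ S W u (from-elems _ u m)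
                  uF : u ∉ has F
                  uF = not-true λ q → true≢false {b = (S ∩ (W ∩ has F)) u} (∩-in S _ uS (∩-in W (has F) uW q)) (apart' u)
                    where
                    apart' : ∀ u → u ∉ S ∩ (W ∩ has F)
                    apart' u = not-true λ q → true≢false
                      (∩-in (S ∩ W) (has F) (∩-in S W (∩-ˡ S _ u q) (∩-ˡ W _ u (∩-ʳ S _ u q))) (∩-ʳ W _ u (∩-ʳ S _ u q))) (apart u)

            joined : ∀ u → u ∈ S ∩ has path ∩ has F → Answer (join (F u) (path u))
            joined u h with has-elim F (∩-ʳ (S ∩ has path) _ u h) | has-elim path (∩-ʳ S _ u (∩-ˡ (S ∩ has path) _ u h))
            ... | (v , ps) , e | qs , e' rewrite e | e' with visited u e | ins u (∩-ˡ S _ u (∩-ˡ (S ∩ has path) _ u h)) e'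
            ...   | uS , sv , wk , j₂ , len | w , rs , refl , c , wk' , t , len' =
                    sv , walk-++ S wk uS j₂ c wk' , subst Terminal (sym (last-++ S v ps u w rs)) t ,
                    ≤-trans (≤-reflexive (length-++ ps)) (≤-trans (+-mono-≤ len (≤-trans len' (card-≤n done))) (≤-reflexive (+-comm (r * n) n)))

          -- One query for each completed element and 2 L for each element of `S` that becomes
          -- reached.
          search-cost : ℕ
          search-cost = n + 2 * L * n

          search-ok : Ok (while (backStep S src F K) (suc n) (λ _ → nothing) (startBack S snk H))
                         (λ o c → Answer o × c ≤ search-cost) (suc n * 0)
          search-ok = ok-while P Q 0 (λ {s} {c} → halt {s} {c}) body (suc n) (startBack S snk H) 0
            (startB , ≤-trans (≤-reflexive (cong (_+ suc n) (sym card-∅))) ≤-refl , z≤n)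
            where
            P : ℕ → Back → ℕ → Set
            P f s c = InvB s × suc n ≤ card (proj₂ s) + f × c ≤ card (proj₂ s) + 2 * L * card (S ∩ has (proj₁ s))
            Q : Maybe (Fin n × Pairs {n}) → ℕ → Set
            Q o c = Answer o × c ≤ search-cost
            halt : ∀ {s c} → P 0 s c → ⊥
            halt {s} (_ , le , _) = 1+n≰n (≤-trans le (≤-trans (≤-reflexive (+-identityʳ _)) (card-≤n (proj₂ s))))
            close : ∀ {s c} → c ≤ card (proj₂ s) + 2 * L * card (S ∩ has (proj₁ s)) → c + 0 ≤ search-cost
            close {s} {c} le = ≤-trans (≤-reflexive (+-identityʳ c)) (≤-trans le (+-mono-≤ (card-≤n (proj₂ s)) (*-monoʳ-≤ (2 * L) (card-≤n (S ∩ has (proj₁ s))))))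
            pathOf-just : ∀ {s v} → v ∈ has (proj₁ s) → proj₁ s v ≡ just (pathOf (proj₁ s v))
            pathOf-just {s} {v} h with has-elim (proj₁ s) h
            ... | ps , e rewrite e = refl
            body : ∀ f s c → P (suc f) s c → Ok (backStep S src F K s) (After P Q f c) 0
            body f s c (iB , le , cost) with pick (todo S s)
            ... | inj₂ none = ok-ret (finished , close {s} cost)
              where
              finished : Answer (meetVisited F s (pick (S ∩ has (proj₁ s) ∩ has F)))
              finished with pick (S ∩ has (proj₁ s) ∩ has F)
              ... | inj₁ (u , h) = joined iB u h
              ... | inj₂ apart   = maximum iB none apart
            ... | inj₁ (v , vT) = go (src v) (src-ok v)
              where
              v∉S = proj₁ (todo-out {s} vT)
              ev = pathOf-just {s} (proj₁ (proj₂ (todo-out {s} vT)))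
              go : ∀ b → b ≡ J false (S ⊕ v) →
                   Ok (if b then ret (inj₂ (just (v , pathOf (proj₁ s v))))
                       else (collect false S v L (elems (S ∖ has (proj₁ s))) >>= λ us → ret (inj₁ (spread S K s v (pathOf (proj₁ s v)) us))))
                      (After P Q f c) 0
              go true e with InvB.out iB v v∉S ev
              ... | wk , t , len = ok-ret (((v∉S , sym e) , wk , t , ≤-trans len (≤-trans (card-≤n (proj₂ s)) (m≤m+n n (r * n)))) , close {s} cost)
              go false e = ok-bind (Circuit.collect-ok false S v jS₁ (sym e) L (elems (S ∖ has (proj₁ s))) (≤-trans (length-elems≤ _) n≤2^L)) next
                where
                next : ∀ us k → us ≡ sel (circ false v) (elems (S ∖ has (proj₁ s))) × k ≤ 1 + 2 * L * length us →
                       Ok (ret (inj₁ (spread S K s v (pathOf (proj₁ s v)) us))) (λ o j → After P Q f c o (k + j)) 0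
                next us k (eus , ck) with spread-ok iB vT ev (sym e) eus
                ... | iB' , up , ed = ok-ret (iB' ,
                      ≤-trans le (≤-reflexive (trans (+-suc (card (proj₂ s)) f) (cong (_+ f) (sym ed)))) ,
                      lin 0 (+-mono-≤ cost (+-mono-≤ ck (+-mono-≤ (*-monoʳ-≤ (2 * L) up) (≤-reflexive (sym ed)))))
                        (eq c k L (card (proj₂ s)) (card (S ∩ has (proj₁ s))) (length us) (card (proj₂ s')) (card (S ∩ has (proj₁ s')))))
                  where
                  s' = spread S K s v (pathOf (proj₁ s v)) us
                  eq : ∀ c k L d p u d' p' → c + (k + 0) + (d + 2 * L * p + (1 + 2 * L * u + (2 * L * p' + d'))) + 0
                                           ≡ d' + 2 * L * p' + (c + (k + (2 * L * (p + u) + suc d)))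
                  eq = solve-∀

      record InvR (r : ℕ) (s : Visited n × Known n) : Set where
        F = proj₁ s
        K = proj₂ s
        field
          visited : ∀ u {v ps} → F u ≡ just (v , ps) →
            u ∈ S × (v ∉ S × Ind false (S ⊕ v)) × Walk S v ps × Ind true (S ⊖ u ⊕ last v ps) × length ps ≤ r * n
          known : KnownOk F K

      Improved : Maybe (BSet n) → Set
      Improved nothing   = ∀ {T} → Common T → card T ≤ card S
      Improved (just S') = Common S' × card S' ≡ suc (card S)

      perRound : ℕ
      perRound = M * n + (n + 2 * L * n) + (1 + 2 * L * n)

      -- An unfinished round visits at least half of 2^j new elements, doubled here to stay within
      -- ℕ; this limits the number of rounds. Learning is again amortised against `K`.
      RoundPost : ℕ → Visited n × Known n → (Visited n × Known n) ⊎ Maybe (BSet n) → ℕ → Set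
      RoundPost r (F , K) (inj₁ (F' , K')) c = InvR (suc r) (F' , K') × 2 ^ j + 2 * card (has F) ≤ 2 * card (has F') ×
        c + A * card (has K) ≤ perRound + A * card (has K')
      RoundPost r (F , K) (inj₂ o) c = Improved o × c + A * card (has K) ≤ perRound + A * n + 6 * (suc r * n)

      module Rounds (src snk : BSet n) (src-ok : ∀ x → src x ≡ J false (S ⊕ x)) (snk-ok : ∀ x → snk x ≡ J true (S ⊕ x)) where

        roundStep-ok : ∀ r s → InvR r s → Ok (roundStep S src snk s) (RoundPost r s) n
        roundStep-ok r (F , K) iR = ok-mono (λ _ _ h → h) errors
          (ok-bind (sortAll-ok F (elems (full ∖ S ∖ snk)) ∅ K dep (λ _ ()) known) λ { (H , K') c (so , ck) →
           ok-bind (BackSearch.search-ok F src snk H K' r src-ok snk-ok (Sorted.known so) (cover so) visited) λ { o k (ans , ck') →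
           ok-weaken (λ { o' l h → pay {K'} o' c k l ck ck' h }) (finish H K' so o ans) } })
          where
          open InvR iR using (visited; known)
          xs = elems (full ∖ S ∖ snk)
          errors : length xs + (suc n * 0 + 0) ≤ n
          errors = ≤-trans (≤-reflexive (trans (cong (λ z → length xs + (z + 0)) (*-zeroʳ n)) (+-identityʳ (length xs)))) (length-elems≤ _)
          dep : ∀ x → x ∈ mem xs → J true (S ⊕ x) ≡ false
          dep x m = trans (sym (snk-ok x)) (∖-ʳ (full ∖ S) snk (from-elems _ x m))
          cover : ∀ {H K'} → Sorted F xs ∅ K H K' → ∀ x → x ∉ S → x ∉ snk → x ∈ H ⊎ x ∈ has K'
          cover so x h k = Sorted.cover so x (in-elems _ x (∖-in (full ∖ S) snk (∖-in full S refl h) k))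
          Fin-Post : Known n → (Visited n × Known n) ⊎ Maybe (BSet n) → ℕ → Set
          Fin-Post K' (inj₁ (F' , K'')) l = (InvR (suc r) (F' , K'') × 2 ^ j + 2 * card (has F) ≤ 2 * card (has F')) × K'' ≡ K' × l ≤ 1 + 2 * L * n
          Fin-Post K' (inj₂ o) l = Improved o × l ≤ 6 * (suc r * n)
          pay : ∀ {K'} o' c k l → c + A * card (has K) ≤ M * length xs + A * card (has K') → k ≤ n + 2 * L * n →
                Fin-Post K' o' l → RoundPost r (F , K) o' (c + (k + l))
          pay {K'} (inj₁ (F' , K'')) c k l p q ((a , b) , refl , t) = a , b ,
            lin 0 (+-mono-≤ p (+-mono-≤ q (+-mono-≤ t (*-monoʳ-≤ M (length-elems≤ (full ∖ S ∖ snk)))))) (eq c k l A (card (has K)) (card (has K')) (M * length xs) (M * n) (n + 2 * L * n) (2 * L * n))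
            where
            eq : ∀ c k l A y y' m m' q t → c + (k + l) + A * y + (m + A * y' + (q + ((1 + t) + m'))) + 0 ≡
                                           m' + q + (1 + t) + A * y' + (c + A * y + (k + (l + m)))
            eq = solve-∀
          pay {K'} (inj₂ o) c k l p q (a , t) = a ,
            lin (1 + 2 * L * n) (+-mono-≤ p (+-mono-≤ q (+-mono-≤ t (+-mono-≤ (*-monoʳ-≤ M (length-elems≤ (full ∖ S ∖ snk))) (*-monoʳ-≤ A (card-≤n (has K')))))))
              (eq c k l A (card (has K)) (card (has K')) (M * length xs) (M * n) (n + 2 * L * n) (2 * L * n) n (6 * (suc r * n)))
            where
            eq : ∀ c k l A y y' m m' q t n z → c + (k + l) + A * y + (m + A * y' + (q + (z + (m' + A * n)))) + (1 + t) ≡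
                                               m' + q + (1 + t) + A * n + z + (c + A * y + (k + (l + (m + A * y'))))
            eq = solve-∀
          finish : ∀ H K' → (so : Sorted F xs ∅ K H K') → ∀ o →
                   BackSearch.Answer F src snk H K' r src-ok snk-ok (Sorted.known so) (cover so) visited o →
                   Ok (roundEnd S snk F K' o) (Fin-Post K') 0
          finish H K' so nothing ans = ok-ret (ans , z≤n)
          finish H K' so (just (v , ps)) ((v∉S , sv) , wk , t , len) = go (snk (last v ps)) refl
            where
            e = last v ps
            go : ∀ b → snk e ≡ b →
                 Ok (if b then (augment S v ps >>= λ S' → ret (inj₂ (just S')))
                     else (collect true S e L (unvisited S F) >>= λ zs → ret (inj₁ (visit F v ps zs , K')))) (Fin-Post K') 0
            go true q = ok-bind (augment-ok S v ps jS₂ v∉S sv wk (trans (sym (snk-ok e)) q)) λ { S' k ((c , ce) , ck) →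
              ok-ret ((c , ce) , ≤-trans (≤-reflexive (+-identityʳ k)) (≤-trans ck (*-monoʳ-≤ 6 len))) }
            go false q = heavyCase t
              where
              heavyCase : BackSearch.Terminal F src snk H K' r src-ok snk-ok (Sorted.known so) (cover so) visited e →
                          Ok (collect true S e L (unvisited S F) >>= λ zs → ret (inj₁ (visit F v ps zs , K'))) (Fin-Post K') 0
              heavyCase (inj₁ s) = true≢false s q
              heavyCase (inj₂ h) with Sorted.heavy so e h
              ... | dep , big = ok-bind (Circuit.collect-ok true S e jS₂ dep L (unvisited S F) (≤-trans (length-elems≤ _) n≤2^L)) next
                where
                next : ∀ zs k → zs ≡ sel (circ true e) (unvisited S F) × k ≤ 1 + 2 * L * length zs →
                       Ok (ret (inj₁ (visit F v ps zs , K'))) (λ o l → Fin-Post K' o (k + l)) 0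
                next zs k (ez , ck) = ok-ret ((record { visited = visited' ; known = known' } , gain) , refl ,
                  ≤-trans (≤-reflexive (+-identityʳ k)) (≤-trans ck (s≤s (*-monoʳ-≤ (2 * L) len-zs))))
                  where
                  F' = visit F v ps zs
                  zs-out : ∀ {u} → u ∈ mem zs → u ∈ S ∖ has F × u ∈ circ true e
                  zs-out {u} m with ∧-split (mem (unvisited S F) u) (trans (sym (mem-sel (circ true e) (unvisited S F) u)) (trans (cong (λ l → mem l u) (sym ez)) m))
                  ... | a , c = from-elems _ u a , c
                  zs-in : ∀ {u} → u ∈ S ∖ has F → u ∈ circ true e → u ∈ mem zs
                  zs-in {u} a c = trans (cong (λ l → mem l u) ez) (trans (mem-sel (circ true e) (unvisited S F) u) (∧-intro (in-elems _ u a) c))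
                  len-zs : length zs ≤ n
                  len-zs = ≤-trans (≤-reflexive (cong length ez)) (≤-trans (sel-elems (circ true e) (S ∖ has F)) (card-≤n _))
                  at-zs : ∀ {u} → u ∈ mem zs → F' u ≡ just (v , ps)
                  at-zs m rewrite m = refl
                  off-zs : ∀ {u} → u ∉ mem zs → F' u ≡ F u
                  off-zs m rewrite m = refl
                  grows : has F ⊆ has F'
                  grows u h = has-just F' (trans (off-zs (not-true λ m → true≢false h (∖-ʳ S _ (proj₁ (zs-out m))))) (proj₂ (has-elim F h)))
                  visited' : ∀ u {v' ps'} → F' u ≡ just (v' , ps') →
                    u ∈ S × (v' ∉ S × Ind false (S ⊕ v')) × Walk S v' ps' × Ind true (S ⊖ u ⊕ last v' ps') × length ps' ≤ suc r * n
                  visited' u eu with bool-case (mem zs u)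
                  ... | inj₁ m with trans (sym (at-zs m)) eu
                  ...   | refl = ∖-ˡ S _ u (proj₁ (zs-out m)) , (v∉S , sv) , wk , proj₂ (zs-out m) , len
                  visited' u eu | inj₂ m with visited u (trans (sym (off-zs m)) eu)
                  ...   | a , b , c , d , le = a , b , c , d , ≤-trans le (m≤n+m _ n)
                  known' : KnownOk F' K'
                  known' x ek = (λ u uS uF c → proj₁ (Sorted.known so x ek) u uS (∉-⊆ grows uF) c) , proj₂ (Sorted.known so x ek)
                  gain : 2 ^ j + 2 * card (has F) ≤ 2 * card (has F')
                  gain = lin 0 (+-mono-≤ (<⇒≤ big) (*-monoʳ-≤ 2 (card-disj {f = has F} {(S ∖ has F) ∩ circ true e} {has F'} grows
                           (λ u m → has-just F' (at-zs (zs-in (∩-ˡ _ _ u m) (∩-ʳ (S ∖ has F) _ u m))))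
                           (λ u h → not-true λ k → true≢false h (∖-ʳ S _ (∩-ˡ (S ∖ has F) _ u k))))))
                         (eq (2 ^ j) (card (has F)) (card ((S ∖ has F) ∩ circ true e)) (card (has F')))
                    where
                    eq : ∀ h f x f' → h + 2 * f + (2 * x + 2 * f') + 0 ≡ 2 * f' + (h + 2 * (f + x))
                    eq = solve-∀

      improveCost : ℕ → ℕ
      improveCost Rf = 2 * n + (Rf * perRound + A * n + 6 * (Rf * n))

      -- Visited elements lie in `S`, so `Rf` unfinished rounds would visit more elements than `S`
      -- has.
      improve-ok : ∀ Rf → 2 * card S < 2 ^ j * Rf → Ok (improve Rf S) (λ o c → Improved o × c ≤ improveCost Rf) (Rf * n)
      improve-ok Rf enough =
        ok-bind (testAll-ok false S (elems full) ∅ (λ _ → ⊥) (λ _ ())) λ { src c (so , ck) →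
        ok-bind (testAll-ok true S (elems full) ∅ (λ _ → ⊥) (λ _ ())) λ { snk d (to , dk) →
        ok-weaken (λ { o l (im , le) → im , lin 0 (+-mono-≤ (≤-trans ck (length-elems≤ full)) (+-mono-≤ (≤-trans dk (length-elems≤ full)) le))
                                              (eq₀ c d l n (Rf * perRound + A * n + 6 * (Rf * n))) })
          (loop src snk (λ x → so x (inj₂ (in-elems full x refl))) (λ x → to x (inj₂ (in-elems full x refl)))) } }
        where
        eq₀ : ∀ c d l n X → c + (d + l) + (n + (n + X)) + 0 ≡ 2 * n + X + (c + (d + l))
        eq₀ = solve-∀
        Q : Maybe (BSet n) → ℕ → Set
        Q o c = Improved o × c ≤ Rf * perRound + A * n + 6 * (Rf * n)
        P : ℕ → Visited n × Known n → ℕ → Set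
        P f s c = ∃ λ r → r + f ≡ Rf × InvR r s × 2 ^ j * r ≤ 2 * card (has (proj₁ s)) × c ≤ r * perRound + A * card (has (proj₂ s))
        halt : ∀ {s c} → P 0 s c → ⊥
        halt {s} (r , e , iR , le , _) = <-irrefl refl (begin-strict
          2 * card S              <⟨ enough ⟩
          2 ^ j * Rf              ≡⟨ cong (2 ^ j *_) (trans (sym e) (+-identityʳ r)) ⟩
          2 ^ j * r               ≤⟨ le ⟩
          2 * card (has (proj₁ s)) ≤⟨ *-monoʳ-≤ 2 (card-mono λ u h → proj₁ (InvR.visited iR u (proj₂ (has-elim (proj₁ s) h)))) ⟩
          2 * card S              ∎)
          where open ≤-Reasoning
        loop : ∀ src snk → (∀ x → src x ≡ J false (S ⊕ x)) → (∀ x → snk x ≡ J true (S ⊕ x)) →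
               Ok (while (roundStep S src snk) Rf (λ _ → nothing) ((λ _ → nothing) , (λ _ → nothing))) Q (Rf * n)
        loop src snk so to = ok-while P Q n (λ {s} {c} → halt {s} {c}) body Rf ((λ _ → nothing) , (λ _ → nothing)) 0
          (0 , refl , record { visited = λ _ () ; known = λ _ () } , ≤-trans (≤-reflexive (*-zeroʳ (2 ^ j))) z≤n , z≤n)
          where
          body : ∀ f s c → P (suc f) s c → Ok (roundStep S src snk s) (After P Q f c) n
          body f s c (r , e , iR , le , cost) = ok-weaken post (Rounds.roundStep-ok src snk so to r s iR)
            where
            post : ∀ o k → RoundPost r s o k → After P Q f c o k
            post (inj₁ s') k (iR' , up , ck) = suc r , trans (sym (+-suc r f)) e , iR' ,
              lin 0 (+-mono-≤ le up) (eq₁ (2 ^ j) r (card (has (proj₁ s))) (card (has (proj₁ s')))) ,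
              lin 0 (+-mono-≤ cost ck) (eq₂ c k r perRound A (card (has (proj₂ s))) (card (has (proj₂ s'))))
              where
              eq₁ : ∀ h r f f' → h * suc r + (2 * f + 2 * f') + 0 ≡ 2 * f' + (h * r + (h + 2 * f))
              eq₁ = solve-∀
              eq₂ : ∀ c k r p A y y' → c + k + (r * p + A * y + (p + A * y')) + 0 ≡ suc r * p + A * y' + (c + (k + A * y))
              eq₂ = solve-∀
            post (inj₂ o) k (im , ck) = im , ≤-trans
              (lin 0 (+-mono-≤ cost ck) (eq₃ c k r perRound A (card (has (proj₂ s))) n (6 * (suc r * n))))
              (+-mono-≤ (+-monoˡ-≤ (A * n) (*-monoˡ-≤ perRound r<)) (*-monoʳ-≤ 6 (*-monoˡ-≤ n r<)))
              where
              r< : suc r ≤ Rf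
              r< = ≤-trans (m≤m+n (suc r) f) (≤-reflexive (trans (sym (+-suc r f)) e))
              eq₃ : ∀ c k r p A y n z → c + k + (r * p + A * y + (p + A * n + z)) + 0 ≡ suc r * p + A * n + z + (c + (k + A * y))
              eq₃ = solve-∀

    phase3-ok : ∀ Rf fuel cap S₀ → Common S₀ → (∀ f → Ind false f → card f ≤ cap) → 2 * cap < 2 ^ j * Rf →
                (∀ {T} → Common T → card T < card S₀ + fuel) →
                Ok (phase3 Rf fuel S₀) (λ S k → (Common S × (∀ {T} → Common T → card T ≤ card S)) ×
                      k ≤ (2 * n + (Rf * (M * n + (n + 2 * L * n) + (1 + 2 * L * n)) + (1 + 2 * L * ((M + M) * 2 ^ j)) * n + 6 * (Rf * n))) * fuel)
                   (fuel * (Rf * n))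
    phase3-ok Rf fuel cap S₀ c₀ bounded enough near = ok-while P Q (Rf * n) (λ {s} {c} → halt {s} {c}) body fuel S₀ 0 (c₀ , near , ≤-refl)
      where
      C : ℕ
      C = 2 * n + (Rf * (M * n + (n + 2 * L * n) + (1 + 2 * L * n)) + (1 + 2 * L * ((M + M) * 2 ^ j)) * n + 6 * (Rf * n))
      P : ℕ → BSet n → ℕ → Set
      P f S c = Common S × (∀ {T} → Common T → card T < card S + f) × c + C * f ≤ C * fuel
      Q : BSet n → ℕ → Set
      Q S k = (Common S × (∀ {T} → Common T → card T ≤ card S)) × k ≤ C * fuel
      halt : ∀ {S c} → P 0 S c → ⊥
      halt {S} (cS , lt , _) = <-irrefl refl (<-≤-trans (lt cS) (≤-reflexive (+-identityʳ (card S))))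
      body : ∀ f S c → P (suc f) S c → Ok (improve Rf S >>= λ o → ret (improved S o)) (After P Q f c) (Rf * n)
      body f S c (cS , lt , cost) = ok-mono (λ _ _ h → h) (≤-reflexive (+-identityʳ (Rf * n)))
        (ok-bind (improve-ok S cS Rf (≤-<-trans (*-monoʳ-≤ 2 (bounded S (proj₁ cS))) enough)) λ { o k (im , ck) → ok-ret (post o k im ck) })
        where
        eq : ∀ c k C f Y → c + (k + 0) + C * f + (Y + C) + 0 ≡ Y + (c + C * suc f + k)
        eq = solve-∀
        pays : ∀ k → k ≤ C → c + (k + 0) + C * f ≤ C * fuel
        pays k ck = lin 0 (+-mono-≤ cost ck) (eq c k C f (C * fuel))
        post : ∀ o k → Improved S cS o → k ≤ C → After P Q f c (improved S o) (k + 0)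
        post nothing   k im ck = (cS , im) , ≤-trans (m≤m+n _ (C * f)) (pays k ck)
        post (just S') k (cS' , e) ck = cS' , (λ cT → <-≤-trans (lt cT) (≤-reflexive (trans (+-suc (card S) f) (cong (_+ f) (sym e))))) , pays k ck

-- Logarithms, fourth roots and the fifth-power bound.

module Arithmetic where
  open FiniteSets
  open import Data.Nat
  open import Data.Nat.Properties
  open import Data.Nat.Tactic.RingSolver

  power-step : ∀ i k → suc i ^ suc k ≤ i ^ suc k + suc k * suc i ^ k
  power-step i zero = ≤-reflexive (eq i)
    where
    eq : ∀ i → suc i * 1 ≡ i * 1 + (1 + 0) * 1
    eq = solve-∀
  power-step i (suc k) = begin
    suc i * suc i ^ suc k                                   ≤⟨ *-monoʳ-≤ (suc i) (power-step i k) ⟩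
    suc i * (i ^ suc k + suc k * suc i ^ k)                 ≡⟨ eq i (i ^ suc k) (suc i ^ k) k ⟩
    i * i ^ suc k + (i ^ suc k + suc k * (suc i * suc i ^ k)) ≤⟨ +-monoʳ-≤ (i * i ^ suc k) (+-monoˡ-≤ _ (^-monoˡ-≤ (suc k) (n≤1+n i))) ⟩
    i * i ^ suc k + (suc i ^ suc k + suc k * (suc i ^ suc k)) ∎
    where
    open ≤-Reasoning
    eq : ∀ i a b k → suc i * (a + suc k * b) ≡ i * a + (a + suc k * (suc i * b))
    eq = solve-∀

  -- By `power-step` the increment of m^(k+1) is at most (k+1) (m+1)^k, which the induction
  -- hypothesis compares with 2^m; increments that double sum to a multiple of the last one.
  poly≤exp : ∀ k → ∃ λ C → ∀ m → m ^ k ≤ C * 2 ^ m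
  poly≤exp zero = 1 , λ m → ≤-trans (m^n>0 2 m) (≤-reflexive (sym (*-identityˡ _)))
  poly≤exp (suc k) with poly≤exp k
  ... | C , h = 2 * (suc k * C) , go
    where
    open ≤-Reasoning
    go : ∀ m → m ^ suc k ≤ 2 * (suc k * C) * 2 ^ m
    go zero = z≤n
    go (suc m) = begin
      suc m ^ suc k                                              ≤⟨ power-step m k ⟩
      m ^ suc k + suc k * suc m ^ k                              ≤⟨ +-mono-≤ (go m) (*-monoʳ-≤ (suc k) (h (suc m))) ⟩
      2 * (suc k * C) * 2 ^ m + suc k * (C * (2 * 2 ^ m))        ≡⟨ eq (suc k) C (2 ^ m) ⟩
      2 * (suc k * C) * (2 * 2 ^ m)                              ∎
      where
      eq : ∀ k C x → 2 * (k * C) * x + k * (C * (2 * x)) ≡ 2 * (k * C) * (2 * x)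
      eq = solve-∀

  log-up : ∀ n → ∃ λ L → suc n ≤ 2 ^ L × 2 ^ L ≤ 2 * suc n
  log-up zero = 0 , ≤-refl , s≤s z≤n
  log-up (suc n) with log-up n
  ... | L , lo , hi with suc (suc n) ≤? 2 ^ L
  ...   | yes p = L , p , ≤-trans hi (*-monoʳ-≤ 2 (n≤1+n (suc n)))
  ...   | no p = suc L , ≤-trans (s≤s lo) (≤-trans (+-monoˡ-≤ (2 ^ L) (m^n>0 2 L)) (≤-reflexive (cong (2 ^ L +_) (sym (+-identityʳ _))))) ,
                 *-monoʳ-≤ 2 (≤-trans (≤-pred (≰⇒> p)) (n≤1+n (suc n)))

  -- The later parameter 2^e is a fourth root up to a factor two. It must be a power of two because
  -- sampling with density 1/g² is done by tossing fair coins.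
  root : ∀ ρ → ∃ λ e → 16 ^ e ≤ suc ρ × suc ρ < 16 ^ suc e
  root zero = 0 , ≤-refl , s≤s (s≤s z≤n)
  root (suc ρ) with root ρ
  ... | e , lo , hi with suc (suc ρ) <? 16 ^ suc e
  ...   | yes p = e , ≤-trans lo (n≤1+n (suc ρ)) , p
  ...   | no p = suc e , ≮⇒≥ p , ≤-<-trans hi (^-monoʳ-< 16 (s≤s (s≤s z≤n)) {suc e} {suc (suc e)} ≤-refl)

  16^ : ∀ e → 16 ^ e ≡ (2 ^ e) ^ 4
  16^ e = trans (^-*-assoc 2 4 e) (trans (cong (2 ^_) (*-comm 4 e)) (sym (^-*-assoc 2 e 4)))

  fourth-cancel : ∀ {x y} → x ^ 4 ≤ y ^ 4 → x ≤ y
  fourth-cancel {x} {y} h with x ≤? y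
  ... | yes p = p
  ... | no p = ⊥-elim (<-irrefl refl (<-≤-trans (^-monoˡ-< 4 (≰⇒> p)) h))
    where open import Data.Empty using (⊥-elim)

  ^-distribʳ-* : ∀ k x y → (x * y) ^ k ≡ x ^ k * y ^ k
  ^-distribʳ-* zero x y = refl
  ^-distribʳ-* (suc k) x y = trans (cong (x * y *_) (^-distribʳ-* k x y)) (eq x y (x ^ k) (y ^ k))
    where
    eq : ∀ x y a b → x * y * (a * b) ≡ x * a * (y * b)
    eq = solve-∀

  ^-^ : ∀ x {a b c} → a * b ≡ c → (x ^ a) ^ b ≡ x ^ c
  ^-^ x {a} {b} e = trans (^-*-assoc x a b) (cong (x ^_) e)

  -- Compared at fourth powers: g⁴ ≤ n turns (g³)⁴ into n³ and leaves one factor n for Λ^40. This is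
  -- the origin of the exponent 40.
  polylog-bound : ∀ {n Λ g B} .{{_ : NonZero B}} → Λ ^ 40 ≤ B * n → g ^ 4 ≤ n → g ^ 3 * Λ ^ 10 ≤ B * n
  polylog-bound {n} {Λ} {g} {B} hL hg = fourth-cancel (begin
    (g ^ 3 * Λ ^ 10) ^ 4         ≡⟨ ^-distribʳ-* 4 (g ^ 3) (Λ ^ 10) ⟩
    (g ^ 3) ^ 4 * (Λ ^ 10) ^ 4   ≡⟨ cong₂ _*_ (trans (^-^ g {3} {4} {12} refl) (sym (^-^ g {4} {3} {12} refl))) (^-^ Λ {10} {4} {40} refl) ⟩
    (g ^ 4) ^ 3 * Λ ^ 40         ≤⟨ *-mono-≤ (^-monoˡ-≤ 3 hg) hL ⟩
    n ^ 3 * (B * n)              ≡⟨ eq (n ^ 3) B n ⟩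
    B * n ^ 4                    ≤⟨ *-monoˡ-≤ (n ^ 4) (≤-trans (≤-reflexive (sym (^-identityʳ B))) (^-monoʳ-≤ B {1} {4} (s≤s z≤n))) ⟩
    B ^ 4 * n ^ 4                ≡⟨ ^-distribʳ-* 4 B n ⟨
    (B * n) ^ 4                  ∎)
    where
    open ≤-Reasoning
    eq : ∀ x B n → x * (B * n) ≡ B * (n * x)
    eq = solve-∀

  polylog-from : ∀ {C} → (∀ Λ → Λ ^ 40 ≤ C * 2 ^ Λ) → ∀ n L g → 2 ^ L ≤ 2 * n → g ^ 4 ≤ n → g ^ 3 * suc L ^ 10 ≤ suc (4 * C) * n
  polylog-from {C} h n L g hL hg = with-Λ (suc L) (h (suc L)) log-bound
    where
    open ≤-Reasoning
    with-Λ : ∀ Λ {x} → Λ ^ 40 ≤ x → x ≤ suc (4 * C) * n → g ^ 3 * Λ ^ 10 ≤ suc (4 * C) * n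
    with-Λ Λ p q = polylog-bound {n} {Λ} {g} {suc (4 * C)} (≤-trans p q) hg
    eq : ∀ C n → C * (2 * (2 * n)) ≡ 4 * C * n
    eq = solve-∀
    log-bound : C * 2 ^ suc L ≤ suc (4 * C) * n
    log-bound = begin
      C * (2 * 2 ^ L)     ≤⟨ *-monoʳ-≤ C (*-monoʳ-≤ 2 hL) ⟩
      C * (2 * (2 * n))   ≡⟨ eq C n ⟩
      4 * C * n           ≤⟨ *-monoˡ-≤ n (n≤1+n (4 * C)) ⟩
      suc (4 * C) * n     ∎

  opaque
    -- The constant is 1 + 4 * 2^40 * 40!, which should never be evaluated during type checking;
    -- hence the opacity.
    polylog : ∃ λ C → ∀ n L g → 2 ^ L ≤ 2 * n → g ^ 4 ≤ n → g ^ 3 * suc L ^ 10 ≤ C * n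
    polylog = suc (4 * proj₁ P) , polylog-from {proj₁ P} (proj₂ P)
      where
      P : ∃ λ C → ∀ m → m ^ 40 ≤ C * 2 ^ m
      P = poly≤exp 40

  -- q ≤ κ n g³ Λ² suffices for the fifth-power bound, because g⁴ ≤ r leaves a factor n^(1/4) to spare.
  fifth-power : ∀ {κ n g Λ q C r} → q ≤ κ * (n * (g ^ 3 * Λ ^ 2)) → g ^ 4 ≤ r → g ^ 3 * Λ ^ 10 ≤ C * n →
                q ^ 5 ≤ κ ^ 5 * C * n ^ 6 * r ^ 3
  fifth-power {κ} {n} {g} {Λ} {q} {C} {r} hq hr hl = begin
    q ^ 5                                             ≤⟨ ^-monoˡ-≤ 5 hq ⟩
    (κ * (n * (g ^ 3 * Λ ^ 2))) ^ 5                   ≡⟨ ^-distribʳ-* 5 κ _ ⟩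
    κ ^ 5 * (n * (g ^ 3 * Λ ^ 2)) ^ 5                 ≡⟨ cong (κ ^ 5 *_) (^-distribʳ-* 5 n _) ⟩
    κ ^ 5 * (n ^ 5 * (g ^ 3 * Λ ^ 2) ^ 5)             ≡⟨ cong (λ z → κ ^ 5 * (n ^ 5 * z)) (^-distribʳ-* 5 (g ^ 3) (Λ ^ 2)) ⟩
    κ ^ 5 * (n ^ 5 * ((g ^ 3) ^ 5 * (Λ ^ 2) ^ 5))     ≡⟨ cong (λ z → κ ^ 5 * (n ^ 5 * z)) (cong₂ _*_ pg (^-^ Λ {2} {5} {10} refl)) ⟩
    κ ^ 5 * (n ^ 5 * ((g ^ 4) ^ 3 * g ^ 3 * Λ ^ 10))  ≡⟨ cong (λ z → κ ^ 5 * (n ^ 5 * z)) (*-assoc ((g ^ 4) ^ 3) (g ^ 3) (Λ ^ 10)) ⟩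
    κ ^ 5 * (n ^ 5 * ((g ^ 4) ^ 3 * (g ^ 3 * Λ ^ 10))) ≤⟨ *-monoʳ-≤ (κ ^ 5) (*-monoʳ-≤ (n ^ 5) (*-mono-≤ (^-monoˡ-≤ 3 hr) hl)) ⟩
    κ ^ 5 * (n ^ 5 * (r ^ 3 * (C * n)))               ≡⟨ eq (κ ^ 5) (n ^ 5) (r ^ 3) C n ⟩
    κ ^ 5 * C * n ^ 6 * r ^ 3                         ∎
    where
    open ≤-Reasoning
    pg : (g ^ 3) ^ 5 ≡ (g ^ 4) ^ 3 * g ^ 3
    pg = trans (^-^ g {3} {5} {15} refl) (trans (^-distribˡ-+-* g 12 3) (cong (_* g ^ 3) (sym (^-^ g {4} {3} {12} refl))))
    eq : ∀ k x r C n → k * (x * (r * (C * n))) ≡ k * C * (n * x) * r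
    eq = solve-∀

-- The complete algorithm, its parameters and its query costs.

module MaximumCommonSet where
  open FiniteSets
  open Matroids
  open RandomizedPrograms
  open OracleProcedures
  open LevelSteps
  open Approximation
  open LabelledSearch
  open Sampling
  open Reachability
  open Arithmetic
  open import Data.Nat
  open import Data.Nat.Properties
  open import Data.Fin.Subset using (Subset; ∣_∣; ⁅_⁆) renaming (_∪_ to _∪ˢ_; _∈_ to _∈ˢ_; _∉_ to _∉ˢ_)
  open import Data.Fin.Subset.Properties using (x∈p∪q⁺; x∈⁅x⁆)
  open import Data.Vec.Properties using (lookup∘tabulate; lookup⇒[]=; []=⇒lookup)
  open import Data.Nat.Tactic.RingSolver

  opaque
    unfolding card

    card-tabulate : ∀ {n} (f : BSet n) → ∣ tabulate f ∣ ≡ card f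
    card-tabulate {zero} f = refl
    card-tabulate {suc n} f with f zero
    ... | true  = cong suc (card-tabulate (f ∘ suc))
    ... | false = card-tabulate (f ∘ suc)

  module _ {n : ℕ} where

    ∈-tab : ∀ {f : BSet n} {x} → x ∈ f → x ∈ˢ tabulate f
    ∈-tab {f} {x} h = lookup⇒[]= x (tabulate f) (trans (lookup∘tabulate f x) h)

    tab-∈ : ∀ {f : BSet n} {x} → x ∈ˢ tabulate f → x ∈ f
    tab-∈ {f} {x} h = trans (sym (lookup∘tabulate f x)) ([]=⇒lookup h)

    matroid : ∀ {I : Subset n → Bool} → IsMatroid I → Mat (λ f → I (tabulate f))
    matroid {I} m = record
      { J∅ = downward (tabulate ∅) (proj₁ nonempty) (λ h → ⊥-elim (true≢false (tab-∈ {∅} h) refl)) (proj₂ nonempty)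
      ; down = λ {f} {g} s h → downward (tabulate f) (tabulate g) (λ k → ∈-tab (s _ (tab-∈ k))) h
      ; exch = λ {f} {g} jf jg lt → back (exchange (tabulate f) (tabulate g) jf jg (subst₂ _<_ (sym (card-tabulate f)) (sym (card-tabulate g)) lt)) }
      where
      open IsMatroid m
      back : ∀ {f g} → (∃ λ v → v ∈ˢ tabulate g × v ∉ˢ tabulate f × I (tabulate f ∪ˢ ⁅ v ⁆) ≡ true) →
             ∃ λ v → v ∈ g × v ∉ f × I (tabulate (f ⊕ v)) ≡ true
      back {f} {g} (v , vg , vf , h) = v , tab-∈ vg , not-true (λ k → vf (∈-tab k)) ,
        downward (tabulate (f ⊕ v)) (tabulate f ∪ˢ ⁅ v ⁆)
          (λ {x} k → ⊕-elim f v (tab-∈ k) (λ q → x∈p∪q⁺ (inj₁ (∈-tab q))) λ { refl → x∈p∪q⁺ (inj₂ (x∈⁅x⁆ v)) }) h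

    ≤ᵇ-in : ∀ {a b} → a ≤ b → (a ≤ᵇ b) ≡ true
    ≤ᵇ-in h = T-true (≤⇒≤ᵇ h)

    ≤ᵇ-out : ∀ {a b} → (a ≤ᵇ b) ≡ true → a ≤ b
    ≤ᵇ-out {a} {b} h = ≤ᵇ⇒≤ a b (subst T (sym h) _)

    -- Truncating the first matroid at O(r) bounds the potential of phase 1, whatever its rank.
    truncate : ∀ {J : BSet n → Bool} cap → Mat J → Mat (λ f → J f ∧ (card f ≤ᵇ cap))
    truncate {J} cap m = record
      { J∅ = ∧-intro J∅ (≤ᵇ-in (≤-trans (≤-reflexive card-∅) z≤n))
      ; down = λ {f} {g} s h → ∧-intro (down s (proj₁ (∧-split (J g) h))) (≤ᵇ-in (≤-trans (card-mono s) (≤ᵇ-out (proj₂ (∧-split (J g) h)))))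
      ; exch = λ {f} {g} jf jg lt → bounded f g jg lt (exch (proj₁ (∧-split (J f) jf)) (proj₁ (∧-split (J g) jg)) lt) }
      where
      open Mat m
      bounded : ∀ f g → J g ∧ (card g ≤ᵇ cap) ≡ true → card f < card g → (∃ λ v → v ∈ g × v ∉ f × J (f ⊕ v) ≡ true) →
                ∃ λ v → v ∈ g × v ∉ f × J (f ⊕ v) ∧ (card (f ⊕ v) ≤ᵇ cap) ≡ true
      bounded f g jg lt (v , vg , vf , h) = v , vg , vf ,
        ∧-intro h (≤ᵇ-in (≤-trans (card-⊕≤ f v) (≤-trans lt (≤ᵇ-out (proj₂ (∧-split (J g) jg))))))

  module Algorithm (n tests L : ℕ) where

    rawQuery : Bool → BSet n → Prog n Bool
    rawQuery i f = ask i (tabulate f) ret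

    -- The truncated matroid costs no additional queries, since the size test involves only the
    -- queried set.
    cappedQuery : ℕ → Bool → BSet n → Prog n Bool
    cappedQuery cap false f = ask false (tabulate f) λ b → ret (b ∧ (card f ≤ᵇ cap))
    cappedQuery cap true  f = ask true (tabulate f) ret

    module _ (ρ : ℕ) where
      open Phase1Programs n (cappedQuery (2 * suc ρ)) using (phase1)
      open Phase2Programs n (cappedQuery (2 * suc ρ)) using (phase2)
      open Phase3Programs n (cappedQuery (2 * suc ρ)) using (phase3)

      -- `fuel₂` is the `fuel` of phase 2 for label bound g³ and at most 33 g³ augmentations.
      e g fuel₂ : ℕ
      e = proj₁ (root ρ)
      g = 2 ^ e
      fuel₂ = suc (n * suc (g * g * g) + n + (g * g * g + g * g * g) + suc (n + g * g * g) * (33 * (g * g * g)))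

      -- As g⁴ ≤ |X| < 16 g⁴ for the greedy X, labels up to g leave a deficit of at most 33 g³, and labels up to
      -- g³ one of at most 32 g.
      maximize : Prog n (Subset n)
      maximize =
        phase1 g (g * g) (64 * (g * g * g)) >>= λ S₁ →
        phase2 (g * g * g) L fuel₂ S₁ >>= λ S₂ →
        phase3 (e + e) L tests (64 * (g * g)) (suc (32 * g)) S₂ >>= λ S₃ → ret (tabulate S₃)

    -- An empty greedy set is already optimal, as no common independent set is more than twice as
    -- large.
    fromGreedy : ℕ → BSet n → Prog n (Subset n)
    fromGreedy zero    X = ret (tabulate X)
    fromGreedy (suc ρ) X = maximize ρ

    algorithm : Prog n (Subset n)
    algorithm = Programs.scan n rawQuery ∅ ∅ (elems full) ∅ ∅ >>= λ r → fromGreedy (card (proj₁ r)) (proj₁ r)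

  module Costs (n L m g : ℕ) (1≤n : 1 ≤ n) (1≤g : 1 ≤ g) where

    -- `V` is the unit in which all phases are measured: n g³ with two logarithmic factors, one from
    -- halving and one from the number of tests.
    Λ d h V : ℕ
    Λ = suc L
    h = g * g
    d = g * g * g
    V = n * d * (Λ * Λ)

    1≤h : 1 ≤ h
    1≤h = *-mono-≤ 1≤g 1≤g

    1≤d : 1 ≤ d
    1≤d = *-mono-≤ 1≤h 1≤g

    1≤Λ² : 1 ≤ Λ * Λ
    1≤Λ² = s≤s z≤n

    nd≤V : n * d ≤ V
    nd≤V = ≤-trans (≤-reflexive (sym (*-identityʳ (n * d)))) (*-monoʳ-≤ (n * d) 1≤Λ²)

    n≤nd : n ≤ n * d
    n≤nd = ≤-trans (≤-reflexive (sym (*-identityʳ n))) (*-monoʳ-≤ n 1≤d)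

    phase1-cost : n + 4 * n * (64 * d) ≤ 257 * V
    phase1-cost = ≤-trans (lin 0 n≤nd (eq n d)) (*-monoʳ-≤ 257 nd≤V)
      where
      eq : ∀ n d → n + 4 * n * (64 * d) + n * d + 0 ≡ 257 * (n * d) + n
      eq = solve-∀

    -- Expanded, the second factor is 34 n d + 2 n + 35 d + 33 d², so it is at most 104 n d since d
    -- ≤ n; the factor 3 comes from 3 + 2 L ≤ 3 Λ.
    phase2-cost : d ≤ n → (3 + 2 * L) * (n * suc d + n + (d + d) + suc (n + d) * (33 * d)) ≤ 312 * V
    phase2-cost d≤n = ≤-trans (*-mono-≤ (κ≤ L) inner) (≤-trans (≤-reflexive (eq₁ Λ (n * d)))
        (*-monoʳ-≤ 312 (*-monoʳ-≤ (n * d) (m≤m*n Λ Λ))))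
      where
      κ≤ : ∀ L → 3 + 2 * L ≤ 3 * suc L
      κ≤ L = ≤-trans (+-monoʳ-≤ 3 (*-monoˡ-≤ L {2} {3} (s≤s (s≤s z≤n)))) (≤-reflexive (eq L))
        where
        eq : ∀ L → 3 + 3 * L ≡ 3 * suc L
        eq = solve-∀
      d≤nd : d ≤ n * d
      d≤nd = ≤-trans (≤-reflexive (sym (*-identityˡ d))) (*-monoˡ-≤ d 1≤n)
      inner : n * suc d + n + (d + d) + suc (n + d) * (33 * d) ≤ 104 * (n * d)
      inner = lin 0 (+-mono-≤ (*-monoʳ-≤ 2 n≤nd) (+-mono-≤ (*-monoʳ-≤ 35 d≤nd) (*-monoʳ-≤ 33 (*-monoˡ-≤ d d≤n)))) (eq n d (n * d) refl)
        where
        eq' : ∀ n d → n * suc d + n + (d + d) + suc (n + d) * (33 * d) + (2 * (n * d) + (35 * (n * d) + 33 * (n * d))) + 0 ≡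
                      104 * (n * d) + (2 * n + (35 * d + 33 * (d * d)))
        eq' = solve-∀
        eq : ∀ n d x → x ≡ n * d → n * suc d + n + (d + d) + suc (n + d) * (33 * d) + (2 * (n * d) + (35 * (n * d) + 33 * (n * d))) + 0 ≡
                      104 * (n * d) + (2 * n + (35 * d + 33 * (d * d)))
        eq n d _ _ = eq' n d
      eq₁ : ∀ Λ x → 3 * Λ * (104 * x) ≡ 312 * (x * Λ)
      eq₁ = solve-∀

    -- 33 bounds the number of augmentations in units of g. For a single one, 771 = 3 + 448 + 256 +
    -- 64 collects the terms without M, and 68 m = 64 m + 4 m those for the tests and for learning
    -- light circuits.
    phase3-cost : ∀ {M} → M ≤ m * Λ →
      (2 * n + (64 * h * (M * n + (n + 2 * L * n) + (1 + 2 * L * n)) + (1 + 2 * L * ((M + M) * h)) * n + 6 * (64 * h * n))) * suc (32 * g)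
        ≤ 33 * (771 + 68 * m) * V
    phase3-cost {M} M≤ = ≤-trans (*-mono-≤ round fuel) (≤-reflexive (eq₂ (771 + 68 * m) n h g Λ))
      where
      fuel : suc (32 * g) ≤ 33 * g
      fuel = +-monoˡ-≤ (32 * g) 1≤g
      W : ℕ
      W = n * h * (Λ * Λ)
      nh≤W : n * h ≤ W
      nh≤W = ≤-trans (≤-reflexive (sym (*-identityʳ (n * h)))) (*-monoʳ-≤ (n * h) 1≤Λ²)
      n≤W : n ≤ W
      n≤W = ≤-trans (≤-trans (≤-reflexive (sym (*-identityʳ n))) (*-monoʳ-≤ n 1≤h)) nh≤W
      h≤W : h ≤ W
      h≤W = ≤-trans (≤-trans (≤-reflexive (sym (*-identityˡ h))) (*-monoˡ-≤ h 1≤n)) nh≤W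
      nhL≤W : n * h * L ≤ W
      nhL≤W = *-monoʳ-≤ (n * h) (≤-trans (n≤1+n L) (m≤m*n Λ Λ))
      nhM≤W : n * h * M ≤ m * W
      nhM≤W = ≤-trans (*-monoʳ-≤ (n * h) (≤-trans M≤ (*-monoʳ-≤ m (m≤m*n Λ Λ)))) (≤-reflexive (eq (n * h) m (Λ * Λ)))
        where
        eq : ∀ x m y → x * (m * y) ≡ m * (x * y)
        eq = solve-∀
      nhLM≤W : n * h * (L * M) ≤ m * W
      nhLM≤W = ≤-trans (*-monoʳ-≤ (n * h) (*-mono-≤ (n≤1+n L) M≤)) (≤-reflexive (eq (n * h) m Λ))
        where
        eq : ∀ x m y → x * (y * (m * y)) ≡ m * (x * (y * y))
        eq = solve-∀
      round : 2 * n + (64 * h * (M * n + (n + 2 * L * n) + (1 + 2 * L * n)) + (1 + 2 * L * ((M + M) * h)) * n + 6 * (64 * h * n)) ≤ (771 + 68 * m) * W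
      round = lin 0 (+-mono-≤ (*-monoʳ-≤ 3 n≤W) (+-mono-≤ (*-monoʳ-≤ 64 nhM≤W) (+-mono-≤ (*-monoʳ-≤ 448 nh≤W)
                (+-mono-≤ (*-monoʳ-≤ 256 nhL≤W) (+-mono-≤ (*-monoʳ-≤ 64 h≤W) (*-monoʳ-≤ 4 nhLM≤W))))))
              (eq n h M L m W)
        where
        eq : ∀ n h M L m W → 2 * n + (64 * h * (M * n + (n + 2 * L * n) + (1 + 2 * L * n)) + (1 + 2 * L * ((M + M) * h)) * n + 6 * (64 * h * n)) +
               (3 * W + (64 * (m * W) + (448 * W + (256 * W + (64 * W + 4 * (m * W)))))) + 0 ≡
             (771 + 68 * m) * W + (3 * n + (64 * (n * h * M) + (448 * (n * h) + (256 * (n * h * L) + (64 * h + 4 * (n * h * (L * M)))))))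
        eq = solve-∀
      eq₂ : ∀ k n h g Λ → k * (n * h * (Λ * Λ)) * (33 * g) ≡ 33 * k * (n * (h * g) * (Λ * Λ))
      eq₂ = solve-∀

-- Correctness, error budget and the final bound.

open FiniteSets
open Matroids
open RandomizedPrograms
open OracleProcedures
open LevelSteps
open Approximation
open LabelledSearch
open Sampling
open Reachability
open Arithmetic
open MaximumCommonSet
open import Data.Nat
open import Data.Nat.Properties
open import Data.Nat.Logarithm using (⌊log₂_⌋)
open import Data.Vec.Properties using (tabulate∘lookup)
open import Data.Rational using (ℚ; 0ℚ; 1ℚ; _-_; nonNegative) renaming (_*_ to _*ℚ_; _≤_ to _≤ℚ_; _+_ to _+ℚ_)
import Data.Rational.Properties as ℚP
open import Data.Rational.Solver
open import Data.Nat.Tactic.RingSolver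

-- 571 = 2 + 257 + 312 for the greedy scan and the first two phases; the remaining summand is phase
-- 3.
costFactor : ℕ → ℕ
costFactor m = 571 + 33 * (771 + 68 * m)

pair : ∀ {A : Set} → A → A → Bool → A
pair a b false = a
pair a b true  = b

module Correctness {n : ℕ} (m tests L : ℕ) (1≤n : 1 ≤ n) (n≤2^L : n ≤ 2 ^ L) (tests≤ : tests ≤ m * suc L)
  {I₁ I₂ : Subset n → Bool} (m₁ : IsMatroid I₁) (m₂ : IsMatroid I₂) where

  open Algorithm n tests L
  open Logic (pair I₁ I₂) (½^ tests) (0≤½^ tests)

  J : Bool → BSet n → Bool
  J i f = pair I₁ I₂ i (tabulate f)

  J-mat : ∀ i → Mat (J i)
  J-mat false = matroid m₁
  J-mat true  = matroid m₂

  raw-ok : ∀ i f → Ok (rawQuery i f) (λ b k → b ≡ J i f × k ≡ 1) 0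
  raw-ok i f = ok-ask (ok-ret (refl , refl))

  Jᶜ : ℕ → Bool → BSet n → Bool
  Jᶜ cap false f = J false f ∧ (card f ≤ᵇ cap)
  Jᶜ cap true  f = J true f

  Jᶜ-mat : ∀ cap i → Mat (Jᶜ cap i)
  Jᶜ-mat cap false = truncate cap (J-mat false)
  Jᶜ-mat cap true  = J-mat true

  capped-ok : ∀ cap i f → Ok (cappedQuery cap i f) (λ b k → b ≡ Jᶜ cap i f × k ≡ 1) 0
  capped-ok cap false f = ok-ask (ok-ret (refl , refl))
  capped-ok cap true  f = ok-ask (ok-ret (refl , refl))

  Com : BSet n → Set
  Com f = J false f ≡ true × J true f ≡ true

  Λ² : ℕ
  Λ² = suc L * suc L

  Maximum : BSet n → Set
  Maximum f = Com f × (∀ {T} → Com T → card T ≤ card f)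

  -- The alternative `g ≡ 1` serves the run that stops at an empty greedy set, where g⁴ ≤ `card f`
  -- has no positive solution.
  Solved : Subset n → ℕ → Set
  Solved S q = ∃ λ f → S ≡ tabulate f × Maximum f ×
    ∃ λ g → (g ≡ 1 ⊎ g ^ 4 ≤ card f) × q ≤ costFactor m * (n * (g * g * g) * Λ²)

  module _ (ρ : ℕ) (X : BSet n) (cX : Com X) (cardX : card X ≡ suc ρ) (twice : ∀ {T} → Com T → card T ≤ 2 * suc ρ) where

    cap : ℕ
    cap = 2 * suc ρ

    open Phase1Specs (pair I₁ I₂) (½^ tests) (0≤½^ tests) (cappedQuery cap) (Jᶜ cap) (Jᶜ-mat cap) (capped-ok cap) using (Common; phase1-ok)
    open Phase2Specs (pair I₁ I₂) (½^ tests) (0≤½^ tests) (cappedQuery cap) (Jᶜ cap) (Jᶜ-mat cap) (capped-ok cap) using (module Phase2Loop)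

    g₀ d₀ : ℕ
    g₀ = g ρ
    d₀ = g₀ * g₀ * g₀
    q₄ : ℕ
    q₄ = g₀ * g₀ * g₀ * g₀

    open Phase3Specs (pair I₁ I₂) tests (cappedQuery cap) (Jᶜ cap) (Jᶜ-mat cap) (capped-ok cap) (e ρ + e ρ) L n≤2^L using (phase3-ok)

    1≤g : 1 ≤ g₀
    1≤g = m^n>0 2 (e ρ)

    16^≡q₄ : 16 ^ e ρ ≡ q₄
    16^≡q₄ = trans (16^ (e ρ)) (eq g₀)
      where
      eq : ∀ g → g * (g * (g * (g * 1))) ≡ g * g * g * g
      eq = solve-∀

    q₄≤ : q₄ ≤ suc ρ
    q₄≤ = subst (_≤ suc ρ) 16^≡q₄ (proj₁ (proj₂ (root ρ)))

    ρ< : suc (suc ρ) ≤ 16 * q₄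
    ρ< = subst (λ x → suc (suc ρ) ≤ 16 * x) 16^≡q₄ (proj₂ (proj₂ (root ρ)))

    2^j : 2 ^ (e ρ + e ρ) ≡ g₀ * g₀
    2^j = ^-distribˡ-+-* 2 (e ρ) (e ρ)

    -- The cap is twice the greedy size, so truncation removes no common independent set and the two
    -- problems have the same optima.
    to-common : ∀ {T} → Com T → Common T
    to-common (h , k) = ∧-intro h (≤ᵇ-in {n} (twice (h , k))) , k

    from-common : ∀ {T} → Common T → Com T
    from-common {T} (h , k) = proj₁ (∧-split (J false T) h) , k

    bounded : ∀ f → Jᶜ cap false f ≡ true → card f ≤ cap
    bounded f h = ≤ᵇ-out {n} (proj₂ (∧-split (J false f) h))

    cap≤ : cap ≤ 32 * q₄
    cap≤ = lin 2 (*-monoʳ-≤ 2 ρ<) (eq ρ q₄)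
      where
      eq : ∀ ρ q → 2 * suc ρ + 2 * (16 * q) + 2 ≡ 32 * q + 2 * suc (suc ρ)
      eq = solve-∀

    -- The potential is at most 4 g (ρ + 1), which is below 4 g times 16 g⁴; the step count 64 g³ is
    -- this 64 g⁵ divided by the gain g² of a step.
    enough₁ : g₀ * (cap + cap) < g₀ * g₀ * (64 * d₀)
    enough₁ = lin 3 (+-mono-≤ (*-monoʳ-≤ (4 * g₀) ρ<) (*-monoʳ-≤ 4 1≤g)) (eq g₀ ρ)
      where
      eq : ∀ g ρ → suc (g * (2 * suc ρ + 2 * suc ρ)) + (4 * g * (16 * (g * g * g * g)) + 4 * g) + 3 ≡
                   g * g * (64 * (g * g * g)) + (4 * g * suc (suc ρ) + 4 * 1)
      eq = solve-∀

    -- Fewer than g² active elements on each of g levels contribute g³, and the crossing term,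
    -- `card S₁` ≤ 32 g⁴ divided by g, contributes 32 g³.
    near₂ : ∀ {S₁} → Common S₁ → (∀ {f} → Common f → g₀ * card f ≤ g₀ * (card S₁ + g₀ * (g₀ * g₀)) + card S₁) →
            ∀ {f} → Common f → card f ≤ card S₁ + 33 * d₀
    near₂ {S₁} c₁ h {f} cf = *-cancelˡ-≤ g₀ {{>-nonZero 1≤g}} (lin 0 (+-mono-≤ (h cf) (≤-trans (bounded S₁ (proj₁ c₁)) cap≤)) (eq g₀ (card f) (card S₁)))
      where
      eq : ∀ g f s → g * f + (g * (s + g * (g * g)) + s + 32 * (g * g * g * g)) + 0 ≡ g * (s + 33 * (g * g * g)) + (g * f + s)
      eq = solve-∀

    near₃ : ∀ {S₂} → Common S₂ → (∀ {f} → Common f → d₀ * card f ≤ d₀ * card S₂ + card S₂) →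
            ∀ {f} → Common f → card f < card S₂ + suc (32 * g₀)
    near₃ {S₂} c₂ h {f} cf = ≤-trans (s≤s (*-cancelˡ-≤ d₀ {{>-nonZero (*-mono-≤ (*-mono-≤ 1≤g 1≤g) 1≤g)}}
        (lin 0 (+-mono-≤ (h cf) (≤-trans (bounded S₂ (proj₁ c₂)) cap≤)) (eq g₀ (card f) (card S₂)))))
        (≤-reflexive (sym (+-suc (card S₂) (32 * g₀))))
      where
      eq : ∀ g f s → g * g * g * f + (g * g * g * s + s + 32 * (g * g * g * g)) + 0 ≡ g * g * g * (s + 32 * g) + (g * g * g * f + s)
      eq = solve-∀

    enough₃ : 2 * cap < 2 ^ (e ρ + e ρ) * (64 * (g₀ * g₀))
    enough₃ = subst (λ x → 2 * cap < x * (64 * (g₀ * g₀))) (sym 2^j)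
      (lin 3 (*-monoʳ-≤ 4 ρ<) (eq g₀ ρ))
      where
      eq : ∀ g ρ → suc (2 * (2 * suc ρ)) + 4 * (16 * (g * g * g * g)) + 3 ≡ g * g * (64 * (g * g)) + 4 * suc (suc ρ)
      eq = solve-∀

    d≤n : d₀ ≤ n
    d≤n = ≤-trans (≤-trans (≤-reflexive (sym (*-identityʳ d₀))) (*-monoʳ-≤ d₀ 1≤g))
      (≤-trans q₄≤ (≤-trans (≤-reflexive (sym cardX)) (card-≤n X)))

    open Costs n L m g₀ 1≤n 1≤g using (V; phase1-cost; phase2-cost; phase3-cost)

    maximize-ok : Ok (maximize ρ) (λ S q → ∃ λ f → S ≡ tabulate f × Maximum f × g₀ ^ 4 ≤ card f ×
                    q ≤ (569 + 33 * (771 + 68 * m)) * V) (2112 * (n * n))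
    maximize-ok = ok-mono (λ _ _ h → h) errors
      (ok-bind (phase1-ok g₀ (g₀ * g₀) (64 * d₀) cap bounded enough₁) λ { S₁ k₁ ((c₁ , h₁) , le₁) →
       ok-bind (Phase2Loop.phase2-ok d₀ L (33 * d₀) n≤2^L S₁ c₁ (near₂ c₁ h₁)) λ { S₂ k₂ ((c₂ , h₂) , le₂) →
       ok-bind (phase3-ok (64 * (g₀ * g₀)) (suc (32 * g₀)) cap S₂ c₂ bounded enough₃ (near₃ c₂ h₂)) λ { S₃ k₃ ((c₃ , h₃) , le₃) →
       ok-ret (S₃ , refl , (from-common c₃ , λ cT → h₃ (to-common cT)) , large S₃ h₃ , total k₁ k₂ k₃ le₁ le₂ le₃) } } })
      where
      large : ∀ S₃ → (∀ {T} → Common T → card T ≤ card S₃) → g₀ ^ 4 ≤ card S₃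
      large S₃ h₃ = ≤-trans (≤-reflexive (trans (sym (16^ (e ρ))) 16^≡q₄))
        (≤-trans q₄≤ (≤-trans (≤-reflexive (sym cardX)) (h₃ (to-common cX))))
      total : ∀ k₁ k₂ k₃ → k₁ ≤ _ → k₂ ≤ _ → k₃ ≤ _ → k₁ + (k₂ + (k₃ + 0)) ≤ (569 + 33 * (771 + 68 * m)) * V
      total k₁ k₂ k₃ p₁ p₂ p₃ = lin 0 (+-mono-≤ (≤-trans p₁ phase1-cost) (+-mono-≤ (≤-trans p₂ (phase2-cost d≤n))
          (≤-trans p₃ (≤-trans (≤-reflexive (cong cost₃ 2^j)) (phase3-cost tests≤)))))
          (eq k₁ k₂ k₃ (33 * (771 + 68 * m)) V)
        where
        cost₃ : ℕ → ℕ
        cost₃ x = (2 * n + (64 * (g₀ * g₀) * (tests * n + (n + 2 * L * n) + (1 + 2 * L * n)) + (1 + 2 * L * ((tests + tests) * x)) * n +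
                   6 * (64 * (g₀ * g₀) * n))) * suc (32 * g₀)
        eq : ∀ a b c k V → a + (b + (c + 0)) + (257 * V + (312 * V + k * V)) + 0 ≡ (569 + k) * V + (a + (b + c))
        eq = solve-∀
      -- Only classifications can fail: at most 33 g augmentations, each with 64 g² rounds of at
      -- most n classifications, give 2112 g³ n, and g³ ≤ n.
      errors : 64 * d₀ * 0 + (fuel₂ ρ * 0 + (suc (32 * g₀) * (64 * (g₀ * g₀) * n) + 0)) ≤ 2112 * (n * n)
      errors = begin
        64 * d₀ * 0 + (fuel₂ ρ * 0 + (suc (32 * g₀) * (64 * (g₀ * g₀) * n) + 0)) ≡⟨ eq₀ (64 * d₀) (fuel₂ ρ) (suc (32 * g₀) * (64 * (g₀ * g₀) * n)) ⟩
        suc (32 * g₀) * (64 * (g₀ * g₀) * n)    ≤⟨ *-monoˡ-≤ (64 * (g₀ * g₀) * n) (+-monoˡ-≤ (32 * g₀) 1≤g) ⟩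
        (g₀ + 32 * g₀) * (64 * (g₀ * g₀) * n)   ≡⟨ eq₁ g₀ n ⟩
        2112 * (d₀ * n)                         ≤⟨ *-monoʳ-≤ 2112 (*-monoˡ-≤ n d≤n) ⟩
        2112 * (n * n)                          ∎
        where
        open ≤-Reasoning
        eq₀ : ∀ a b c → a * 0 + (b * 0 + (c + 0)) ≡ c
        eq₀ = solve-∀
        eq₁ : ∀ g n → (g + 32 * g) * (64 * (g * g) * n) ≡ 2112 * (g * g * g * n)
        eq₁ = solve-∀

  open Specs (pair I₁ I₂) (½^ tests) (0≤½^ tests) rawQuery J J-mat raw-ok using (scan-ok; Scanned; module M; Sp)

  -- Elements rejected by the second matroid are spanned by `X` there, and all others are spanned by
  -- `X` in the first, so each of the two parts of `T` is at most as large as `X`.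
  greedy-half : ∀ {X R} → Scanned ∅ ∅ (elems full) ∅ ∅ X R → ∀ {T} → Com T → card T ≤ 2 * card X
  greedy-half {X} {R} sc {T} (j₁ , j₂) = begin
    card T                       ≡⟨ card-split T R ⟩
    card (T ∩ R) + card (T ∖ R)  ≤⟨ +-mono-≤
      (M.rank-≤ true Sc.ind₂ (M.down true (∩-ˡ T R) j₂) λ x h → inj₂ (Sc.rejected x (∩-ʳ T R x h)))
      (M.rank-≤ false Sc.ind₁ (M.down false (∖-ˡ T R) j₁) λ x h → other x (Sc.covered x (in-elems full x refl)) (∖-ʳ T R h)) ⟩
    card (∅ ∪ X) + card (∅ ∪ X)  ≤⟨ +-mono-≤ le le ⟩
    card X + card X              ≡⟨ cong (card X +_) (+-identityʳ (card X)) ⟨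
    2 * card X                   ∎
    where
    open ≤-Reasoning
    module Sc = Scanned sc
    other : ∀ x → x ∈ R ⊎ Sp false (∅ ∪ X) x → x ∉ R → Sp false (∅ ∪ X) x
    other x (inj₁ h) k = true≢false h k
    other x (inj₂ h) k = h
    le : card (∅ ∪ X) ≤ card X
    le = card-mono (∪-lub (λ _ ()) λ _ h → h)

  full-length : length (elems {n} full) ≤ n
  full-length = ≤-trans (≤-reflexive (length-elems full)) (card-≤n full)

  algorithm-ok : Ok algorithm Solved (2112 * (n * n))
  algorithm-ok = ok-bind (scan-ok ∅ ∅ (elems full) ∅ ∅ (M.down false (∪-lub (λ _ h → h) λ _ h → h) (M.J∅ false))
                    (M.down true (∪-lub (λ _ h → h) λ _ h → h) (M.J∅ true)) λ _ ())
    λ { (X , R) k (sc , ck) → go X R k sc (≤-trans ck (*-monoʳ-≤ 2 full-length)) (card X) refl }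
    where
    go : ∀ X R k → Scanned ∅ ∅ (elems full) ∅ ∅ X R → k ≤ 2 * n → ∀ s → card X ≡ s →
         Ok (fromGreedy s X) (λ S q → Solved S (k + q)) (2112 * (n * n))
    go X R k sc ck s e = cases s e
      where
      cX : Com X
      cX = M.down false (∪-ʳ ∅ X) (Scanned.ind₁ sc) , M.down true (∪-ʳ ∅ X) (Scanned.ind₂ sc)
      2n≤ : ∀ {V} → n ≤ V → k ≤ 2 * V
      2n≤ h = ≤-trans ck (*-monoʳ-≤ 2 h)
      n≤V : ∀ g → 1 ≤ g → n ≤ n * (g * g * g) * Λ²
      n≤V g h = ≤-trans (≤-trans (≤-reflexive (sym (*-identityʳ n))) (*-monoʳ-≤ n (*-mono-≤ (*-mono-≤ h h) h)))
        (≤-trans (≤-reflexive (sym (*-identityʳ (n * (g * g * g))))) (*-monoʳ-≤ (n * (g * g * g)) {1} {Λ²} (s≤s z≤n)))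
      2≤κ : 2 ≤ costFactor m
      2≤κ = ≤-trans {2} {571} {costFactor m} (s≤s (s≤s z≤n)) (m≤m+n 571 (33 * (771 + 68 * m)))
      cases : ∀ s → card X ≡ s → Ok (fromGreedy s X) (λ S q → Solved S (k + q)) (2112 * (n * n))
      cases zero e = ok-ret (X , refl , (cX , λ cT → ≤-trans (greedy-half sc cT) (≤-trans (≤-reflexive (trans (cong (2 *_) e) refl)) z≤n)) ,
        1 , inj₁ refl , ≤-trans (≤-reflexive (+-identityʳ k)) (≤-trans (2n≤ (n≤V 1 ≤-refl)) (*-monoˡ-≤ (n * (1 * 1 * 1) * Λ²) 2≤κ)))
      cases (suc ρ) e = ok-weaken (λ { S q (f , eS , mf , gf , le) → f , eS , mf , g ρ , inj₂ gf ,
          lin 0 (+-mono-≤ (2n≤ (n≤V (g ρ) (m^n>0 2 (proj₁ (root ρ))))) le) (eq k q (33 * (771 + 68 * m)) (n * (g ρ * g ρ * g ρ) * Λ²)) })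
        (maximize-ok ρ X cX e λ cT → ≤-trans (greedy-half sc cT) (≤-reflexive (cong (2 *_) e)))
        where
        eq : ∀ k q x V → k + q + (2 * V + (569 + x) * V) + 0 ≡ (571 + x) * V + (k + q)
        eq = solve-∀

opaque
  -- Enough tests for a union bound over all classifications.
  testCount : ℕ → ℕ → ℕ
  testCount c L = 12 + L * (2 + c)

  testCount≤ : ∀ c L → testCount c L ≤ (14 + c) * suc L
  testCount≤ c L = lin (2 * L + 10 * L + 2 + c) (z≤n {0}) (eq L c)
    where
    eq : ∀ L c → 12 + L * (2 + c) + 0 + (2 * L + 10 * L + 2 + c) ≡ (14 + c) * suc L + 0
    eq = solve-∀

  -- The 12 in `testCount` covers 2112 ≤ 2^12, and L (2 + c) covers the n² bad events together with
  -- the required failure probability n^-c.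
  union-bound : ∀ n c L → n ≤ 2 ^ L → 2112 * (n * n) * n ^ c ≤ 2 ^ testCount c L
  union-bound n c L h = ≤-trans (≤-reflexive (regroup n (n ^ c)))
    (≤-trans (*-mono-≤ 2112≤ (≤-trans (^-monoˡ-≤ (2 + c) h) (≤-reflexive (^-*-assoc 2 L (2 + c)))))
             (≤-reflexive (sym (^-distribˡ-+-* 2 12 (L * (2 + c))))))
    where
    regroup : ∀ n x → 2112 * (n * n) * x ≡ 2112 * (n * (n * x))
    regroup n x = trans (*-assoc 2112 (n * n) x) (cong (2112 *_) (*-assoc n n x))
    2112≤ : 2112 ≤ 2 ^ 12
    2112≤ = ≤ᵇ⇒≤ 2112 (2 ^ 12) _

fail-bound : ∀ E M N → E * N ≤ 2 ^ M → (toℚ E *ℚ ½^ M) *ℚ toℚ N ≤ℚ 1ℚ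
fail-bound E M N h = begin
  (toℚ E *ℚ ½^ M) *ℚ toℚ N  ≡⟨ swap (toℚ E) (½^ M) (toℚ N) ⟩
  (toℚ E *ℚ toℚ N) *ℚ ½^ M  ≡⟨ cong (_*ℚ ½^ M) (toℚ-* E N) ⟨
  toℚ (E * N) *ℚ ½^ M       ≤⟨ ℚP.*-monoʳ-≤-nonNeg (½^ M) {{nonNegative (0≤½^ M)}} (toℚ-mono h) ⟩
  toℚ (2 ^ M) *ℚ ½^ M       ≡⟨ 2^*½^ M ⟩
  1ℚ                        ∎
  where
  open ℚP.≤-Reasoning
  open +-*-Solver using () renaming (solve to solveℚ; _:*_ to _⊗_; _:=_ to _⊜_)
  swap : ∀ a b c → (a *ℚ b) *ℚ c ≡ (a *ℚ c) *ℚ b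
  swap = solveℚ 3 (λ a b c → (a ⊗ b) ⊗ c ⊜ (a ⊗ c) ⊗ b) refl

failure-≤ : ∀ (p E N : ℚ) → 0ℚ ≤ℚ N → 1ℚ ≤ℚ p +ℚ E → E *ℚ N ≤ℚ 1ℚ → (1ℚ - p) *ℚ N ≤ℚ 1ℚ
failure-≤ p E N N≥0 h k = ℚP.≤-trans (ℚP.*-monoʳ-≤-nonNeg N {{nonNegative N≥0}}
    (subst (1ℚ - p ≤ℚ_) (cancel p E) (ℚP.+-monoˡ-≤ (Data.Rational.- p) h))) k
  where
  open +-*-Solver using () renaming (solve to solveℚ; _:+_ to _⊕'_; _:-_ to _⊖'_; _:=_ to _⊜_)
  cancel : ∀ p e → (p +ℚ e) - p ≡ e
  cancel = solveℚ 2 (λ p e → (p ⊕' e) ⊖' p ⊜ e) refl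

log-total : ∀ n → ∃ λ L → n ≤ 2 ^ L × (1 ≤ n → 2 ^ L ≤ 2 * n)
log-total zero = 0 , z≤n , λ ()
log-total (suc n) with log-up n
... | L , lo , hi = L , lo , λ _ → hi

within-budget : ∀ {κ C n g Λ q r l} → q ≤ κ * (n * (g * g * g) * (Λ * Λ)) → g ^ 4 ≤ r → g ^ 3 * Λ ^ 10 ≤ C * n →
                q ^ 5 ≤ κ ^ 5 * C * n ^ 6 * r ^ 3 * suc l ^ 4
within-budget {κ} {C} {n} {g} {Λ} {q} {r} {l} hq hr hl =
  ≤-trans (fifth-power {κ} {n} {g} {Λ} {q} {C} {r} (≤-trans hq (≤-reflexive (cong (κ *_) (eq n g Λ)))) hr hl)
    (≤-trans (≤-reflexive (sym (*-identityʳ (κ ^ 5 * C * n ^ 6 * r ^ 3)))) (*-monoʳ-≤ (κ ^ 5 * C * n ^ 6 * r ^ 3) (m^n>0 (suc l) 4)))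
  where
  eq : ∀ n g l → n * (g * g * g) * (l * l) ≡ n * (g * (g * (g * 1)) * (l * (l * 1)))
  eq = solve-∀

algorithmFor : ℕ → (n : ℕ) → Prog n (Subset n)
algorithmFor c n = Algorithm.algorithm n (testCount c (proj₁ (log-total n))) (proj₁ (log-total n))

constant : ℕ → ℕ
constant c = costFactor (14 + c) ^ 5 * proj₁ polylog

module _ (c n : ℕ) (1≤n : 1 ≤ n) {I₁ I₂ : Subset n → Bool} (m₁ : IsMatroid I₁) (m₂ : IsMatroid I₂)
  (r : ℕ) (opt : IsMaxCommonSize I₁ I₂ r) where

  L : ℕ
  L = proj₁ (log-total n)

  n≤2^L : n ≤ 2 ^ L
  n≤2^L = proj₁ (proj₂ (log-total n))

  open Correctness (14 + c) (testCount c L) L 1≤n n≤2^L (testCount≤ c L) m₁ m₂ using (algorithm-ok; Solved; Com)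

  goal : Subset n → ℕ → Bool
  goal S q = I₁ S ∧ I₂ S ∧ (∣ S ∣ ≡ᵇ r) ∧ (q ^ 5 ≤ᵇ constant c * n ^ 6 * (r ⊔ 1) ^ 3 * (suc ⌊log₂ r ⌋) ^ 4)

  solved-goal : ∀ S q → Solved S q → goal S q ≡ true
  solved-goal S q (f , refl , ((j₁ , j₂) , best) , g , large , le) =
    ∧-intro j₁ (∧-intro j₂ (∧-intro (T-true (≡⇒≡ᵇ ∣ tabulate f ∣ r size)) (≤ᵇ-in {n}
      (within-budget {costFactor (14 + c)} {proj₁ polylog} {n} {g} {suc L} {q} {r ⊔ 1} {⌊log₂ r ⌋} le (g⁴≤ large)
        (proj₂ polylog n L g (proj₂ (proj₂ (log-total n)) 1≤n) (≤-trans (g⁴≤ large) r≤n))))))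
    where
    S₀ : Subset n
    S₀ = proj₁ (proj₁ opt)
    size : ∣ tabulate f ∣ ≡ r
    size = ≤-antisym (proj₂ opt (tabulate f) (j₁ , j₂)) (begin
      r                        ≡⟨ proj₂ (proj₂ (proj₁ opt)) ⟨
      ∣ S₀ ∣                   ≡⟨ cong ∣_∣ (tabulate∘lookup S₀) ⟨
      ∣ tabulate (lookup S₀) ∣ ≡⟨ card-tabulate (lookup S₀) ⟩
      card (lookup S₀)         ≤⟨ best (subst (λ X → I₁ X ≡ true × I₂ X ≡ true) (sym (tabulate∘lookup S₀)) (proj₁ (proj₂ (proj₁ opt)))) ⟩
      card f                   ≡⟨ card-tabulate f ⟨
      ∣ tabulate f ∣           ∎)
      where open ≤-Reasoning
    cardf : card f ≡ r
    cardf = trans (sym (card-tabulate f)) size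
    g⁴≤ : g ≡ 1 ⊎ g ^ 4 ≤ card f → g ^ 4 ≤ r ⊔ 1
    g⁴≤ (inj₁ refl) = m≤n⊔m r 1
    g⁴≤ (inj₂ h)    = ≤-trans h (≤-trans (≤-reflexive cardf) (m≤m⊔n r 1))
    r≤n : r ⊔ 1 ≤ n
    r≤n = ⊔-lub (≤-trans (≤-reflexive (sym cardf)) (card-≤n f)) 1≤n

  success : 1ℚ ≤ℚ Pr I₁ I₂ goal (compile (algorithmFor c n)) +ℚ (toℚ (2112 * (n * n)) *ℚ ½^ (testCount c L))
  success = Err.err-probRun (pair I₁ I₂) goal 0 (algorithmFor c n) solved-goal (Logic.err algorithm-ok)

theorem4p6 : (c : ℕ) →
    ∃ λ (C : ℕ) → ∃ λ (n₀ : ℕ) → ∃ λ (A : (n : ℕ) → QTree n) →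
    ∀ (n : ℕ) → n₀ ≤ n →
    (I₁ I₂ : Subset n → Bool) → IsMatroid I₁ → IsMatroid I₂ →
    (r : ℕ) → IsMaxCommonSize I₁ I₂ r →
    ((1ℚ - Pr I₁ I₂
    (λ S q → I₁ S ∧ I₂ S ∧ (∣ S ∣ ≡ᵇ r)
    ∧ (q ^ 5 ≤ᵇ C Data.Nat.* n ^ 6 Data.Nat.* (r ⊔ 1) ^ 3
    Data.Nat.* (suc ⌊log₂ r ⌋) ^ 4))
    (A n))
    *ℚ toℚ (n ^ c)) ≤ℚ 1ℚ
-- The threshold n₀ = 1 excludes the empty ground set, for which `2 ^ L ≤ 2 * n` fails. The tree
-- depends only on `c` and n, as r is estimated during the run.
theorem4p6 c = constant c , 1 , (λ n → compile (algorithmFor c n)) , λ n 1≤n I₁ I₂ m₁ m₂ r opt →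
  failure-≤ (Pr I₁ I₂ (goal c n 1≤n m₁ m₂ r opt) (compile (algorithmFor c n)))
    (toℚ (2112 * (n * n)) *ℚ ½^ (testCount c (proj₁ (log-total n)))) (toℚ (n ^ c)) (0≤toℚ (n ^ c)) (success c n 1≤n m₁ m₂ r opt)
    (fail-bound (2112 * (n * n)) (testCount c (proj₁ (log-total n))) (n ^ c)
      (union-bound n c (proj₁ (log-total n)) (proj₁ (proj₂ (log-total n)))))
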